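{- For every two positive integers $k$ and $\ell$, Fair $k$-Division Under Conflicts is solvable in time $\mathcal{O}\left(4^{k\ell}|\sigma|(Q+1)^{2k}\right)$ if the conflict graph $G$ has clique-width at most $\ell$ and is given by an $\ell$-expression $\sigma$, where $Q=\max_{1\le j\le k}p_j(V(G))$.
   Context: All graphs are finite, simple and undirected. $\mathbb{Z}_+$ denotes the set of nonnegative integers (profits may be $0$). The number $k$ is a fixed constant (not part of the input). A partial $k$-coloring of a graph $G$ is a sequence $(X_1,\ldots,X_k)$ of $k$ pairwise disjoint (possibly empty) independent sets in $G$; not all vertices need to be covered. Fair $k$-Division Under Conflicts is the following problem. Input: a graph $G=(V,E)$ (the conflict graph) and $k$ profit functions $p_1,\ldots,p_k:V\to\mathbb{Z}_+$. Task: compute a partial $k$-coloring of $G$ with maximum satisfaction level, where the satisfaction level of $(X_1,\ldots,X_k)$ is $\min_{1\le j\le k}p_j(X_j)$ and $p_j(X)=\sum_{v\in X}p_j(v)$ for $X\subseteq V$. A labeled graph is a graph in which every vertex is assigned some label from $\mathbb{N}$; it is $\ell$-labeled if all labels belong to $[\ell]=\{1,\ldots,\ell\}$. The clique-width of a graph $G$ is the smallest positive integer $\ell$ such that an $\ell$-labeled graph isomorphic to $G$ can be constructed with the following operations: (1) $i(v)$: creating a new one-vertex graph with vertex $v$ labeled $i$; (2) $G_1\oplus G_2$: disjoint union of two already constructed labeled graphs $G_1$ and $G_2$; (3) $\eta_{i,j}$, for $i\ne j$: adding all edges between vertices labeled $i$ and vertices labeled $j$; (4) $\rho_{i\to j}$,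 for $i\neq j$: relabeling every vertex labeled $i$ with label $j$. A construction of a graph by these operations is represented by an algebraic expression, called an $\ell$-expression if it uses at most $\ell$ labels. For an $\ell$-expression $\sigma$, $|\sigma|$ denotes its encoding length. -}

module Defs where

open import Algebra.Properties.CommutativeMonoid.Sum using (sum)
open import Data.Bool using (Bool; true; false; if_then_else_)
open import Data.Empty using (⊥)
open import Data.Fin using (Fin; zero; suc; toℕ)
import Data.Fin as Fin
open import Data.Fin.Subset using (Subset; _∈_; _∩_; Empty) renaming (⊤ to full)
open import Data.List using (List; []; _∷_; _++_; length; concat)
import Data.List as List
open import Data.Nat using (ℕ; zero; suc; _+_; _∸_; _≤_; _⊓_; _⊔_; NonZero)
import Data.Nat as ℕ
open import Data.Nat.Properties using (+-0-commutativeMonoid)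
open import Data.Product using (Σ; ∃-syntax; _×_; _,_)
open import Data.Sum using (_⊎_; inj₁; inj₂; [_,_])
open import Data.Unit using (⊤)
import Data.Vec as Vec
open import Function using (_∘_; _⇔_; Bijective)
open import Relation.Binary.PropositionalEquality using (_≡_; _≢_; refl; sym; trans)
open import Relation.Nullary using (¬_)
open import Relation.Nullary.Decidable using (does)

record Graph (V : Set) : Set₁ where
  field
    _~_     : V → V → Set
    ~-sym   : ∀ {u v} → u ~ v → v ~ u
    ~-irrefl : ∀ {v} → ¬ (v ~ v)

record IsIsomorphism {V W : Set} (G : Graph V) (H : Graph W) (f : V → W) : Set where
  private
    module G = Graph G
    module H = Graph H
  field
    bijective : Bijective _≡_ _≡_ f
    adjacency : ∀ u v → (u G.~ v) ⇔ (f u H.~ f v)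

-- The label set [ℓ] is Fin ℓ.
record LabeledGraph (ℓ : ℕ) : Set₁ where
  field
    V     : Set
    graph : Graph V
    label : V → Fin ℓ
  open Graph graph public

module _ {ℓ : ℕ} where

  single : Fin ℓ → LabeledGraph ℓ
  single i = record
    { V     = ⊤
    ; graph = record { _~_ = λ _ _ → ⊥ ; ~-sym = λ () ; ~-irrefl = λ () }
    ; label = λ _ → i
    }

  disjointUnion : LabeledGraph ℓ → LabeledGraph ℓ → LabeledGraph ℓ
  disjointUnion G₁ G₂ = record
    { V     = G₁.V ⊎ G₂.V
    ; graph = record
      { _~_      = adj
      ; ~-sym    = λ {u} {v} → adj-sym u v
      ; ~-irrefl = λ {v} → adj-irrefl v
      }
    ; label = [ G₁.label , G₂.label ]
    }
    where
    module G₁ = LabeledGraph G₁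
    module G₂ = LabeledGraph G₂

    adj : G₁.V ⊎ G₂.V → G₁.V ⊎ G₂.V → Set
    adj (inj₁ u) (inj₁ v) = u G₁.~ v
    adj (inj₂ u) (inj₂ v) = u G₂.~ v
    adj (inj₁ _) (inj₂ _) = ⊥
    adj (inj₂ _) (inj₁ _) = ⊥

    adj-sym : ∀ u v → adj u v → adj v u
    adj-sym (inj₁ _) (inj₁ _) = G₁.~-sym
    adj-sym (inj₂ _) (inj₂ _) = G₂.~-sym
    adj-sym (inj₁ _) (inj₂ _) ()
    adj-sym (inj₂ _) (inj₁ _) ()

    adj-irrefl : ∀ v → ¬ adj v v
    adj-irrefl (inj₁ _) = G₁.~-irrefl
    adj-irrefl (inj₂ _) = G₂.~-irrefl

  join : (i j : Fin ℓ) → i ≢ j → LabeledGraph ℓ → LabeledGraph ℓ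
  join i j i≢j G = record
    { V     = V
    ; graph = record
      { _~_      = λ u v → u ~ v ⊎ (label u ≡ i × label v ≡ j) ⊎ (label u ≡ j × label v ≡ i)
      ; ~-sym    = λ where
          (inj₁ e)              → inj₁ (~-sym e)
          (inj₂ (inj₁ (a , b))) → inj₂ (inj₂ (b , a))
          (inj₂ (inj₂ (a , b))) → inj₂ (inj₁ (b , a))
      ; ~-irrefl = λ where
          (inj₁ e)              → ~-irrefl e
          (inj₂ (inj₁ (a , b))) → i≢j (trans (sym a) b)
          (inj₂ (inj₂ (a , b))) → i≢j (trans (sym b) a)
      }
    ; label = label
    }
    where open LabeledGraph G

  relabel : (i j : Fin ℓ) → i ≢ j → LabeledGraph ℓ → LabeledGraph ℓ
  relabel i j _ G = record
    { V     = V
    ; graph = graph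
    ; label = λ v → if does (label v Fin.≟ i) then j else label v
    }
    where open LabeledGraph G

-- The leaf `vertex i v` is the operation i(v); leaves carry names in Fin n.
data Expression (ℓ n : ℕ) : Set where
  vertex : Fin ℓ → Fin n → Expression ℓ n
  _⊕_    : Expression ℓ n → Expression ℓ n → Expression ℓ n
  η ρ    : (i j : Fin ℓ) → i ≢ j → Expression ℓ n → Expression ℓ n

module _ {ℓ n : ℕ} where

  ⟦_⟧ : Expression ℓ n → LabeledGraph ℓ
  ⟦ vertex i _ ⟧ = single i
  ⟦ σ ⊕ τ ⟧      = disjointUnion ⟦ σ ⟧ ⟦ τ ⟧
  ⟦ η i j i≢j σ ⟧ = join i j i≢j ⟦ σ ⟧
  ⟦ ρ i j i≢j σ ⟧ = relabel i j i≢j ⟦ σ ⟧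

  name : (σ : Expression ℓ n) → LabeledGraph.V ⟦ σ ⟧ → Fin n
  name (vertex _ v) _ = v
  name (σ ⊕ τ)        = [ name σ , name τ ]
  name (η _ _ _ σ)    = name σ
  name (ρ _ _ _ σ)    = name σ

  -- σ constructs G itself: every vertex of G is named by exactly one leaf,
  -- and naming identifies the constructed graph with G.
  _Constructs_ : Expression ℓ n → Graph (Fin n) → Set
  σ Constructs G = IsIsomorphism (LabeledGraph.graph ⟦ σ ⟧) G (name σ)

  -- Reverse Polish notation, one machine word per symbol.
  encode : Expression ℓ n → List ℕ
  encode (vertex i v) = 0 ∷ toℕ i ∷ toℕ v ∷ []
  encode (σ ⊕ τ)      = encode σ ++ encode τ ++ 1 ∷ []
  encode (η i j _ σ)  = encode σ ++ 2 ∷ toℕ i ∷ toℕ j ∷ []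
  encode (ρ i j _ σ)  = encode σ ++ 3 ∷ toℕ i ∷ toℕ j ∷ []

  ∣_∣ᵉ : Expression ℓ n → ℕ
  ∣ σ ∣ᵉ = length (encode σ)

Constructible : ∀ {n} → ℕ → Graph (Fin n) → Set
Constructible {n} ℓ G =
  Σ (Expression ℓ n) λ τ → ∃[ f ] IsIsomorphism (LabeledGraph.graph ⟦ τ ⟧) G f

record IsCliqueWidth {n : ℕ} (G : Graph (Fin n)) (w : ℕ) : Set where
  field
    positive      : 1 ≤ w
    constructible : Constructible w G
    least         : ∀ m → 1 ≤ m → Constructible m G → w ≤ m

CliqueWidth≤ : ∀ {n} → Graph (Fin n) → ℕ → Set
CliqueWidth≤ G ℓ = ∃[ w ] (IsCliqueWidth G w × w ≤ ℓ)

fold₁ : (ℕ → ℕ → ℕ) → ∀ {k} → .{{NonZero k}} → (Fin k → ℕ) → ℕ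
fold₁ _∙_ {suc zero}    f = f zero
fold₁ _∙_ {suc (suc k)} f = f zero ∙ fold₁ _∙_ (f ∘ suc)

min max : ∀ {k} → .{{NonZero k}} → (Fin k → ℕ) → ℕ
min = fold₁ _⊓_
max = fold₁ _⊔_

module _ {k n : ℕ} where

  record IsPartialColoring (G : Graph (Fin n)) (X : Fin k → Subset n) : Set where
    open Graph G
    field
      disjoint    : ∀ i j → i ≢ j → Empty (X i ∩ X j)
      independent : ∀ i u v → u ∈ X i → v ∈ X i → ¬ (u ~ v)

  total : (Fin n → ℕ) → Subset n → ℕ
  total f X = sum +-0-commutativeMonoid λ v → if Vec.lookup X v then f v else 0

  satisfaction : .{{NonZero k}} → (Fin k → Fin n → ℕ) → (Fin k → Subset n) → ℕ
  satisfaction p X = min λ j → total (p j) (X j)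

  record IsOptimal .{{_ : NonZero k}} (G : Graph (Fin n)) (p : Fin k → Fin n → ℕ)
                   (X : Fin k → Subset n) : Set where
    field
      coloring : IsPartialColoring G X
      maximal  : ∀ Y → IsPartialColoring G Y → satisfaction p Y ≤ satisfaction p X

  maxProfit : .{{NonZero k}} → (Fin k → Fin n → ℕ) → ℕ
  maxProfit p = max λ j → total (p j) full

-- Random access machine with uniform cost.  As in Cook and Reckhow's model the
-- only arithmetic is addition and (truncated) subtraction: multiplication at
-- unit cost on unbounded words would be unrealistically powerful.
record State : Set where
  constructor ⟨_,_⟩
  field
    reg : ℕ → ℕ
    mem : ℕ → ℕ
open State public

infixl 6 _⊞_ _⊟_
data Term : Set where
  lit     : ℕ → Term
  var     : ℕ → Term
  load    : Term → Term
  _⊞_ _⊟_ : Term → Term → Term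

infix  4 _≔_ [_]≔_
infixr 3 _⨾_
data Program : Set where
  skip    : Program
  _≔_     : ℕ → Term → Program
  [_]≔_   : Term → Term → Program
  _⨾_     : Program → Program → Program
  ifnz_then_else_ : Term → Program → Program → Program
  whilenz_loop_   : Term → Program → Program

value : Term → State → ℕ
value (lit c)  s = c
value (var r)  s = reg s r
value (load a) s = mem s (value a s)
value (a ⊞ b)  s = value a s + value b s
value (a ⊟ b)  s = value a s ∸ value b s

cost : Term → ℕ
cost (lit _)  = 1
cost (var _)  = 1
cost (load a) = 1 + cost a
cost (a ⊞ b)  = 1 + cost a + cost b
cost (a ⊟ b)  = 1 + cost a + cost b

_[_↦_] : (ℕ → ℕ) → ℕ → ℕ → (ℕ → ℕ)
(f [ a ↦ x ]) b = if does (b ℕ.≟ a) then x else f b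

-- Run P s s′ t: started in s, P halts in s′ after t steps.
data Run : Program → State → State → ℕ → Set where
  run-skip : ∀ {s} → Run skip s s 1

  run-≔ : ∀ {r e s} →
    Run (r ≔ e) s ⟨ reg s [ r ↦ value e s ] , mem s ⟩ (1 + cost e)

  run-[]≔ : ∀ {a e s} →
    Run ([ a ]≔ e) s ⟨ reg s , mem s [ value a s ↦ value e s ] ⟩ (1 + cost a + cost e)

  run-⨾ : ∀ {P Q s s′ s″ t t′} →
    Run P s s′ t → Run Q s′ s″ t′ → Run (P ⨾ Q) s s″ (t + t′)

  run-then : ∀ {e P Q s s′ t} → value e s ≢ 0 →
    Run P s s′ t → Run (ifnz e then P else Q) s s′ (1 + cost e + t)

  run-else : ∀ {e P Q s s′ t} → value e s ≡ 0 →
    Run Q s s′ t → Run (ifnz e then P else Q) s s′ (1 + cost e + t)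

  run-exit : ∀ {e P s} → value e s ≡ 0 →
    Run (whilenz e loop P) s s (1 + cost e)

  run-loop : ∀ {e P s s′ s″ t t′} → value e s ≢ 0 →
    Run P s s′ t → Run (whilenz e loop P) s′ s″ t′ →
    Run (whilenz e loop P) s s″ (1 + cost e + t + t′)

word : List ℕ → ℕ → ℕ
word []       _       = 0
word (x ∷ xs) zero    = x
word (x ∷ xs) (suc i) = word xs i

-- The input occupies the memory from address 0 on, with its length in register 0.
initial : List ℕ → State
initial ws = ⟨ (λ _ → 0) [ 0 ↦ length ws ] , word ws ⟩

-- The output starts at the address in register 0 and has its length in register 1.
record Outputs (s : State) (ws : List ℕ) : Set where
  field
    size  : reg s 1 ≡ length ws
    words : ∀ i → mem s (reg s 0 + toℕ i) ≡ List.lookup ws i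

-- The number of vertices, the k profit functions, and the expression.  The graph
-- itself is not part of the input.
inputWords : ∀ {k ℓ n} → (Fin k → Fin n → ℕ) → Expression ℓ n → List ℕ
inputWords {n = n} p σ =
  n ∷ concat (List.tabulate λ j → List.tabulate (p j)) ++ encode σ

bit : Bool → ℕ
bit b = if b then 1 else 0

-- The characteristic vectors of X₁, …, Xₖ, one after another.
outputWords : ∀ {k n} → (Fin k → Subset n) → List ℕ
outputWords X = concat (List.tabulate λ j → List.map bit (Vec.toList (X j)))

record SolvesWithin {k ℓ n : ℕ} .{{_ : NonZero k}} (P : Program) (G : Graph (Fin n))
                    (σ : Expression ℓ n) (p : Fin k → Fin n → ℕ) (bound : ℕ) : Set where
  field
    final   : State
    steps   : ℕ
    run     : Run P (initial (inputWords p σ)) final steps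
    inTime  : steps ≤ bound
    X       : Fin k → Subset n
    output  : Outputs final (outputWords X)
    optimal : IsOptimal G p X

{-# OPTIONS --safe #-}

-- Dynamic programming over the expression.  For a family L = (L₁ , … , Lₖ) of
-- label sets, consider the partial colorings of a subexpression in which every
-- label occurring in class c belongs to L_c.  Because "belongs to" is only an
-- inclusion, a disjoint union combines solutions for one and the same L, which
-- leaves 2^{kℓ} families instead of 4^{kℓ} pairs and pays for all bookkeeping.
-- A relabelling is a table lookup at the preimage of L, and a join of i and j
-- takes the union over the 2^k ways to drop i or j from each L_c.
--
-- The profit vector of a coloring is a single number, written in the mixed radix
-- with bases 1 + p_c(V): the codes are then less than ∏ (1 + p_c(V)) ≤ (Q + 1)^k,
-- adding vectors is adding codes, and the satisfaction level is recovered by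
-- repeated subtraction.  A table entry points to the two entries it was combined
-- from, so an optimal coloring is read off by traversing a binary tree.
module Submission where

open import Defs
open import Algebra.Properties.CommutativeMonoid.Sum using (sum; ∑-distrib-+; sum-cong-≗; sum-replicate-zero)
open import Data.Bool using (Bool; true; false; if_then_else_; _∧_; _∨_; not)
import Data.Bool as Bool
open import Data.Bool.Properties using (¬-not)
open import Data.Fin using (Fin; zero; suc; toℕ; combine; remQuot; funToFin; finToFun)
import Data.Fin as Fin
open import Data.Fin.Properties using (finToFun-funToFin; remQuot-combine; toℕ<n; toℕ-injective)
import Data.Fin.Properties as Fin
open import Data.Fin.Subset using (Subset; _∈_) renaming (⊤ to full)
open import Data.Fin.Subset.Properties using (x∈p∩q⁺; x∈p∩q⁻)
open import Data.List using (List; []; _∷_; _++_; length; concat)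
import Data.List as List
open import Data.List.Properties using (length-++; length-tabulate)
open import Data.Maybe using (Maybe; just; nothing)
open import Data.Maybe.Properties using (≡-dec; just-injective)
open import Data.Nat
open import Data.Nat.Properties
open import Data.Nat.Tactic.RingSolver using (solve-∀)
open import Data.Product using (∃-syntax; _×_; _,_; proj₁; proj₂; uncurry)
open import Data.Sum using (_⊎_; inj₁; inj₂; [_,_]; [_,_]′)
open import Data.Sum.Properties using (inj₁-injective; inj₂-injective)
open import Data.Unit using (⊤; tt)
import Data.Vec as Vec
open import Data.Vec.Properties using (lookup-replicate; lookup∘tabulate; []=⇒lookup; lookup⇒[]=)
open import Function using (_∘_; _$_; Bijective)
open import Function.Bundles using (module Equivalence)
open import Relation.Binary.PropositionalEquality hiding ([_])
open import Relation.Nullary using (¬_; Dec; contradiction; yes; no; does; _×-dec_)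
open import Relation.Nullary.Decidable using (map′; _⊎-dec_; dec-true; dec-false)

-- Verification of programs

-- The constant is chosen before `k` and `ℓ`, although the program depends on both. Whatever
-- concerns families of label sets is therefore settled when the program is written: preimages and
-- cuts become literal offsets, and blocks unrolled `K` = 2^{kℓ} times stand inside loops over
-- codes. The factors `k`, `ℓ` and `2 ^ k` that unrolling brings in are absorbed by `K`, as `k` and
-- `ℓ` are positive; a join needs `M * (K * 2 ^ k)` copies and a union at most `M * (M * K)` merges,
-- both within `K * K * (M * M)`. The machine cannot multiply. A code q is therefore held only as
-- the offset `q * K`, and the profits are multiplied once, by repeated addition, with their weight
-- and with `K`. The tables are verified against `Solutions`, a relation between families, codes and
-- trees in which no graph occurs; colorings are related to it afterwards. One entry per family and
-- code is enough, because within the digit bounds a code determines the profit vector and thus the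
-- satisfaction level.

Memory : Set
Memory = ℕ → ℕ

put : List ℕ → ℕ → ℕ → List ℕ
put []       zero    x = x ∷ []
put []       (suc r) x = 0 ∷ put [] r x
put (_ ∷ vs) zero    x = x ∷ vs
put (v ∷ vs) (suc r) x = v ∷ put vs r x

word-put : ∀ vs r x b → word (put vs r x) b ≡ (word vs [ r ↦ x ]) b
word-put []       zero    x zero    = refl
word-put []       zero    x (suc b) = refl
word-put []       (suc r) x zero    = refl
word-put []       (suc r) x (suc b) = word-put [] r x b
word-put (_ ∷ vs) zero    x zero    = refl
word-put (_ ∷ vs) zero    x (suc b) = refl
word-put (v ∷ vs) (suc r) x zero    = refl
word-put (v ∷ vs) (suc r) x (suc b) = word-put vs r x b

value-cong : ∀ e {f g m} → f ≗ g → value e ⟨ f , m ⟩ ≡ value e ⟨ g , m ⟩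
value-cong (lit c)  f≗g = refl
value-cong (var r)  f≗g = f≗g r
value-cong (load a) {m = m} f≗g = cong m (value-cong a f≗g)
value-cong (a ⊞ b)  f≗g = cong₂ _+_ (value-cong a f≗g) (value-cong b f≗g)
value-cong (a ⊟ b)  f≗g = cong₂ _∸_ (value-cong a f≗g) (value-cong b f≗g)

-- The register file is kept as a finite list, so that without function
-- extensionality the registers of a state are still known exactly.
record Exec (P : Program) (vs : List ℕ) (m : Memory) (C : ℕ)
            (Q : List ℕ → Memory → Set) : Set where
  constructor exec
  field
    run : ∀ {f} → f ≗ word vs → ∃[ f′ ] ∃[ vs′ ] ∃[ m′ ] ∃[ t ]
          (Run P ⟨ f , m ⟩ ⟨ f′ , m′ ⟩ t × f′ ≗ word vs′ × t ≤ C × Q vs′ m′)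

module _ {vs : List ℕ} {m : Memory} where

  eval : Term → ℕ
  eval e = value e ⟨ word vs , m ⟩

  exec-skip : ∀ {Q} → Q vs m → Exec skip vs m 1 Q
  exec-skip q = exec λ f≗ → _ , _ , _ , _ , run-skip , f≗ , ≤-refl , q

  exec-≔ : ∀ {r e Q} → Q (put vs r (eval e)) m → Exec (r ≔ e) vs m (1 + cost e) Q
  exec-≔ {r} {e} q = exec λ {f} f≗ → _ , _ , _ , _ , run-≔ , assigned f≗ , ≤-refl , q
    where
    assigned : ∀ {f} → f ≗ word vs → (f [ r ↦ value e ⟨ f , m ⟩ ]) ≗ word (put vs r (eval e))
    assigned {f} f≗ b = begin
      (f [ r ↦ value e ⟨ f , m ⟩ ]) b  ≡⟨ cong₂ (if does (b ≟ r) then_else_) (value-cong e f≗) (f≗ b) ⟩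
      (word vs [ r ↦ eval e ]) b       ≡⟨ word-put vs r (eval e) b ⟨
      word (put vs r (eval e)) b       ∎
      where open ≡-Reasoning

  exec-[]≔ : ∀ {a e Q} → Q vs (m [ eval a ↦ eval e ]) →
             Exec ([ a ]≔ e) vs m (1 + cost a + cost e) Q
  exec-[]≔ {a} {e} {Q} q = exec λ f≗ → _ , _ , _ , _ , run-[]≔ , f≗ , ≤-refl ,
    subst₂ (λ x y → Q vs (m [ x ↦ y ])) (sym (value-cong a f≗)) (sym (value-cong e f≗)) q

  -- The postcondition of the first program is the specification of the second, so straight-line
  -- code is verified by nesting while normalisation computes the registers.
  exec-⨾ : ∀ {P P′ C C′ Q} → Exec P vs m C (λ vs′ m′ → Exec P′ vs′ m′ C′ Q) →
           Exec (P ⨾ P′) vs m (C + C′) Q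
  exec-⨾ (exec x) = exec λ f≗ →
    let _ , _ , _ , _ , r , f′≗ , t≤ , exec y = x f≗
        _ , _ , _ , _ , r′ , f″≗ , t′≤ , q = y f′≗ in
    _ , _ , _ , _ , run-⨾ r r′ , f″≗ , +-mono-≤ t≤ t′≤ , q

  exec-then : ∀ {e P P′ C Q} → eval e ≢ 0 → Exec P vs m C Q →
              Exec (ifnz e then P else P′) vs m (1 + cost e + C) Q
  exec-then {e} e≢0 (exec x) = exec λ f≗ → let _ , _ , _ , _ , r , f′≗ , t≤ , q = x f≗ in
    _ , _ , _ , _ , run-then (e≢0 ∘ trans (sym (value-cong e f≗))) r , f′≗ , +-monoʳ-≤ (1 + cost e) t≤ , q

  exec-else : ∀ {e P P′ C Q} → eval e ≡ 0 → Exec P′ vs m C Q →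
              Exec (ifnz e then P else P′) vs m (1 + cost e + C) Q
  exec-else {e} e≡0 (exec x) = exec λ f≗ → let _ , _ , _ , _ , r , f′≗ , t≤ , q = x f≗ in
    _ , _ , _ , _ , run-else (trans (value-cong e f≗) e≡0) r , f′≗ , +-monoʳ-≤ (1 + cost e) t≤ , q

  exec-exit : ∀ {e P Q} → eval e ≡ 0 → Q vs m → Exec (whilenz e loop P) vs m (1 + cost e) Q
  exec-exit {e} e≡0 q = exec λ f≗ →
    _ , _ , _ , _ , run-exit (trans (value-cong e f≗) e≡0) , f≗ , ≤-refl , q

  exec-loop : ∀ {e P C C′ Q} → eval e ≢ 0 →
    Exec P vs m C (λ vs′ m′ → Exec (whilenz e loop P) vs′ m′ C′ Q) →
    Exec (whilenz e loop P) vs m (1 + cost e + C + C′) Q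
  exec-loop {e} e≢0 (exec x) = exec λ f≗ →
    let _ , _ , _ , _ , r , f′≗ , t≤ , exec y = x f≗
        _ , _ , _ , _ , r′ , f″≗ , t′≤ , q = y f′≗ in
    _ , _ , _ , _ , run-loop (e≢0 ∘ trans (sym (value-cong e f≗))) r r′ , f″≗ ,
    +-mono-≤ (+-monoʳ-≤ (1 + cost e) t≤) t′≤ , q

  within : ∀ {P C C′ Q} → C ≤ C′ → Exec P vs m C Q → Exec P vs m C′ Q
  within C≤ (exec x) = exec λ f≗ → let _ , _ , _ , _ , r , f′≗ , t≤ , q = x f≗ in
    _ , _ , _ , _ , r , f′≗ , ≤-trans t≤ C≤ , q

  exec-map : ∀ {P C Q Q′} → (∀ {vs′ m′} → Q vs′ m′ → Q′ vs′ m′) → Exec P vs m C Q → Exec P vs m C Q′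
  exec-map h (exec x) = exec λ f≗ → let _ , _ , _ , _ , r , f′≗ , t≤ , q = x f≗ in
    _ , _ , _ , _ , r , f′≗ , t≤ , h q

-- Unrolled blocks, dispatch and counted loops

forAll : (D : ℕ) → (Fin D → Program) → Program
forAll zero    body = skip
forAll (suc D) body = body zero ⨾ forAll D (body ∘ suc)

switch : (r offset D : ℕ) → (Fin D → Program) → Program
switch r o zero    body = skip
switch r o (suc D) body = ifnz (var r ⊟ lit o) then switch r (suc o) D (body ∘ suc) else body zero

exec-switch : ∀ {vs m C Q r} o D {body : Fin D → Program} i → word vs r ≡ o + toℕ i →
  Exec (body i) vs m C Q → Exec (switch r o D body) vs m (D * 4 + C) Q
exec-switch {C = C} o (suc D) zero eq x =
  within (+-monoʳ-≤ 4 (m≤n+m C (D * 4)))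
    (exec-else (trans (cong (_∸ o) eq) (m+n∸m≡n o 0)) x)
exec-switch {C = C} o (suc D) (suc i) eq x =
  within (≤-reflexive (sym (+-assoc 4 (D * 4) C)))
    (exec-then (λ e≡0 → 1+n≢0 (trans (sym (trans (cong (_∸ o) eq) (m+n∸m≡n o _))) e≡0))
      (exec-switch (suc o) D i (trans eq (+-suc o (toℕ i))) x))

∸-suc≢0 : ∀ {i n} → i < n → n ∸ i ≢ 0
∸-suc≢0 i<n e = <⇒≱ i<n (m∸n≡0⇒m≤n e)

-- Here `n` counts the remaining rounds; the induction shifts the invariant to `I ∘ suc`, so no
-- start index has to be generalised.
exec-times : ∀ n {e body C} (I : ℕ → List ℕ → Memory → Set) →
  (∀ {i vs m} → i < n → I i vs m → value e ⟨ word vs , m ⟩ ≢ 0) →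
  (∀ {vs m} → I n vs m → value e ⟨ word vs , m ⟩ ≡ 0) →
  (∀ {i vs m} → i < n → I i vs m → Exec body vs m C (I (suc i))) →
  ∀ {vs m} → I 0 vs m → Exec (whilenz e loop body) vs m (n * (1 + cost e + C) + (1 + cost e)) (I n)
exec-times zero    I continue stop step x = exec-exit (stop x) x
exec-times (suc n) {e} {C = C} I continue stop step x =
  within (≤-reflexive (sym (+-assoc (1 + cost e + C) (n * (1 + cost e + C)) _)))
    (exec-loop (continue z<s x) (exec-map
      (exec-times n (I ∘ suc) (continue ∘ s≤s) stop (step ∘ s≤s)) (step z<s x)))

-- J is invariant, ⊑ is monotone progress, and the step with index i achieves
-- the goal G i, which further progress does not destroy.
module Steps (J : Memory → Set) (_⊑_ : Memory → Memory → Set)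
  (⊑-refl : ∀ {m} → m ⊑ m) (⊑-trans : ∀ {m m′ m″} → m ⊑ m′ → m′ ⊑ m″ → m ⊑ m″) where

  Step : Memory → (Memory → Set) → List ℕ → List ℕ → Memory → Set
  Step m G vs vs′ m′ = vs′ ≡ vs × J m′ × m ⊑ m′ × G m′

  exec-forAll : ∀ c X D {body : Fin D → Program} (vs : ℕ → List ℕ) (G : Fin D → Memory → Set) →
    (∀ i {m m′} → m ⊑ m′ → G i m → G i m′) →
    (∀ i {m} → J m → Exec (body i) (vs (toℕ i)) m (c * X) (Step m (G i) (vs (suc (toℕ i))))) →
    ∀ {m} → J m → Exec (forAll D body) (vs 0) m (1 + D * (c * X))
      (Step m (λ m′ → ∀ i → G i m′) (vs D))
  exec-forAll c X zero    vs G mono step j = exec-skip (refl , j , ⊑-refl , λ ())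
  exec-forAll c X (suc D) vs G mono step j =
    within (≤-reflexive (+-suc _ _)) (exec-⨾ (exec-map
      (λ { (refl , j′ , m⊑m′ , g) → exec-map
        (λ (eq , j″ , m′⊑m″ , gs) → eq , j″ , ⊑-trans m⊑m′ m′⊑m″ ,
          λ { zero → mono zero m′⊑m″ g ; (suc i) → gs i })
        (exec-forAll c X D (vs ∘ suc) (G ∘ suc) (mono ∘ suc) (step ∘ suc) j′) })
      (step zero j)))

  exec-while : ∀ n {e body C} (vs : ℕ → List ℕ) (G : ℕ → Memory → Set) →
    (∀ i {m m′} → m ⊑ m′ → G i m → G i m′) →
    (∀ i {m} → i < n → value e ⟨ word (vs i) , m ⟩ ≢ 0) →
    (∀ {m} → value e ⟨ word (vs n) , m ⟩ ≡ 0) →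
    (∀ i {m} → i < n → J m → Exec body (vs i) m C (Step m (G i) (vs (suc i)))) →
    ∀ {m} → J m → Exec (whilenz e loop body) (vs 0) m (n * (1 + cost e + C) + (1 + cost e))
      (Step m (λ m′ → ∀ i → i < n → G i m′) (vs n))
  exec-while n vs G mono continue stop step {m} j = exec-times n
    (λ i vs′ m′ → vs′ ≡ vs i × J m′ × m ⊑ m′ × (∀ i′ → i′ < i → G i′ m′))
    (λ { i<n (refl , _) → continue _ i<n }) (λ { (refl , _) → stop })
    (λ { i<n (refl , j , m⊑ , gs) → exec-map
      (λ (eq , j′ , ⊑m′ , g) → eq , j′ , ⊑-trans m⊑ ⊑m′ , λ i′ i′<1+i →
        [ (λ i′<i → mono i′ ⊑m′ (gs i′ i′<i)) , (λ { refl → g }) ]′ (m<1+n⇒m<n∨m≡n i′<1+i))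
      (step _ i<n j) })
    (refl , j , ⊑-refl , λ _ ())

-- Arithmetic of running times

c≤c*X : ∀ c {X} → 1 ≤ X → c ≤ c * X
c≤c*X c {X} 1≤X = ≤-trans (≤-reflexive (sym (*-identityʳ c))) (*-monoʳ-≤ c 1≤X)

forAll-cost : ∀ c {D X} → 1 ≤ D → 1 ≤ X → 1 + D * (c * X) ≤ (1 + c) * (D * X)
forAll-cost c {D} {X} 1≤D 1≤X = +-mono-≤ (*-mono-≤ 1≤D 1≤X)
  (≤-reflexive (trans (sym (*-assoc D c X)) (trans (cong (_* X) (*-comm D c)) (*-assoc c D X))))

while-cost : ∀ h c {n X C} → 1 ≤ n → 1 ≤ X → C ≤ c * X → n * (h + C) + h ≤ (h + c + h) * (n * X)
while-cost h c {n} {X} {C} 1≤n 1≤X C≤ = begin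
  n * (h + C) + h                      ≤⟨ +-mono-≤ (*-monoʳ-≤ n (+-mono-≤ (c≤c*X h 1≤X) C≤))
      (c≤c*X h (*-mono-≤ 1≤n 1≤X)) ⟩
  n * (h * X + c * X) + h * (n * X)    ≡⟨ rearrange n h c X ⟩
  (h + c + h) * (n * X)                ∎
  where
  open ≤-Reasoning
  rearrange : ∀ n h c X → n * (h * X + c * X) + h * (n * X) ≡ (h + c + h) * (n * X)
  rearrange = solve-∀

-- Running times are kept in the form numeral times product. Their numerals then add up by
-- computation, and the final constant comes out as a literal free of `k` and `ℓ`.
+-cost : ∀ X {A B} a b → A ≤ a * X → B ≤ b * X → A + B ≤ (a + b) * X
+-cost X a b A≤ B≤ = ≤-trans (+-mono-≤ A≤ B≤) (≤-reflexive (sym (*-distribʳ-+ X a b)))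

-- Codes of profit vectors, label families and colorings

Σ< : ∀ {n} → (Fin n → ℕ) → ℕ
Σ< = sum +-0-commutativeMonoid

Σ<-cong : ∀ {n} {f g : Fin n → ℕ} → f ≗ g → Σ< f ≡ Σ< g
Σ<-cong = sum-cong-≗ +-0-commutativeMonoid

divmod-unique : ∀ a {r r′} d d′ → r < a → r′ < a → r + d * a ≡ r′ + d′ * a → r ≡ r′ × d ≡ d′
divmod-unique a {r} {r′} zero zero r< r′< eq = trans (sym (+-identityʳ r)) (trans eq (+-identityʳ r′)) , refl
divmod-unique a {r} {r′} zero (suc d′) r< r′< eq =
  contradiction (begin-strict
    r                  <⟨ r< ⟩
    a                  ≤⟨ m≤m+n a (d′ * a) ⟩
    a + d′ * a         ≤⟨ m≤n+m _ r′ ⟩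
    r′ + suc d′ * a    ≡⟨ eq ⟨
    r + 0              ≡⟨ +-identityʳ r ⟩
    r                  ∎) (<-irrefl refl)
  where open ≤-Reasoning
divmod-unique a {r} {r′} (suc d) zero r< r′< eq =
  contradiction (begin-strict
    r′                 <⟨ r′< ⟩
    a                  ≤⟨ m≤m+n a (d * a) ⟩
    a + d * a          ≤⟨ m≤n+m _ r ⟩
    r + suc d * a      ≡⟨ eq ⟩
    r′ + 0             ≡⟨ +-identityʳ r′ ⟩
    r′                 ∎) (<-irrefl refl)
  where open ≤-Reasoning
divmod-unique a {r} {r′} (suc d) (suc d′) r< r′< eq =
  let r≡ , d≡ = divmod-unique a d d′ r< r′< (+-cancelˡ-≡ a _ _ (trans (swap r d) (trans eq (sym (swap r′ d′)))))
  in r≡ , cong suc d≡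
  where
  swap : ∀ r d → a + (r + d * a) ≡ r + (a + d * a)
  swap r d = rearrange a r (d * a)
    where
    rearrange : ∀ x y z → x + (y + z) ≡ y + (x + z)
    rearrange = solve-∀

-- Mixed radix: digit c ranges over 0 … P c, so that it has weight a ∏_{i<c} (1 + P i).
scale : ∀ {k} → ℕ → (Fin k → ℕ) → Fin k → ℕ
scale a P zero    = a
scale a P (suc c) = scale (suc (P zero) * a) (P ∘ suc) c

top : ∀ {k} → ℕ → (Fin k → ℕ) → ℕ
top {zero}  a P = a
top {suc k} a P = top (suc (P zero) * a) (P ∘ suc)

code : ∀ {k} → ℕ → (Fin k → ℕ) → (Fin k → ℕ) → ℕ
code {zero}  a P d = 0
code {suc k} a P d = d zero * a + code (suc (P zero) * a) (P ∘ suc) (d ∘ suc)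

next-digit : ∀ {r a x y} → r < a → x ≤ y → r + x * a < suc y * a
next-digit {r} {a} {x} {y} r<a x≤y = +-mono-<-≤ r<a (*-monoˡ-≤ a x≤y)

-- The accumulator `r` is the value of the digits already passed. Adding `d zero * a` keeps it below
-- `suc (P zero) * a`, the next weight, so the induction closes.
code-bound : ∀ {k} {d P : Fin k → ℕ} {a} r → r < a → (∀ c → d c ≤ P c) → r + code a P d < top a P
code-bound {zero}  {a = a} r r<a d≤P = subst (_< a) (sym (+-identityʳ r)) r<a
code-bound {suc k} {d} {P} {a} r r<a d≤P =
  subst (_< top a P) (+-assoc r (d zero * a) _)
    (code-bound (r + d zero * a) (next-digit {x = d zero} r<a (d≤P zero)) (d≤P ∘ suc))

-- The induction hypothesis at the next weight equates the parts consisting of remainder and first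
-- digit; uniqueness of division by `a` then separates these two.
code-unique : ∀ {k} {d P e : Fin k → ℕ} {a r r′} → r < a → r′ < a → (∀ c → d c ≤ P c) → (∀ c → e c ≤ P c) →
  r + code a P d ≡ r′ + code a P e → r ≡ r′ × (∀ c → d c ≡ e c)
code-unique {zero} {r = r} {r′} _ _ _ _ eq =
  trans (sym (+-identityʳ r)) (trans eq (+-identityʳ r′)) , λ ()
code-unique {suc k} {d} {P} {e} {a} {r} {r′} r< r′< d≤ e≤ eq =
  let eq₁ , eqs = code-unique {P = P ∘ suc} (next-digit {x = d zero} r< (d≤ zero)) (next-digit {x = e zero} r′< (e≤ zero))
        (d≤ ∘ suc) (e≤ ∘ suc)
        (trans (+-assoc r (d zero * a) _) (trans eq (sym (+-assoc r′ (e zero * a) _))))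
      r≡ , d≡ = divmod-unique a (d zero) (e zero) r< r′< eq₁
  in r≡ , λ { zero → d≡ ; (suc c) → eqs c }

code-zero : ∀ {k} {P : Fin k → ℕ} {a} → code a P (λ _ → 0) ≡ 0
code-zero {zero}          = refl
code-zero {suc k} {P} = code-zero {P = P ∘ suc}

-- Linearity holds without digit bounds. Carries have to be excluded only where a code is decoded.
code-+ : ∀ {k} {P d e : Fin k → ℕ} {a} → code a P (λ c → d c + e c) ≡ code a P d + code a P e
code-+ {zero} = refl
code-+ {suc k} {P} {d} {e} {a} =
  trans (cong ((d zero + e zero) * a +_) (code-+ {P = P ∘ suc} {d ∘ suc} {e ∘ suc}))
    (shuffle (d zero) (e zero) a _ _)
  where
  shuffle : ∀ x y a u v → (x + y) * a + (u + v) ≡ x * a + u + (y * a + v)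
  shuffle = solve-∀

code-single : ∀ {k} {P : Fin k → ℕ} {a} c x →
  code a P (λ c′ → if does (c′ Fin.≟ c) then x else 0) ≡ x * scale a P c
code-single {P = P} {a} zero    x = trans (cong (x * a +_) (code-zero {P = P ∘ suc})) (+-identityʳ _)
code-single {P = P} {a} (suc c) x = code-single {P = P ∘ suc} c x

-- Letting the weights start at `K` instead of 1 multiplies every code by `K`, which is the form in
-- which the machine stores codes.
code-* : ∀ {k} {P d : Fin k → ℕ} a b → code (a * b) P d ≡ code a P d * b
code-* {zero} a b = refl
code-* {suc k} {P} {d} a b
  rewrite sym (*-assoc (suc (P zero)) a b) | code-* {P = P ∘ suc} {d ∘ suc} (suc (P zero) * a) b =
  trans (cong (_+ code (suc (P zero) * a) (P ∘ suc) (d ∘ suc) * b) (sym (*-assoc (d zero) a b)))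
    (sym (*-distribʳ-+ b (d zero * a) _))

scale-* : ∀ {k} {P : Fin k → ℕ} a b c → scale (a * b) P c ≡ scale a P c * b
scale-* a b zero = refl
scale-* {P = P} a b (suc c) = trans (cong (λ x → scale x (P ∘ suc) c) (sym (*-assoc (suc (P zero)) a b)))
  (scale-* {P = P ∘ suc} (suc (P zero) * a) b c)

top-* : ∀ {k} {P : Fin k → ℕ} a b → top (a * b) P ≡ top a P * b
top-* {zero} a b = refl
top-* {suc k} {P} a b = trans (cong (λ x → top x (P ∘ suc)) (sym (*-assoc (suc (P zero)) a b)))
  (top-* {P = P ∘ suc} (suc (P zero) * a) b)

top≤ : ∀ {k Q} {P : Fin k → ℕ} a → (∀ c → P c ≤ Q) → top a P ≤ a * suc Q ^ k
top≤ {zero} a P≤Q = ≤-reflexive (sym (*-identityʳ a))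
top≤ {suc k} {Q} {P} a P≤Q = begin
  top (suc (P zero) * a) (P ∘ suc)  ≤⟨ top≤ _ (P≤Q ∘ suc) ⟩
  suc (P zero) * a * suc Q ^ k      ≤⟨ *-monoˡ-≤ (suc Q ^ k) (*-monoˡ-≤ a (s≤s (P≤Q zero))) ⟩
  suc Q * a * suc Q ^ k             ≡⟨ cong (_* suc Q ^ k) (*-comm (suc Q) a) ⟩
  a * suc Q * suc Q ^ k             ≡⟨ *-assoc a (suc Q) _ ⟩
  a * (suc Q * suc Q ^ k)           ∎
  where open ≤-Reasoning

-- Sums over vertices and over the leaves of an expression

Σ<-zero : ∀ n → Σ< {n} (λ _ → 0) ≡ 0
Σ<-zero n = sum-replicate-zero +-0-commutativeMonoid n

Σ<-one : ∀ n → Σ< {n} (λ _ → 1) ≡ n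
Σ<-one zero    = refl
Σ<-one (suc n) = cong suc (Σ<-one n)

Σ<-single : ∀ {n} (y : Fin n) (g : Fin n → ℕ) → Σ< (λ x → if does (y Fin.≟ x) then g x else 0) ≡ g y
Σ<-single {suc n} zero    g = trans (cong (g zero +_) (Σ<-zero n)) (+-identityʳ _)
Σ<-single {suc n} (suc y) g = Σ<-single y (g ∘ suc)

term≤Σ< : ∀ {n} (f : Fin n → ℕ) x → f x ≤ Σ< f
term≤Σ< f zero    = m≤m+n (f zero) _
term≤Σ< f (suc x) = ≤-trans (term≤Σ< (f ∘ suc) x) (m≤n+m _ (f zero))

Σ<-mono : ∀ {n} {f g : Fin n → ℕ} → (∀ x → f x ≤ g x) → Σ< f ≤ Σ< g
Σ<-mono {zero}  f≤g = z≤n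
Σ<-mono {suc n} f≤g = +-mono-≤ (f≤g zero) (Σ<-mono (f≤g ∘ suc))

total-full : ∀ {n} (g : Fin n → ℕ) → total {1} g full ≡ Σ< g
total-full g = Σ<-cong λ x → cong (if_then g x else 0) (lookup-replicate x true)

total≤ : ∀ {n} (g : Fin n → ℕ) (X : Subset n) → total {1} g X ≤ Σ< g
total≤ g X = Σ<-mono λ x → lemma (Vec.lookup X x) (g x)
  where
  lemma : ∀ b y → (if b then y else 0) ≤ y
  lemma true  y = ≤-refl
  lemma false y = z≤n

Vertex : ∀ {ℓ n} → Expression ℓ n → Set
Vertex σ = LabeledGraph.V ⟦ σ ⟧

module _ {ℓ n : ℕ} where

  leafSum : (σ : Expression ℓ n) → (Vertex σ → ℕ) → ℕ
  leafSum (vertex _ _) h = h tt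
  leafSum (σ ⊕ τ)      h = leafSum σ (h ∘ inj₁) + leafSum τ (h ∘ inj₂)
  leafSum (η _ _ _ σ)  h = leafSum σ h
  leafSum (ρ _ _ _ σ)  h = leafSum σ h

  leafSum-cong : ∀ σ {g h : Vertex σ → ℕ} → g ≗ h → leafSum σ g ≡ leafSum σ h
  leafSum-cong (vertex _ _) eq = eq tt
  leafSum-cong (σ ⊕ τ)      eq = cong₂ _+_ (leafSum-cong σ (eq ∘ inj₁)) (leafSum-cong τ (eq ∘ inj₂))
  leafSum-cong (η _ _ _ σ)  eq = leafSum-cong σ eq
  leafSum-cong (ρ _ _ _ σ)  eq = leafSum-cong σ eq

  leafSum-zero : ∀ σ {h : Vertex σ → ℕ} → (∀ u → h u ≡ 0) → leafSum σ h ≡ 0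
  leafSum-zero (vertex _ _) eq = eq tt
  leafSum-zero (σ ⊕ τ)      eq = cong₂ _+_ (leafSum-zero σ (eq ∘ inj₁)) (leafSum-zero τ (eq ∘ inj₂))
  leafSum-zero (η _ _ _ σ)  eq = leafSum-zero σ eq
  leafSum-zero (ρ _ _ _ σ)  eq = leafSum-zero σ eq

  leafSum-single : ∀ σ {h : Vertex σ → ℕ} w → (∀ u → u ≢ w → h u ≡ 0) → leafSum σ h ≡ h w
  leafSum-single (vertex _ _) tt off = refl
  leafSum-single (σ ⊕ τ) (inj₁ w) off = trans
    (cong₂ _+_ (leafSum-single σ w λ u u≢w → off (inj₁ u) (u≢w ∘ inj₁-injective))
      (leafSum-zero τ λ u → off (inj₂ u) λ ())) (+-identityʳ _)
  leafSum-single (σ ⊕ τ) (inj₂ w) off =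
    cong₂ _+_ (leafSum-zero σ λ u → off (inj₁ u) λ ())
      (leafSum-single τ w λ u u≢w → off (inj₂ u) (u≢w ∘ inj₂-injective))
  leafSum-single (η _ _ _ σ) w off = leafSum-single σ w off
  leafSum-single (ρ _ _ _ σ) w off = leafSum-single σ w off

  leafSum-Σ< : ∀ σ {m} (h : Vertex σ → Fin m → ℕ) →
    leafSum σ (λ u → Σ< (h u)) ≡ Σ< (λ x → leafSum σ (λ u → h u x))
  leafSum-Σ< (vertex _ _) h = refl
  leafSum-Σ< (σ ⊕ τ)      h = trans (cong₂ _+_ (leafSum-Σ< σ (h ∘ inj₁)) (leafSum-Σ< τ (h ∘ inj₂)))
    (sym (∑-distrib-+ +-0-commutativeMonoid
      (λ x → leafSum σ (λ u → h (inj₁ u) x)) (λ x → leafSum τ (λ u → h (inj₂ u) x))))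
  leafSum-Σ< (η _ _ _ σ)  h = leafSum-Σ< σ h
  leafSum-Σ< (ρ _ _ _ σ)  h = leafSum-Σ< σ h

  -- Expand `g (name σ u)` into a row of indicator terms and exchange the two sums: bijectivity
  -- leaves exactly one leaf in every column.
  leafSum-name : ∀ σ → Bijective _≡_ _≡_ (name σ) → ∀ g → leafSum σ (g ∘ name σ) ≡ Σ< g
  leafSum-name σ (injective , surjective) g = begin
    leafSum σ (g ∘ name σ)                   ≡⟨ leafSum-cong σ (λ u → Σ<-single (name σ u) g) ⟨
    leafSum σ (λ u → Σ< (δ u))               ≡⟨ leafSum-Σ< σ δ ⟩
    Σ< (λ x → leafSum σ (λ u → δ u x))       ≡⟨ Σ<-cong one ⟩
    Σ< g                                     ∎
    where
    open ≡-Reasoning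
    δ : Vertex σ → Fin n → ℕ
    δ u x = if does (name σ u Fin.≟ x) then g x else 0
    one : ∀ x → leafSum σ (λ u → δ u x) ≡ g x
    one x with surjective x
    ... | w , named with refl ← named refl = trans
      (leafSum-single σ w λ u u≢w →
        cong (if_then g x else 0) (dec-false (name σ u Fin.≟ x) (u≢w ∘ injective)))
      (cong (if_then g x else 0) (dec-true (name σ w Fin.≟ x) refl))

  -- Every leaf owns words of the encoding. Together with `leafSum-name` this bounds the number of
  -- vertices by the encoding length, which pays for rewriting the profits.
  leafSum-one≤ : ∀ σ → leafSum σ (λ _ → 1) ≤ ∣ σ ∣ᵉ
  leafSum-one≤ (vertex _ _) = s≤s z≤n
  leafSum-one≤ (σ ⊕ τ) = begin
    leafSum σ _ + leafSum τ _             ≤⟨ +-mono-≤ (leafSum-one≤ σ) (leafSum-one≤ τ) ⟩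
    ∣ σ ∣ᵉ + ∣ τ ∣ᵉ                         ≤⟨ +-monoʳ-≤ ∣ σ ∣ᵉ (m≤m+n ∣ τ ∣ᵉ 1) ⟩
    ∣ σ ∣ᵉ + (∣ τ ∣ᵉ + 1)                   ≡⟨ cong (∣ σ ∣ᵉ +_) (length-++ (encode τ)) ⟨
    ∣ σ ∣ᵉ + length (encode τ ++ 1 ∷ [])   ≡⟨ length-++ (encode σ) ⟨
    ∣ σ ⊕ τ ∣ᵉ                             ∎
    where open ≤-Reasoning
  leafSum-one≤ (η i j _ σ) = ≤-trans (leafSum-one≤ σ)
      (≤-trans (m≤m+n _ _) (≤-reflexive (sym (length-++ (encode σ)))))
  leafSum-one≤ (ρ i j _ σ) = ≤-trans (leafSum-one≤ σ)
      (≤-trans (m≤m+n _ _) (≤-reflexive (sym (length-++ (encode σ)))))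

  -- Needed so that `fits-η⁻` can decide constructively which label a class does not use.
  any? : ∀ (σ : Expression ℓ n) {P : Vertex σ → Set} → (∀ u → Dec (P u)) → Dec (∃[ u ] P u)
  any? (vertex _ _) P? = map′ (tt ,_) proj₂ (P? tt)
  any? (σ ⊕ τ)      P? = map′ (λ { (inj₁ (u , p)) → inj₁ u , p ; (inj₂ (u , p)) → inj₂ u , p })
    (λ { (inj₁ u , p) → inj₁ (u , p) ; (inj₂ u , p) → inj₂ (u , p) })
    (any? σ (P? ∘ inj₁) ⊎-dec any? τ (P? ∘ inj₂))
  any? (η _ _ _ σ)  P? = any? σ P?
  any? (ρ _ _ _ σ)  P? = any? σ P?

1≤2^ : ∀ x → 1 ≤ 2 ^ x
1≤2^ x = m^n>0 2 x

n≤2^n : ∀ x → x ≤ 2 ^ x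
n≤2^n zero    = z≤n
n≤2^n (suc x) = +-mono-≤ (1≤2^ x) (≤-trans (n≤2^n x) (m≤m+n (2 ^ x) 0))

-- Families of label sets and the colorings that respect them

module Families (k ℓ : ℕ) where

  K : ℕ
  K = 2 ^ (k * ℓ)

  1≤K : 1 ≤ K
  1≤K = 1≤2^ (k * ℓ)

  2^k≤K : 1 ≤ ℓ → 2 ^ k ≤ K
  2^k≤K 1≤ℓ = ^-monoʳ-≤ 2 (m≤m*n k ℓ {{>-nonZero 1≤ℓ}})

  k≤K : 1 ≤ ℓ → k ≤ K
  k≤K 1≤ℓ = ≤-trans (n≤2^n k) (2^k≤K 1≤ℓ)

  bool : Fin 2 → Bool
  bool zero       = false
  bool (suc zero) = true

  digit : Bool → Fin 2
  digit false = zero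
  digit true  = suc zero

  bool-digit : ∀ b → bool (digit b) ≡ b
  bool-digit false = refl
  bool-digit true  = refl

  -- L : Fin K codes the family of the k label sets { i | has L c i }.
  has : Fin K → Fin k → Fin ℓ → Bool
  has L c i = bool (finToFun L (combine c i))

  family : (Fin k → Fin ℓ → Bool) → Fin K
  family g = funToFin (digit ∘ uncurry g ∘ remQuot ℓ)

  has-family : ∀ g c i → has (family g) c i ≡ g c i
  has-family g c i = begin
    has (family g) c i                          ≡⟨ cong bool (finToFun-funToFin _ (combine c i)) ⟩
    bool (digit (uncurry g (remQuot ℓ (combine c i))))  ≡⟨ bool-digit _ ⟩
    uncurry g (remQuot ℓ (combine c i))         ≡⟨ cong (uncurry g) (remQuot-combine c i) ⟩
    g c i                                       ∎
    where open ≡-Reasoning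

  -- The family for the whole expression: it excludes no partial coloring.
  everything : Fin K
  everything = family λ _ _ → true

  -- New labels are contained in `L` exactly when the old ones are contained in this family, so a
  -- relabelling needs a single lookup.
  preimage : Fin ℓ → Fin ℓ → Fin K → Fin K
  preimage i j L = family λ c a → has L c (if does (a Fin.≟ i) then j else a)

  has-preimage : ∀ i j L c a → has (preimage i j L) c a ≡ has L c (if does (a Fin.≟ i) then j else a)
  has-preimage i j L = has-family λ c a → has L c (if does (a Fin.≟ i) then j else a)

  removed : Fin ℓ → Fin ℓ → Fin (2 ^ k) → Fin k → Fin ℓ
  removed i j d c = if bool (finToFun d c) then i else j

  -- An independent class of a join of i and j misses one of these labels.
  cut : Fin ℓ → Fin ℓ → Fin K → Fin (2 ^ k) → Fin K
  cut i j L d = family λ c a → has L c a ∧ not (does (a Fin.≟ removed i j d c))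

  has-cut-∧ : ∀ i j L d c a → has (cut i j L d) c a ≡ has L c a ∧ not (does (a Fin.≟ removed i j d c))
  has-cut-∧ i j L d = has-family λ c a → has L c a ∧ not (does (a Fin.≟ removed i j d c))

  has-cut : ∀ {i j L d c a} → has (cut i j L d) c a ≡ true → has L c a ≡ true × a ≢ removed i j d c
  has-cut {i} {j} {L} {d} {c} {a} h
    with has L c a | a Fin.≟ removed i j d c | trans (sym (has-cut-∧ i j L d c a)) h
  ... | true  | no a≢ | _ = refl , a≢
  ... | true  | yes _ | ()
  ... | false | _     | ()

  cut-has : ∀ {i j L d c a} → has L c a ≡ true → a ≢ removed i j d c → has (cut i j L d) c a ≡ true
  cut-has {i} {j} {L} {d} {c} {a} h a≢ = trans (has-cut-∧ i j L d c a)
    (cong₂ (λ x y → x ∧ not y) h (dec-false (a Fin.≟ removed i j d c) a≢))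

  module _ {n : ℕ} where

    record Fits (σ : Expression ℓ n) (L : Fin K) (f : Vertex σ → Maybe (Fin k)) : Set where
      open LabeledGraph ⟦ σ ⟧
      field
        independent : ∀ {u v c} → f u ≡ just c → f v ≡ just c → ¬ (u ~ v)
        contained   : ∀ {u c} → f u ≡ just c → has L c (label u) ≡ true
    open Fits public

    fits-⊕ : ∀ {σ τ L f} → Fits σ L (f ∘ inj₁) → Fits τ L (f ∘ inj₂) → Fits (σ ⊕ τ) L f
    fits-⊕ F G .independent {inj₁ u} {inj₁ v} = F .independent
    fits-⊕ F G .independent {inj₁ u} {inj₂ v} _ _ ()
    fits-⊕ F G .independent {inj₂ u} {inj₁ v} _ _ ()
    fits-⊕ F G .independent {inj₂ u} {inj₂ v} = G .independent
    fits-⊕ F G .contained {inj₁ u} = F .contained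
    fits-⊕ F G .contained {inj₂ u} = G .contained

    fits-⊕ˡ : ∀ {σ τ L f} → Fits (σ ⊕ τ) L f → Fits σ L (f ∘ inj₁)
    fits-⊕ˡ F .independent = F .independent
    fits-⊕ˡ F .contained   = F .contained

    fits-⊕ʳ : ∀ {σ τ L f} → Fits (σ ⊕ τ) L f → Fits τ L (f ∘ inj₂)
    fits-⊕ʳ F .independent = F .independent
    fits-⊕ʳ F .contained   = F .contained

    fits-ρ : ∀ {i j i≢j σ L f} → Fits σ (preimage i j L) f → Fits (ρ i j i≢j σ) L f
    fits-ρ F .independent = F .independent
    fits-ρ {i} {j} {L = L} F .contained {u} {c} e = trans (sym (has-preimage i j L c _)) (F .contained e)

    fits-ρ⁻ : ∀ {i j i≢j σ L f} → Fits (ρ i j i≢j σ) L f → Fits σ (preimage i j L) f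
    fits-ρ⁻ F .independent = F .independent
    fits-ρ⁻ {i} {j} {L = L} F .contained {u} {c} e = trans (has-preimage i j L c _) (F .contained e)

    -- A new edge inside class c would connect the labels `i` and `j`, and one of them has been
    -- dropped from L_c.
    fits-η : ∀ {i j i≢j σ L f} d → Fits σ (cut i j L d) f → Fits (η i j i≢j σ) L f
    fits-η d F .contained e = proj₁ (has-cut (F .contained e))
    fits-η d F .independent fu fv (inj₁ u~v) = F .independent fu fv u~v
    fits-η {i} {j} {L = L} d F .independent {c = c} fu fv (inj₂ ends)
      with has-cut {i} {j} {L} {d} (F .contained fu) | has-cut {i} {j} {L} {d} (F .contained fv)
    ... | _ , u≢ | _ , v≢ with bool (finToFun d c) | ends
    ... | true  | inj₁ (u≡i , _) = u≢ u≡i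
    ... | true  | inj₂ (_ , v≡i) = v≢ v≡i
    ... | false | inj₁ (_ , v≡j) = v≢ v≡j
    ... | false | inj₂ (u≡j , _) = u≢ u≡j

    fits-η⁻ : ∀ {i j i≢j σ L f} → Fits (η i j i≢j σ) L f → ∃[ d ] Fits σ (cut i j L d) f
    fits-η⁻ {i} {j} {i≢j} {σ} {L} {f} F = d , record
      { independent = λ fu fv → F .independent fu fv ∘ inj₁
      ; contained   = λ fu → cut-has (F .contained fu) (avoids fu)
      }
      where
      open LabeledGraph ⟦ σ ⟧ using (label)
      uses? : ∀ c → Dec (∃[ u ] (f u ≡ just c × label u ≡ i))
      uses? c = any? σ λ u → ≡-dec Fin._≟_ (f u) (just c) ×-dec (label u Fin.≟ i)
      choice : Fin k → Bool
      choice c = not (does (uses? c))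
      d : Fin (2 ^ k)
      d = funToFin (digit ∘ choice)
      d-choice : ∀ c → bool (finToFun d c) ≡ choice c
      d-choice c = trans (cong bool (finToFun-funToFin (digit ∘ choice) c)) (bool-digit _)
      avoids : ∀ {u c} → f u ≡ just c → label u ≢ removed i j d c
      avoids {u} {c} fu with uses? c | d-choice c
      ... | no unused       | e rewrite e = λ u≡i → unused (u , fu , u≡i)
      ... | yes (v , fv , v≡i) | e rewrite e = λ u≡j → F .independent {v} {u} fv fu (inj₂ (inj₁ (v≡i , u≡j)))

  -- Profit vectors, and the passage between leaf colorings and vertex subsets

  module Profits {n : ℕ} (p : Fin k → Fin n → ℕ) where

    contribution : Maybe (Fin k) → Fin n → Fin k → ℕ
    contribution nothing   x c = 0
    contribution (just c′) x c = if does (c Fin.≟ c′) then p c′ x else 0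

    profit : (σ : Expression ℓ n) → (Vertex σ → Maybe (Fin k)) → Fin k → ℕ
    profit σ f c = leafSum σ λ u → contribution (f u) (name σ u) c

    worth : Fin k → ℕ
    worth c = Σ< (p c)

    codeOf : (σ : Expression ℓ n) → (Vertex σ → Maybe (Fin k)) → ℕ
    codeOf σ f = code 1 worth (profit σ f)

    M : ℕ
    M = top 1 worth

    codeOf-⊕ : ∀ (σ τ : Expression ℓ n) f → codeOf (σ ⊕ τ) f ≡ codeOf σ (f ∘ inj₁) + codeOf τ (f ∘ inj₂)
    codeOf-⊕ σ τ f = code-+ {P = worth} {d = profit σ (f ∘ inj₁)} {profit τ (f ∘ inj₂)} {1}

    Matches : (σ : Expression ℓ n) → (Vertex σ → Maybe (Fin k)) → (Fin k → Subset n) → Set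
    Matches σ f X = ∀ u c → Vec.lookup (X c) (name σ u) ≡ does (≡-dec Fin._≟_ (f u) (just c))

    module _ (G : Graph (Fin n)) (σ : Expression ℓ n) (constructs : σ Constructs G) where
      open IsIsomorphism constructs
      open Graph G using (_~_)

      vertexOf : Fin n → Vertex σ
      vertexOf x = proj₁ (proj₂ bijective x)

      name-vertexOf : ∀ x → name σ (vertexOf x) ≡ x
      name-vertexOf x = proj₂ (proj₂ bijective x) refl

      vertexOf-name : ∀ u → vertexOf (name σ u) ≡ u
      vertexOf-name u = proj₁ bijective (name-vertexOf (name σ u))

      vertices≤ : n ≤ ∣ σ ∣ᵉ
      vertices≤ = ≤-trans (≤-reflexive
          (trans (sym (Σ<-one n)) (sym (leafSum-name σ bijective (λ _ → 1))))) (leafSum-one≤ σ)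

      profit-matches : ∀ f X → Matches σ f X → ∀ c → profit σ f c ≡ total {k} (p c) (X c)
      profit-matches f X matches c = trans (leafSum-cong σ pointwise)
        (leafSum-name σ bijective (λ x → if Vec.lookup (X c) x then p c x else 0))
        where
        pointwise : ∀ u → contribution (f u) (name σ u) c ≡
            (if Vec.lookup (X c) (name σ u) then p c (name σ u) else 0)
        pointwise u rewrite matches u c with f u
        ... | nothing = refl
        ... | just c′ with c′ Fin.≟ c | c Fin.≟ c′
        ... | yes refl | yes _    = refl
        ... | no _     | no _     = refl
        ... | yes refl | no c≢c   = contradiction refl c≢c
        ... | no c≢c   | yes refl = contradiction refl c≢c

      classes : (Vertex σ → Maybe (Fin k)) → Fin k → Subset n
      classes f c = Vec.tabulate λ x → does (≡-dec Fin._≟_ (f (vertexOf x)) (just c))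

      classes-match : ∀ f → Matches σ f (classes f)
      classes-match f u c = trans (lookup∘tabulate _ (name σ u))
        (cong (λ v → does (≡-dec Fin._≟_ (f v) (just c))) (vertexOf-name u))

      classes∈ : ∀ {f c x} → x ∈ classes f c → f (vertexOf x) ≡ just c
      classes∈ {f} {c} {x} x∈ with trans (sym (lookup∘tabulate _ x)) ([]=⇒lookup x∈)
      ... | e with ≡-dec Fin._≟_ (f (vertexOf x)) (just c)
      ... | yes fx = fx

      classes-color : ∀ {L f} → Fits σ L f → IsPartialColoring G (classes f)
      classes-color {f = f} F = record
        { disjoint = λ i j i≢j (x , x∈) → let x∈i , x∈j = x∈p∩q⁻ (classes f i) (classes f j) x∈ in
            i≢j (just-injective (trans (sym (classes∈ {f} x∈i)) (classes∈ {f} x∈j)))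
        ; independent = λ c x y x∈ y∈ x~y → F .independent (classes∈ {f} x∈) (classes∈ {f} y∈)
            (Equivalence.from (adjacency _ _)
              (subst₂ _~_ (sym (name-vertexOf x)) (sym (name-vertexOf y)) x~y))
        }

      module _ (Y : Fin k → Subset n) (coloring : IsPartialColoring G Y) where
        open IsPartialColoring coloring using (disjoint) renaming (independent to Y-independent)

        class? : ∀ x → Dec (∃[ c ] Vec.lookup (Y c) x ≡ true)
        class? x = Fin.any? λ c → Vec.lookup (Y c) x Bool.≟ true

        -- Which class the search finds is immaterial by disjointness; this is `color-matches`.
        color : Vertex σ → Maybe (Fin k)
        color u with class? (name σ u)
        ... | yes (c , _) = just c
        ... | no _        = nothing

        color∈ : ∀ {u c} → color u ≡ just c → name σ u ∈ Y c
        color∈ {u} e with class? (name σ u)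
        color∈ refl | yes (c , l) = lookup⇒[]= _ (Y c) l

        color-matches : Matches σ color Y
        color-matches u c with class? (name σ u)
        ... | no none = ¬-not λ l → none (c , l)
        ... | yes (c′ , l) with c′ Fin.≟ c
        ... | yes refl = l
        ... | no c′≢c = ¬-not λ l′ → disjoint c′ c c′≢c
          (name σ u , x∈p∩q⁺ (lookup⇒[]= _ (Y c′) l , lookup⇒[]= _ (Y c) l′))

        color-fits : Fits σ everything color
        color-fits .independent fu fv u~v = Y-independent _ _ _ (color∈ {u = _} fu) (color∈ fv)
          (Equivalence.to (adjacency _ _) u~v)
        color-fits .contained {u} {c} _ = has-family (λ _ _ → true) c _

-- Filling the tables

update-same : ∀ (m : Memory) {a b} x → b ≡ a → (m [ a ↦ x ]) b ≡ x
update-same m {a} {b} x b≡a = cong (if_then x else m b) (dec-true (b ≟ a) b≡a)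

update-other : ∀ (m : Memory) {a b} x → b ≢ a → (m [ a ↦ x ]) b ≡ m b
update-other m {a} {b} x b≢a = cong (if_then x else m b) (dec-false (b ≟ a) b≢a)

Seg : Memory → ℕ → List ℕ → Set
Seg m a []       = ⊤
Seg m a (w ∷ ws) = m a ≡ w × Seg m (suc a) ws

seg-++ : ∀ {m a} xs {ys} → Seg m a (xs ++ ys) → Seg m a xs × Seg m (length xs + a) ys
seg-++ []       s = tt , s
seg-++ {m} {a} (x ∷ xs) {ys} (e , s) =
  let s₁ , s₂ = seg-++ xs s in (e , s₁) , subst (λ b → Seg m b ys) (+-suc (length xs) a) s₂

data Tree : Set where
  leaf : ℕ → Tree
  node : Tree → Tree → Tree

-- Registers: 0 the length N of the input, 1 n, 2 the number Z of cells of a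
-- table, 3 the position in the expression, 4 the topmost table, 5 the end of
-- the used memory, 6 k n, 7 … 12 scratch.  A table at T keeps its cells from T
-- on and the address of the next lower table at T + Z + Z.
module Programs (k ℓ : ℕ) where

  open Families k ℓ

  -- A cell consists of the words at a and a + Z.
  write : Term → Term → Term → Program
  write a x y = ([ a ]≔ x) ⨾ ([ a ⊞ var 2 ]≔ y)

  -- The term `x` is a code already multiplied by `K` and the family is a literal, so addressing a
  -- cell takes additions only.
  cellAt : ℕ → Term → Fin K → Term
  cellAt T x L = var T ⊞ (x ⊞ lit (toℕ L))

  emptyClass : Fin K → Program
  emptyClass L = write (cellAt 5 (lit 0) L) (lit 1) (lit 0)

  colored : Fin ℓ → Fin k → Fin K → Program
  colored i c L = if has L c i
    then write (cellAt 5 (var 11) L) (lit 1) (var 0 ⊞ (lit k ⊞ var 10)) else skip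

  -- Register 10 is the input address of the vertex's profit. Adding n moves it to the same vertex
  -- in the next row, and adding N + k turns it into the output address.
  colorLeaf : Fin ℓ → Fin k → Program
  colorLeaf i c = 11 ≔ load (var 10) ⨾ forAll K (colored i c) ⨾ 11 ≔ lit 0 ⨾ 10 ≔ var 1 ⊞ var 10

  leafTable : Fin ℓ → Program
  leafTable i = forAll K emptyClass ⨾ 11 ≔ lit 0 ⨾ 10 ≔ lit 1 ⊞ var 9 ⨾ forAll k (colorLeaf i)

  copy : Fin K → Fin K → Program
  copy A L = ifnz load (cellAt 4 (var 10) A)
    then write (cellAt 5 (var 10) L) (load (cellAt 4 (var 10) A)) (load (cellAt 4 (var 10) A ⊞ var 2))
    else skip

  -- Joins and relabellings share this loop: the code stays fixed, and each cell tries its `D`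
  -- source families.
  transfer : (D : ℕ) → (Fin K → Fin D → Fin K) → Program
  transfer D src = 10 ≔ lit 0 ⨾
    whilenz (var 2 ⊟ var 10) loop
      (forAll K (λ L → forAll D λ d → copy (src L d) L) ⨾ 10 ≔ lit K ⊞ var 10)

  merge : Fin K → Program
  merge L = ifnz load (cellAt 8 (var 10) L)
    then (ifnz load (cellAt 4 (var 11) L)
      then write (cellAt 5 (var 10 ⊞ var 11) L) (cellAt 8 (var 10) L) (cellAt 4 (var 11) L)
      else skip)
    else skip

  -- The inner loop ends when the two offsets together reach Z, since a code of M or more has no
  -- cell.
  union : Program
  union = 11 ≔ lit 0 ⨾ 10 ≔ lit 0 ⨾
    whilenz (var 2 ⊟ var 10) loop
      ((whilenz (var 2 ⊟ (var 10 ⊞ var 11)) loop (forAll K merge ⨾ 11 ≔ lit K ⊞ var 11)) ⨾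
        11 ≔ lit 0 ⨾ 10 ≔ lit K ⊞ var 10)

  linkOf : ℕ → Term
  linkOf T = (var T ⊞ var 2) ⊞ var 2

  -- Operand tables leave the linked list but not the memory, because later cells may point into
  -- them.
  finish : ℕ → Program
  finish l = [ linkOf 5 ]≔ var 12 ⨾ 4 ≔ var 5 ⨾ 5 ≔ lit 1 ⊞ linkOf 5 ⨾ 3 ≔ lit l ⊞ var 3

  relabelled : (D : ℕ) → (Fin ℓ → Fin ℓ → Fin K → Fin D → Fin K) → Program
  relabelled D src = 12 ≔ load (linkOf 4) ⨾
    switch 8 0 ℓ (λ i → switch 9 0 ℓ λ j → transfer D (src i j)) ⨾ finish 3

  operation : Fin 4 → Program
  operation zero = 12 ≔ var 4 ⨾ switch 8 0 ℓ leafTable ⨾ finish 3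
  operation (suc zero) = 8 ≔ load (linkOf 4) ⨾ 12 ≔ load (linkOf 8) ⨾ union ⨾ finish 1
  operation (suc (suc zero)) = relabelled (2 ^ k) cut
  operation (suc (suc (suc zero))) = relabelled 1 λ i j L _ → preimage i j L

  -- Three words are fetched before the opcode is known. For a union the last two are arbitrary and
  -- have no influence.
  symbol : Program
  symbol = 7 ≔ load (var 3) ⨾ 8 ≔ load (lit 1 ⊞ var 3) ⨾ 9 ≔ load (lit 2 ⊞ var 3) ⨾ switch 7 0 4 operation

  evaluate : Program
  evaluate = whilenz (var 0 ⊟ var 3) loop symbol

-- Tables in memory and the operations on them

module Evaluation (k ℓ n : ℕ) (M N kn lo : ℕ) (weight : Fin k → Fin n → ℕ) (base : Memory)
  (1≤k : 1 ≤ k) (1≤ℓ : 1 ≤ ℓ) (2≤lo : 2 ≤ lo) (1≤M : 1 ≤ M) where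

  open Families k ℓ
  open Programs k ℓ

  -- The input address of the profit of vertex v for agent c.
  pos : ℕ → ℕ → ℕ
  pos zero    v = suc v
  pos (suc c) v = n + pos c v

  -- The addresses from N to N + k − 1 hold the scales, N + k stays unused.
  slot : Fin k → Fin n → ℕ
  slot c v = N + (k + pos (toℕ c) (toℕ v))

  Z : ℕ
  Z = M * K

  cell : ℕ → Fin K → ℕ → ℕ
  cell T L q = T + (q * K + toℕ L)

  cell< : ∀ T L {q} → q < M → cell T L q < T + Z
  cell< T L {q} q<M = +-monoʳ-< T (begin-strict
    q * K + toℕ L   <⟨ +-monoʳ-< (q * K) (toℕ<n L) ⟩
    q * K + K       ≡⟨ +-comm (q * K) K ⟩
    suc q * K       ≤⟨ *-monoˡ-≤ K q<M ⟩
    M * K           ∎)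
    where open ≤-Reasoning

  cell-injective : ∀ T L L′ q q′ → cell T L q ≡ cell T L′ q′ → L ≡ L′ × q ≡ q′
  cell-injective T L L′ q q′ eq =
    let L≡ , q≡ = divmod-unique K q q′ (toℕ<n L) (toℕ<n L′)
          (trans (+-comm (toℕ L) _) (trans (+-cancelˡ-≡ T _ _ eq) (+-comm (q′ * K) _)))
    in toℕ-injective L≡ , q≡

  -- The cell (1 , b) is a leaf with output address b, any other nonzero cell
  -- holds the addresses of its two children.  A first word 0 means no entry.
  Points : Memory → ℕ → ℕ → Tree → Set
  Holds : Memory → ℕ → ℕ → ℕ → Tree → Set
  Points m H a t = lo ≤ a × a + Z < H × Holds m H (m a) (m (a + Z)) t
  Holds m H x y (leaf b)   = x ≡ 1 × y ≡ b × b < lo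
  Holds m H x y (node l r) = Points m H x l × Points m H y r

  -- A leaf starts with 1 and a node with an address of at least `lo`; since 2 ≤ `lo`, the first
  -- word also tells these two kinds apart.
  holds-≢0 : ∀ {m H x y} t → Holds m H x y t → x ≢ 0
  holds-≢0 (leaf b) (refl , _) ()
  holds-≢0 (node l r) ((lo≤x , _) , _) x≡0 = <⇒≢ (≤-trans (s≤s z≤n) (≤-trans 2≤lo lo≤x)) (sym x≡0)

  -- All words that a tree depends on lie from `lo` up to below `H`. Neither output bits below `lo`
  -- nor writes from `H` on can disturb it.
  holds-frame : ∀ {m m′ H H′ x y} t → (∀ b → lo ≤ b → b < H → m′ b ≡ m b) → H ≤ H′ →
    Holds m H x y t → Holds m′ H′ x y t
  points-frame : ∀ {m m′ H H′ a} t → (∀ b → lo ≤ b → b < H → m′ b ≡ m b) → H ≤ H′ →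
    Points m H a t → Points m′ H′ a t
  points-frame {m} {m′} {a = a} t same H≤ (lo≤ , <H , h)
    rewrite sym (same a lo≤ (≤-<-trans (m≤m+n a Z) <H))
          | sym (same (a + Z) (≤-trans lo≤ (m≤m+n a Z)) <H) =
    lo≤ , ≤-trans <H H≤ , holds-frame t same H≤ h
  holds-frame (leaf b)   same H≤ h       = h
  holds-frame (node l r) same H≤ (p , q) = points-frame l same H≤ p , points-frame r same H≤ q

  -- A L q t: the subproblem A has a solution with labels in L and code q whose
  -- output addresses are the leaves of t.
  Spec : Set₁
  Spec = Fin K → ℕ → Tree → Set

  -- Completeness for codes below `M` suffices: in a union, a + b < `M` bounds both summands. So
  -- filling the tables needs no bound on the codes of subexpressions.
  record Table (A : Spec) (m : Memory) (H T : ℕ) : Set where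
    field
      lo≤T     : lo ≤ T
      end<     : T + Z + Z < H
      sound    : ∀ L q → q < M → m (cell T L q) ≢ 0 →
                 ∃[ t ] (A L q t × Holds m H (m (cell T L q)) (m (cell T L q + Z)) t)
      complete : ∀ L q t → A L q t → q < M → m (cell T L q) ≢ 0

  table-frame : ∀ {A m m′ H H′ T} → (∀ b → b < H → m′ b ≡ m b) → H ≤ H′ → Table A m H T → Table A m′ H′ T
  table-frame {A} {m} {m′} {H} {H′} {T} same H≤ tab = record
    { lo≤T = lo≤T
    ; end< = ≤-trans end< H≤
    ; sound = sound′
    ; complete = λ L q t a q<M → complete L q t a q<M ∘ trans (sym (first L q<M))
    }
    where
    open Table tab
    first : ∀ L {q} → q < M → m′ (cell T L q) ≡ m (cell T L q)
    first L q<M = same _ (<-trans (cell< T L q<M) (≤-<-trans (m≤m+n (T + Z) Z) end<))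
    second : ∀ L {q} → q < M → m′ (cell T L q + Z) ≡ m (cell T L q + Z)
    second L q<M = same _ (<-trans (+-monoˡ-< Z (cell< T L q<M)) end<)
    sound′ : ∀ L q → q < M → m′ (cell T L q) ≢ 0 →
      ∃[ t ] (A L q t × Holds m′ H′ (m′ (cell T L q)) (m′ (cell T L q + Z)) t)
    sound′ L q q<M nz rewrite first L q<M | second L q<M =
      let t , a , h = sound L q q<M nz in t , a , holds-frame t (λ b _ → same b) H≤ h

  Stack : Memory → ℕ → ℕ → List Spec → Set
  Stack m H S []      = ⊤
  Stack m H S (A ∷ Γ) = Table A m H S × Stack m H (m (S + Z + Z)) Γ

  stack-frame : ∀ {m m′ H H′ S} Γ → (∀ b → b < H → m′ b ≡ m b) → H ≤ H′ → Stack m H S Γ → Stack m′ H′ S Γ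
  stack-frame []      same H≤ _ = tt
  stack-frame {m} {m′} {S = S} (A ∷ Γ) same H≤ (tab , st)
    rewrite same (S + Z + Z) (Table.end< tab) = table-frame same H≤ tab , stack-frame Γ same H≤ st

  -- By `fresh`, a new table at `H` is empty without being cleared.
  record Config (m : Memory) (S H : ℕ) (Γ : List Spec) : Set where
    field
      lo≤H  : lo ≤ H
      agree : ∀ b → b < lo → m b ≡ base b
      fresh : ∀ b → H ≤ b → m b ≡ 0
      stack : Stack m H S Γ

  regs : (pc S H r₇ r₈ r₉ r₁₀ r₁₁ r₁₂ : ℕ) → List ℕ
  regs pc S H r₇ r₈ r₉ r₁₀ r₁₁ r₁₂ = N ∷ n ∷ Z ∷ pc ∷ S ∷ H ∷ kn ∷ r₇ ∷ r₈ ∷ r₉ ∷ r₁₀ ∷ r₁₁ ∷ r₁₂ ∷ []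

  -- m₀ is the memory before the table for A is filled at H.
  module Build (A : Spec) (m₀ : Memory) (S H : ℕ) {Γ : List Spec} (config : Config m₀ S H Γ) where
    open Config config using (lo≤H)

    -- Entries are judged in `m₀`, which does not change while the table grows; `exec-finish`
    -- transports them to the final memory once.
    record Partial (m : Memory) : Set where
      field
        below : ∀ b → b < H → m b ≡ m₀ b
        fresh : ∀ b → H + Z + Z ≤ b → m b ≡ 0
        sound : ∀ L q → q < M → m (cell H L q) ≢ 0 →
                ∃[ t ] (A L q t × Holds m₀ H (m (cell H L q)) (m (cell H L q + Z)) t)
    open Partial

    -- A cell may be overwritten by another solution with the same family and code, so what persists
    -- is only that it is occupied.
    record _⊑_ (m m′ : Memory) : Set where
      constructor keeps
      field keep : ∀ L q → q < M → m (cell H L q) ≢ 0 → m′ (cell H L q) ≢ 0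

    ⊑-refl : ∀ {m} → m ⊑ m
    ⊑-refl = keeps λ _ _ _ nz → nz

    open Steps Partial _⊑_ ⊑-refl
      (λ (keeps f) (keeps g) → keeps λ L q q<M → g L q q<M ∘ f L q q<M) public

    initially : Partial m₀
    initially .below b _ = refl
    initially .fresh b ≤b = Config.fresh config b (≤-trans (m≤m+n H Z) (≤-trans (m≤m+n (H + Z) Z) ≤b))
    initially .sound L q _ nz = contradiction (Config.fresh config _ (m≤m+n H _)) nz

    Filled : Fin K → ℕ → Memory → Set
    Filled L q m = q < M → m (cell H L q) ≢ 0

    filled-mono : ∀ {L q m m′} → m ⊑ m′ → Filled L q m → Filled L q m′
    filled-mono (keeps keep) filled q<M = keep _ _ q<M (filled q<M)

    store : ∀ {m L q t x y} → Partial m → A L q t → q < M → Holds m₀ H x y t →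
      let m′ = (m [ cell H L q ↦ x ]) [ cell H L q + Z ↦ y ] in Partial m′ × m ⊑ m′ × Filled L q m′
    store {m} {L} {q} {t} {x} {y} P a q<M h =
        record { below = below′ ; fresh = fresh′ ; sound = sound′ } , keeps mono , λ _ → nonzero
      where
      α = cell H L q
      m₁ = m [ α ↦ x ]
      m′ = m₁ [ α + Z ↦ y ]
      H≤α : H ≤ α
      H≤α = m≤m+n H _
      α< : α < H + Z
      α< = cell< H L q<M
      elsewhere : ∀ {b} → b ≢ α → b ≢ α + Z → m′ b ≡ m b
      elsewhere b≢ b≢′ = trans (update-other m₁ y b≢′) (update-other m x b≢)
      below′ : ∀ b → b < H → m′ b ≡ m₀ b
      below′ b b<H = trans (elsewhere (<⇒≢ (<-≤-trans b<H H≤α))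
          (<⇒≢ (<-≤-trans b<H (≤-trans H≤α (m≤m+n α Z))))) (P .below b b<H)
      fresh′ : ∀ b → H + Z + Z ≤ b → m′ b ≡ 0
      fresh′ b ≤b = trans (elsewhere (≢-sym (<⇒≢ (<-≤-trans α< (≤-trans (m≤m+n (H + Z) Z) ≤b))))
        (≢-sym (<⇒≢ (<-≤-trans (+-monoˡ-< Z α<) ≤b)))) (P .fresh b ≤b)
      first≢second : ∀ L₁ {q₁} → q₁ < M → cell H L₁ q₁ ≢ α + Z
      first≢second L₁ q₁<M = <⇒≢ (<-≤-trans (cell< H L₁ q₁<M) (+-monoˡ-≤ Z H≤α))
      nonzero : m′ α ≢ 0
      nonzero = holds-≢0 t h ∘ trans
          (sym (trans (update-other m₁ y (first≢second L q<M)) (update-same m x refl)))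
      mono : ∀ L₁ q₁ → q₁ < M → m (cell H L₁ q₁) ≢ 0 → m′ (cell H L₁ q₁) ≢ 0
      mono L₁ q₁ q₁<M nz with cell H L₁ q₁ ≟ α
      ... | yes e = subst (λ b → m′ b ≢ 0) (sym e) nonzero
      ... | no ≢α = nz ∘ trans (sym (elsewhere ≢α (first≢second L₁ q₁<M)))
      sound′ : ∀ L₁ q₁ → q₁ < M → m′ (cell H L₁ q₁) ≢ 0 →
        ∃[ t₁ ] (A L₁ q₁ t₁ × Holds m₀ H (m′ (cell H L₁ q₁)) (m′ (cell H L₁ q₁ + Z)) t₁)
      sound′ L₁ q₁ q₁<M nz with cell H L₁ q₁ ≟ α
      ... | yes e with refl , refl ← cell-injective H L₁ L q₁ q e =
        t , a , subst₂ (λ x y → Holds m₀ H x y t)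
          (sym (trans (update-other m₁ y (first≢second L q<M)) (update-same m x refl)))
          (sym (update-same m₁ {α + Z} y refl)) h
      ... | no ≢α = subst₂ (λ x y → ∃[ t₁ ] (A L₁ q₁ t₁ × Holds m₀ H x y t₁)) (sym same₁) (sym same₂)
          (P .sound L₁ q₁ q₁<M (nz ∘ trans same₁))
        where
        same₁ = elsewhere ≢α (first≢second L₁ q₁<M)
        same₂ = elsewhere (≢-sym (<⇒≢ (<-≤-trans α< (+-monoˡ-≤ Z (m≤m+n H _))))) (≢α ∘ +-cancelʳ-≡ Z _ _)

    -- The second assignment is evaluated after the first. Hence the address must have the same
    -- value in every memory, and `y` is evaluated in the memory updated at the first word.
    exec-write : ∀ {vs m L q t} a x y {X Y} → Partial m → A L q t → q < M → word vs 2 ≡ Z →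
      (∀ m′ → value a ⟨ word vs , m′ ⟩ ≡ cell H L q) → value x ⟨ word vs , m ⟩ ≡ X →
      value y ⟨ word vs , m [ cell H L q ↦ X ] ⟩ ≡ Y → Holds m₀ H X Y t →
      Exec (write a x y) vs m ((1 + cost a + cost x) + (1 + (1 + cost a + 1) + cost y)) (Step m (Filled L q) vs)
    exec-write {vs} {m} {L} {q} a x y {X} {Y} P al q<M z≡ a≡ x≡ y≡ h = exec-⨾ (exec-[]≔ (exec-[]≔
      (subst (Step m (Filled L q) vs vs) (sym same) (refl , store P al q<M h))))
      where
      m₁ = m [ value a ⟨ word vs , m ⟩ ↦ value x ⟨ word vs , m ⟩ ]
      m₁≡ : m₁ ≡ m [ cell H L q ↦ X ]
      m₁≡ = cong₂ (λ a x → m [ a ↦ x ]) (a≡ m) x≡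
      same : m₁ [ value a ⟨ word vs , m₁ ⟩ + word vs 2 ↦ value y ⟨ word vs , m₁ ⟩ ] ≡
             (m [ cell H L q ↦ X ]) [ cell H L q + Z ↦ Y ]
      same = trans (cong₂ (λ a y → m₁ [ a ↦ y ]) (cong₂ _+_ (a≡ m₁) z≡)
        (trans (cong (λ m → value y ⟨ word vs , m ⟩) m₁≡) y≡)) (cong (λ m → m [ cell H L q + Z ↦ Y ]) m₁≡)

    exec-finish : ∀ {m pc S′ r₇ r₈ r₉ r₁₀ r₁₁ link Γ′} l → Partial m → (∀ L q t → A L q t → Filled L q m) →
      Stack m₀ H link Γ′ →
      Exec (finish l) (regs pc S′ H r₇ r₈ r₉ r₁₀ r₁₁ link) m 25 λ vs′ m′ →
        vs′ ≡ regs (l + pc) H (1 + (H + Z + Z)) r₇ r₈ r₉ r₁₀ r₁₁ link × Config m′ H (1 + (H + Z + Z)) (A ∷ Γ′)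
    exec-finish {m} {link = link} {Γ′} l P filled st = within (≤ᵇ⇒≤ _ _ tt) $
      exec-⨾ (exec-[]≔ (exec-⨾ (exec-≔ (exec-⨾ (exec-≔ (exec-≔ (refl , record
        { lo≤H  = ≤-trans lo≤H H≤H′
        ; agree = λ b b<lo → trans (same b (<-≤-trans b<lo lo≤H)) (Config.agree config b b<lo)
        ; fresh = λ b H′≤b → trans (update-other m link (≢-sym (<⇒≢ H′≤b)))
            (P .fresh b (≤-trans (n≤1+n _) H′≤b))
        ; stack = record
          { lo≤T     = lo≤H
          ; end<     = n<1+n _
          ; sound    = sound′
          ; complete = λ L q t a q<M nz → filled L q t a q<M (trans (sym (first L q<M)) nz)
          } , subst (λ S → Stack m′ H′ S Γ′) (sym (update-same m link refl)) (stack-frame Γ′ same H≤H′ st)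
        })))))))
      where
      H′ = 1 + (H + Z + Z)
      m′ = m [ H + Z + Z ↦ link ]
      H≤ : H ≤ H + Z + Z
      H≤ = ≤-trans (m≤m+n H Z) (m≤m+n (H + Z) Z)
      H≤H′ : H ≤ H′
      H≤H′ = ≤-trans H≤ (n≤1+n _)
      same : ∀ b → b < H → m′ b ≡ m₀ b
      same b b<H = trans (update-other m link (<⇒≢ (<-≤-trans b<H H≤))) (P .below b b<H)
      first : ∀ L {q} → q < M → m′ (cell H L q) ≡ m (cell H L q)
      first L q<M = update-other m link (<⇒≢ (<-≤-trans (cell< H L q<M) (m≤m+n (H + Z) Z)))
      second : ∀ L {q} → q < M → m′ (cell H L q + Z) ≡ m (cell H L q + Z)
      second L q<M = update-other m link (<⇒≢ (+-monoˡ-< Z (cell< H L q<M)))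
      sound′ : ∀ L q → q < M → m′ (cell H L q) ≢ 0 →
        ∃[ t ] (A L q t × Holds m′ H′ (m′ (cell H L q)) (m′ (cell H L q + Z)) t)
      sound′ L q q<M nz rewrite first L q<M | second L q<M =
        let t , a , h = P .sound L q q<M nz in t , a , holds-frame t (λ b _ → same b) H≤H′ h

  LeafSpec : Fin ℓ → Fin n → Spec
  LeafSpec i v L q t = (q ≡ 0 × t ≡ leaf 0) ⊎
    ∃[ c ] (has L c i ≡ true × q ≡ weight c v × t ≡ leaf (slot c v))

  UnionSpec : Spec → Spec → Spec
  UnionSpec A B L q t = ∃[ a ] ∃[ b ] ∃[ s ] ∃[ u ] (q ≡ a + b × t ≡ node s u × A L a s × B L b u)

  TransferSpec : ∀ {D} → (Fin K → Fin D → Fin K) → Spec → Spec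
  TransferSpec src A L q t = ∃[ d ] A (src L d) q t

  module _ (weights : ∀ c v → base (pos (toℕ c) (toℕ v)) ≡ weight c v * K)
           (pos<lo : ∀ (c : Fin k) (v : Fin n) → pos (toℕ c) (toℕ v) < lo) (slot<lo : ∀ c v → slot c v < lo)
           (weight<M : ∀ c v → weight c v < M) where

    module _ {m₀ S H Γ} (config : Config m₀ S H Γ) (i : Fin ℓ) (v : Fin n) where

      open Build (LeafSpec i v) m₀ S H config

      exec-emptyClass : ∀ {pc r₇ r₈ r₉ r₁₀ r₁₁ r₁₂ m} L → Partial m →
        let vs = regs pc S H r₇ r₈ r₉ r₁₀ r₁₁ r₁₂ in
        Exec (emptyClass L) vs m (40 * 1) (Step m (Filled L 0) vs)
      exec-emptyClass L P = within (≤ᵇ⇒≤ _ _ tt) $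
        exec-write (cellAt 5 (lit 0) L) (lit 1) (lit 0) P (inj₁ (refl , refl)) 1≤M refl (λ _ → refl) refl refl
          (refl , refl , ≤-trans (s≤s z≤n) 2≤lo)

      exec-colored : ∀ {pc r₇ r₈ r₉ r₁₂ m} c L → Partial m →
        let vs = regs pc S H r₇ r₈ r₉ (pos (toℕ c) (toℕ v)) (weight c v * K) r₁₂ in
        Exec (colored i c L) vs m (40 * 1)
          (Step m (λ m′ → has L c i ≡ true → Filled L (weight c v) m′) vs)
      exec-colored c L P with has L c i in e
      ... | false = within (≤ᵇ⇒≤ _ _ tt) (exec-skip (refl , P , ⊑-refl , λ ()))
      ... | true  = within (≤ᵇ⇒≤ _ _ tt) $ exec-map (λ (eq , P′ , m⊑ , g) → eq , P′ , m⊑ , λ _ → g) $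
        exec-write (cellAt 5 (var 11) L) (lit 1) (var 0 ⊞ (lit k ⊞ var 10)) P
          (inj₂ (c , e , refl , refl)) (weight<M c v) refl (λ _ → refl) refl refl
          (refl , refl , slot<lo c v)

      Colored : Fin k → Memory → Set
      Colored c m = ∀ L → has L c i ≡ true → Filled L (weight c v) m

      exec-colorLeaf : ∀ {pc r₇ r₈ r₁₂ m} c → Partial m →
        let vs = λ c → regs pc S H r₇ r₈ (toℕ v) (pos c (toℕ v)) 0 r₁₂ in
        Exec (colorLeaf i c) (vs (toℕ c)) m (50 * (K * 1)) (Step m (Colored c) (vs (suc (toℕ c))))
      exec-colorLeaf {pc} {r₇} {r₈} {r₁₂} {m} c P = within
        (+-cost (K * 1) 3 47 (c≤c*X 3 1≤K1) (+-cost (K * 1) 41 6 (forAll-cost 40 1≤K ≤-refl) (c≤c*X 6 1≤K1)))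
        (exec-⨾ (exec-≔ (subst (λ w → Exec (forAll K (colored i c) ⨾ 11 ≔ lit 0 ⨾
            10 ≔ var 1 ⊞ var 10) (regs pc S H r₇ r₈ (toℕ v) (pos (toℕ c) (toℕ v)) w r₁₂) m
            (1 + K * (40 * 1) + 6) (Step m (Colored c)
                (regs pc S H r₇ r₈ (toℕ v) (pos (suc (toℕ c)) (toℕ v)) 0 r₁₂))) (sym stored)
          (exec-⨾ (exec-map (λ { (refl , P′ , m⊑ , g) → exec-⨾ (exec-≔ (exec-≔ (refl , P′ , m⊑ , g))) })
            (exec-forAll 40 1 K (λ _ → regs pc S H r₇ r₈ (toℕ v) (pos (toℕ c) (toℕ v)) (weight c v * K) r₁₂)
              (λ L m → has L c i ≡ true → Filled L (weight c v) m)
              (λ L m⊑ g h → filled-mono {L} {weight c v} m⊑ (g h)) (λ L → exec-colored c L) P))))))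
        where
        1≤K1 : 1 ≤ K * 1
        1≤K1 = *-mono-≤ 1≤K ≤-refl
        stored : m (pos (toℕ c) (toℕ v)) ≡ weight c v * K
        stored = trans (Partial.below P _ (<-≤-trans (pos<lo c v) (Config.lo≤H config)))
          (trans (Config.agree config _ (pos<lo c v)) (weights c v))

      exec-leafTable : ∀ {pc r₇ r₈ r₁₀ r₁₁ r₁₂ m r₉} → r₉ ≡ toℕ v → Partial m →
        Exec (leafTable i) (regs pc S H r₇ r₈ r₉ r₁₀ r₁₁ r₁₂) m (98 * (k * (K * 1))) λ vs′ m′ →
          vs′ ≡ regs pc S H r₇ r₈ r₉ (pos k r₉) 0 r₁₂ × Partial m′ ×
              (∀ L q t → LeafSpec i v L q t → Filled L q m′)
      exec-leafTable {pc} {r₇} {r₈} {r₁₀} {r₁₁} {r₁₂} refl P = within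
        (+-cost (k * (K * 1)) 41 57 (≤-trans (forAll-cost 40 1≤K ≤-refl) (*-monoʳ-≤ 41 K≤))
          (+-cost (k * (K * 1)) 2 55 (c≤c*X 2 1≤X)
              (+-cost (k * (K * 1)) 4 51 (c≤c*X 4 1≤X) (forAll-cost 50 1≤k 1≤K1))))
        (exec-⨾ (exec-map
          (λ { (refl , P₁ , _ , empties) → exec-⨾ (exec-≔ (exec-⨾ (exec-≔ (exec-map
            (λ (eq , P₂ , m⊑ , colors) → eq , P₂ , λ where
              L .0 t (inj₁ (refl , _)) → filled-mono {L} {0} m⊑ (empties L)
              L _ t (inj₂ (c , h , refl , _)) → colors c L h)
            (exec-forAll 50 (K * 1) k (λ c → regs pc S H r₇ r₈ (toℕ v) (pos c (toℕ v)) 0 r₁₂) Colored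
              (λ c m⊑ g L h → filled-mono {L} {weight c v} m⊑ (g L h)) (λ c → exec-colorLeaf c) P₁))))) })
          (exec-forAll 40 1 K (λ _ → regs pc S H r₇ r₈ (toℕ v) r₁₀ r₁₁ r₁₂) (λ L → Filled L 0)
            (λ L → filled-mono {L} {0}) (λ L → exec-emptyClass L) P)))
        where
        1≤K1 : 1 ≤ K * 1
        1≤K1 = *-mono-≤ 1≤K ≤-refl
        K≤ : K * 1 ≤ k * (K * 1)
        K≤ = m≤n*m (K * 1) k {{>-nonZero 1≤k}}
        1≤X : 1 ≤ k * (K * 1)
        1≤X = ≤-trans 1≤K1 K≤

  module _ {A : Spec} {D : ℕ} (1≤D : 1 ≤ D) (src : Fin K → Fin D → Fin K) {m₀ S H Γ}
           (config : Config m₀ S H Γ) (table : Table A m₀ H S) where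

    open Build (TransferSpec src A) m₀ S H config
    open Table table using (end<)

    Copied : ℕ → Fin K → Fin D → Memory → Set
    Copied q L d m = ∀ t → A (src L d) q t → Filled L q m

    copied-mono : ∀ q L d {m m′} → m ⊑ m′ → Copied q L d m → Copied q L d m′
    copied-mono q L d m⊑ g t a = filled-mono {L} {q} m⊑ (g t a)

    exec-copy : ∀ {pc r₇ r₈ r₉ r₁₁ r₁₂ m} q → q < M → ∀ L d → Partial m →
      let vs = regs pc S H r₇ r₈ r₉ (q * K) r₁₁ r₁₂ in
      Exec (copy (src L d) L) vs m (60 * 1) (Step m (Copied q L d) vs)
    exec-copy {m = m} q q<M L d P with m₀ (cell S (src L d) q) ≟ 0
    ... | yes zero₀ = within (≤ᵇ⇒≤ _ _ tt) $
      exec-else (trans first zero₀) (exec-skip (refl , P , ⊑-refl ,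
        λ t a _ → contradiction zero₀ (Table.complete table _ q t a q<M)))
      where
      first : m (cell S (src L d) q) ≡ m₀ (cell S (src L d) q)
      first = Partial.below P _ (<-trans (cell< S _ q<M) (≤-<-trans (m≤m+n (S + Z) Z) end<))
    ... | no nonzero with Table.sound table (src L d) q q<M nonzero
    ... | t , a , h = within (≤ᵇ⇒≤ _ _ tt) $
      exec-then (nonzero ∘ trans (sym first)) (exec-map (λ (eq , P′ , m⊑ , g) → eq , P′ , m⊑ , λ _ _ → g)
        (exec-write (cellAt 5 (var 10) L) (load (cellAt 4 (var 10) (src L d)))
            (load (cellAt 4 (var 10) (src L d) ⊞ var 2))
          P (d , a) q<M refl (λ _ → refl) first second h))
      where
      c<H : cell S (src L d) q < H
      c<H = <-trans (cell< S _ q<M) (≤-<-trans (m≤m+n (S + Z) Z) end<)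
      c+Z<H : cell S (src L d) q + Z < H
      c+Z<H = <-trans (+-monoˡ-< Z (cell< S _ q<M)) end<
      first : m (cell S (src L d) q) ≡ m₀ (cell S (src L d) q)
      first = Partial.below P _ c<H
      second : (m [ cell H L q ↦ m₀ (cell S (src L d) q) ]) (cell S (src L d) q + Z) ≡ m₀
          (cell S (src L d) q + Z)
      second = trans (update-other m _ (<⇒≢ (<-≤-trans c+Z<H (m≤m+n H _)))) (Partial.below P _ c+Z<H)

    exec-transfer : ∀ {pc r₇ r₈ r₉ r₁₀ r₁₁ r₁₂ m} → Partial m →
      Exec (transfer D src) (regs pc S H r₇ r₈ r₉ r₁₀ r₁₁ r₁₂) m (76 * (M * (K * (D * 1)))) λ vs′ m′ →
        vs′ ≡ regs pc S H r₇ r₈ r₉ (M * K) r₁₁ r₁₂ × Partial m′ ×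
            (∀ L q t → TransferSpec src A L q t → Filled L q m′)
    exec-transfer {pc} {r₇} {r₈} {r₉} {r₁₀} {r₁₁} {r₁₂} P = within
      (+-cost (M * (K * (D * 1))) 2 74 (c≤c*X 2 (*-mono-≤ 1≤M 1≤X)) (while-cost 4 66 1≤M 1≤X
        (+-cost (K * (D * 1)) 62 4 (forAll-cost 61 1≤K (*-mono-≤ 1≤D ≤-refl)) (c≤c*X 4 1≤X))))
      (exec-⨾ (exec-≔ (exec-map
        (λ (eq , P′ , _ , g) → eq , P′ , λ L q t (d , a) q<M → g q q<M L d t a q<M)
        (exec-while M (λ q → regs pc S H r₇ r₈ r₉ (q * K) r₁₁ r₁₂) (λ q m → ∀ L d → Copied q L d m)
          (λ q m⊑ g L d → copied-mono q L d m⊑ (g L d))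
          (λ q q<M → ∸-suc≢0 (*-monoˡ-< K {{>-nonZero 1≤K}} q<M)) (n∸n≡0 (M * K))
          (λ q q<M P₁ → exec-⨾ (exec-map (λ { (refl , P₂ , m⊑ , g) → exec-≔ (refl , P₂ , m⊑ , g) })
            (exec-forAll 61 (D * 1) K (λ _ → regs pc S H r₇ r₈ r₉ (q * K) r₁₁ r₁₂) (λ L m → ∀ d →
                Copied q L d m)
              (λ L m⊑ g d → copied-mono q L d m⊑ (g d))
              (λ L P₃ → within (forAll-cost 60 1≤D ≤-refl)
                (exec-forAll 60 1 D (λ _ → regs pc S H r₇ r₈ r₉ (q * K) r₁₁ r₁₂) (Copied q L)
                  (copied-mono q L) (λ d → exec-copy q q<M L d) P₃))
              P₁)))
          P))))
      where
      1≤X : 1 ≤ K * (D * 1)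
      1≤X = *-mono-≤ 1≤K (*-mono-≤ 1≤D ≤-refl)

  module _ {A B : Spec} {m₀ S H Γ} (config : Config m₀ S H Γ)
           {T : ℕ} (tableA : Table A m₀ H T) (tableB : Table B m₀ H S) where

    open Build (UnionSpec A B) m₀ S H config

    Merged : ℕ → ℕ → Fin K → Memory → Set
    Merged a b L m = ∀ s u → A L a s → B L b u → Filled L (a + b) m

    merged-mono : ∀ a b L {m m′} → m ⊑ m′ → Merged a b L m → Merged a b L m′
    merged-mono a b L m⊑ g s u x y = filled-mono {L} {a + b} m⊑ (g s u x y)

    module _ {C T} (table : Table C m₀ H T) where
      open Table table

      cell-below : ∀ {m} → Partial m → ∀ L {q} → q < M → m (cell T L q) ≡ m₀ (cell T L q)
      cell-below P L q<M = Partial.below P _ (<-trans (cell< T L q<M) (≤-<-trans (m≤m+n (T + Z) Z) end<))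

      cell-points : ∀ L {q t} → q < M → Holds m₀ H (m₀ (cell T L q)) (m₀ (cell T L q + Z)) t →
          Points m₀ H (cell T L q) t
      cell-points L q<M h = ≤-trans lo≤T (m≤m+n T _) , <-trans (+-monoˡ-< Z (cell< T L q<M)) end< , h

    exec-merge : ∀ {pc r₇ r₉ r₁₂ m} a b → a + b < M → ∀ L → Partial m →
      let vs = regs pc S H r₇ T r₉ (a * K) (b * K) r₁₂ in
      Exec (merge L) vs m (70 * 1) (Step m (Merged a b L) vs)
    exec-merge {m = m} a b a+b<M L P = byCases (m₀ (cell T L a) ≟ 0) (m₀ (cell S L b) ≟ 0)
      where
      a<M = ≤-<-trans (m≤m+n a b) a+b<M
      b<M = ≤-<-trans (m≤n+m b a) a+b<M
      firstA = cell-below tableA P L a<M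
      firstB = cell-below tableB P L b<M
      byCases : _ → _ → Exec (merge L) _ m (70 * 1) (Step m (Merged a b L) _)
      byCases (yes zeroA) _ = within (≤ᵇ⇒≤ _ _ tt) $ exec-else (trans firstA zeroA)
        (exec-skip (refl , P , ⊑-refl , λ s u x y _ → contradiction zeroA (Table.complete tableA L a s x a<M)))
      byCases (no nonzeroA) (yes zeroB) = within (≤ᵇ⇒≤ _ _ tt) $ exec-then (nonzeroA ∘ trans (sym firstA)) $
        exec-else (trans firstB zeroB)
        (exec-skip (refl , P , ⊑-refl , λ s u x y _ → contradiction zeroB (Table.complete tableB L b u y b<M)))
      byCases (no nonzeroA) (no nonzeroB) =
        let s , x , h  = Table.sound tableA L a a<M nonzeroA
            u , y , h′ = Table.sound tableB L b b<M nonzeroB in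
        within (≤ᵇ⇒≤ _ _ tt) $ exec-then (nonzeroA ∘ trans (sym firstA)) $
            exec-then (nonzeroB ∘ trans (sym firstB)) $
        exec-map (λ (eq , P′ , m⊑ , g) → eq , P′ , m⊑ , λ _ _ _ _ → g) $
        exec-write (cellAt 5 (var 10 ⊞ var 11) L) (cellAt 8 (var 10) L) (cellAt 4 (var 11) L) P
          (a , b , s , u , refl , refl , x , y) a+b<M refl
          (λ _ → cong (λ x → H + (x + toℕ L)) (sym (*-distribʳ-+ K a b))) refl refl
          (cell-points tableA L a<M h , cell-points tableB L b<M h′)

    exec-union : ∀ {pc r₇ r₉ r₁₀ r₁₁ r₁₂ m} → Partial m →
      Exec union (regs pc S H r₇ T r₉ r₁₀ r₁₁ r₁₂) m (109 * (M * (M * (K * 1)))) λ vs′ m′ →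
        vs′ ≡ regs pc S H r₇ T r₉ (M * K) 0 r₁₂ × Partial m′ × (∀ L q t → UnionSpec A B L q t → Filled L q m′)
    exec-union {pc} {r₇} {r₉} {r₁₀} {r₁₁} {r₁₂} P = within
      (+-cost (M * (M * (K * 1))) 2 107 (c≤c*X 2 1≤MX)
          (+-cost (M * (M * (K * 1))) 2 105 (c≤c*X 2 1≤MX) (while-cost 4 97 1≤M 1≤X
        (+-cost (M * (K * 1)) 91 6 ≤-refl (c≤c*X 6 1≤X)))))
      (exec-⨾ (exec-≔ (exec-⨾ (exec-≔ (exec-map
        (λ (eq , P′ , _ , g) → eq , P′ , λ where
          L _ _ (a , b , s , u , refl , refl , x , y) q<M →
            -- A sum below `M` places b among the `M ∸ a` rounds of the inner loop.
            g a (≤-<-trans (m≤m+n a b) q<M) b (m+n≤o⇒m≤o∸n (suc b) (subst (_< M) (+-comm a b) q<M)) L s u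
                x y q<M)
        (exec-while M (λ a → vs a 0) (λ a m → ∀ b → b < M ∸ a → ∀ L → Merged a b L m)
          (λ a m⊑ g b b< L → merged-mono a b L m⊑ (g b b< L))
          (λ a a<M → ∸-suc≢0 (*-monoˡ-< K {{>-nonZero 1≤K}} a<M)) (n∸n≡0 (M * K)) row P))))))
      where
      vs : ℕ → ℕ → List ℕ
      vs a b = regs pc S H r₇ T r₉ (a * K) (b * K) r₁₂
      1≤X : 1 ≤ M * (K * 1)
      1≤X = *-mono-≤ 1≤M (*-mono-≤ 1≤K ≤-refl)
      1≤MX : 1 ≤ M * (M * (K * 1))
      1≤MX = *-mono-≤ 1≤M 1≤X
      +< : ∀ {a b} → a < M → b < M ∸ a → a + b < M
      +< {a} {b} a<M b< = subst (a + b <_) (m+[n∸m]≡n (<⇒≤ a<M)) (+-monoʳ-< a b<)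
      row : ∀ a {m} → a < M → Partial m → Exec _ (vs a 0) m (91 * (M * (K * 1)) + 6)
        (Step m (λ m′ → ∀ b → b < M ∸ a → ∀ L → Merged a b L m′) (vs (suc a) 0))
      row a a<M P₁ = exec-⨾ (exec-map
        (λ { (refl , P₂ , m⊑ , g) → exec-⨾ (exec-≔ (exec-≔ (refl , P₂ , m⊑ , g))) })
        -- A row runs for `M ∸ a` rounds but is charged for `M`, to make the bound uniform in `a`.
        (within (≤-trans (while-cost 6 75 (m<n⇒0<n∸m a<M) (*-mono-≤ 1≤K ≤-refl)
              (+-cost (K * 1) 71 4 (forAll-cost 70 1≤K ≤-refl) (c≤c*X 4 (*-mono-≤ 1≤K ≤-refl))))
            (*-mono-≤ {87} {91} (≤ᵇ⇒≤ _ _ tt) (*-monoˡ-≤ (K * 1) (m∸n≤m M a))))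
          (exec-while (M ∸ a) (vs a) (λ b m → ∀ L → Merged a b L m)
            (λ b m⊑ g L → merged-mono a b L m⊑ (g L))
            (λ b b< → subst (λ x → Z ∸ x ≢ 0) (*-distribʳ-+ K a b)
              (∸-suc≢0 (*-monoˡ-< K {{>-nonZero 1≤K}} (+< a<M b<))))
            (trans (cong (Z ∸_) (trans (sym (*-distribʳ-+ K a (M ∸ a)))
                (cong (_* K) (m+[n∸m]≡n (<⇒≤ a<M))))) (n∸n≡0 Z))
            (λ b b< P₃ → exec-⨾ (exec-map (λ { (refl , P₄ , m⊑ , g) → exec-≔ (refl , P₄ , m⊑ , g) })
              (exec-forAll 70 1 K (λ _ → vs a b) (Merged a b) (merged-mono a b) (λ L →
                  exec-merge a b (+< a<M b<) L) P₃)))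
            P₁)))

  -- Evaluation of a whole expression

  Solutions : Expression ℓ n → Spec
  Solutions (vertex i v)  = LeafSpec i v
  Solutions (σ ⊕ τ)       = UnionSpec (Solutions σ) (Solutions τ)
  Solutions (η i j _ σ)   = TransferSpec (cut i j) (Solutions σ)
  Solutions (ρ i j _ σ)   = TransferSpec {1} (λ L _ → preimage i j L) (Solutions σ)

  data At (pc : ℕ) (Γ : List Spec) : List ℕ → Memory → Set where
    at : ∀ {S H r₇ r₈ r₉ r₁₀ r₁₁ r₁₂ m} → Config m S H Γ → At pc Γ (regs pc S H r₇ r₈ r₉ r₁₀ r₁₁ r₁₂) m

  -- The numeral 250 exceeds 145, 158 and 177, the numerals obtained below for joins and
  -- relabellings, for vertices and for unions.
  nodeCost : ℕ
  nodeCost = 250 * (K * K * (M * M))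

  ℓ≤K : ℓ ≤ K
  ℓ≤K = ≤-trans (n≤2^n ℓ) (^-monoʳ-≤ 2 (m≤n*m ℓ k {{>-nonZero 1≤k}}))

  -- Costs with fewer factors are padded with ones to two factors up to `K` and two up to `M`.
  ≤U : ∀ {a b c d} → a ≤ K → b ≤ K → c ≤ M → d ≤ M → a * b * (c * d) ≤ K * K * (M * M)
  ≤U a≤ b≤ c≤ d≤ = *-mono-≤ (*-mono-≤ a≤ b≤) (*-mono-≤ c≤ d≤)

  1≤U : 1 ≤ K * K * (M * M)
  1≤U = ≤U {1} {1} {1} {1} 1≤K 1≤K 1≤M 1≤M

  ℓ≤U : ℓ ≤ K * K * (M * M)
  ℓ≤U = ≤-trans (≤-reflexive (sym (trans (*-identityʳ _) (*-identityʳ _)))) (≤U {ℓ} {1} {1} {1} ℓ≤K 1≤K 1≤M 1≤M)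

  switch-cost : ∀ {C} c → C ≤ c * (K * K * (M * M)) → ℓ * 4 + C ≤ (4 + c) * (K * K * (M * M))
  switch-cost c C≤ = +-cost _ 4 c (≤-trans (≤-reflexive (*-comm ℓ 4)) (*-monoʳ-≤ 4 ℓ≤U)) C≤

  module _ (lo≤ : N ≤ lo) where

    -- The 29 steps are 3 + 5 + 5 for the fetched words and 4 * 4 for the dispatch over four
    -- opcodes.
    exec-fetch : ∀ {pc S H r₇ r₈ r₉ r₁₀ r₁₁ r₁₂ m C Q} o → m pc ≡ toℕ o →
      Exec (operation o) (regs pc S H (m pc) (m (1 + pc)) (m (2 + pc)) r₁₀ r₁₁ r₁₂) m C Q →
      Exec symbol (regs pc S H r₇ r₈ r₉ r₁₀ r₁₁ r₁₂) m (29 + C) Q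
    exec-fetch o eq x = exec-⨾ (exec-≔ (exec-⨾ (exec-≔ (exec-⨾ (exec-≔ (exec-switch 0 4 {operation} o eq x))))))

    fetched : ∀ {m S H Γ pc w ws} → Config m S H Γ → Seg base pc (w ∷ ws) → length ws + suc pc ≤ N → m pc ≡ w
    fetched {pc = pc} {ws = ws} config (e , _) fits =
      trans (Config.agree config _ (≤-trans (m≤n+m (suc pc) (length ws)) (≤-trans fits lo≤))) e

    U : ℕ
    U = K * K * (M * M)

    exec-relabelled : ∀ {pc A Γ m S H r₇ r₈ r₉ r₁₀ r₁₁ r₁₂ D} src i j → 1 ≤ D → D ≤ K →
      r₈ ≡ toℕ i → r₉ ≡ toℕ j → Config m S H (A ∷ Γ) →
      Exec (relabelled D src) (regs pc S H r₇ r₈ r₉ r₁₀ r₁₁ r₁₂) m (116 * U)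
          (At (3 + pc) (TransferSpec (src i j) A ∷ Γ))
    exec-relabelled {A = A} {m = m} {S} {H} {D = D} src i j 1≤D D≤K i≡ j≡ config = within
      (+-cost U 7 109 (c≤c*X 7 1≤U) (+-cost U 84 25
        (switch-cost 80 (switch-cost 76 (*-monoʳ-≤ 76 small))) (c≤c*X 25 1≤U)))
      (exec-⨾ (exec-≔ (exec-⨾ (exec-switch 0 ℓ i i≡ (exec-switch 0 ℓ j j≡
        (exec-map (λ { (refl , P , filled) →
            exec-map (λ { (refl , config′) → at config′ })
                (exec-finish 3 P filled (proj₂ (Config.stack config))) })
          (exec-transfer 1≤D (src i j) config (proj₁ (Config.stack config)) initially)))))))
      where
      open Build (TransferSpec (src i j) A) m S H config
      rearrange : ∀ m x d → m * (x * (d * 1)) ≡ x * d * (m * 1)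
      rearrange = solve-∀
      small : M * (K * (D * 1)) ≤ U
      small = ≤-trans (≤-reflexive (rearrange M K D)) (≤U {K} {D} {M} {1} ≤-refl D≤K ≤-refl 1≤M)

    exec-relabelled-symbol : ∀ {pc A Γ vs m D} o src i j → operation o ≡ relabelled D src → 1 ≤ D → D ≤ K →
      Seg base pc (toℕ o ∷ toℕ i ∷ toℕ j ∷ []) → 3 + pc ≤ N → At pc (A ∷ Γ) vs m →
      Exec symbol vs m nodeCost (At (3 + pc) (TransferSpec (src i j) A ∷ Γ))
    exec-relabelled-symbol {pc} {A} {Γ} {m = m} o src i j o≡ 1≤D D≤K
      seg@(_ , seg₁@(_ , seg₂)) fits (at {S} {H} {r₁₀ = r₁₀} {r₁₁} {r₁₂} config) = within
      (≤-trans (+-cost U 29 116 (c≤c*X 29 1≤U) ≤-refl) (*-monoˡ-≤ U {145} {250} (≤ᵇ⇒≤ _ _ tt)))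
      (exec-fetch o (fetched config seg fits) (subst
        (λ P → Exec P (regs pc S H (m pc) (m (1 + pc)) (m (2 + pc)) r₁₀ r₁₁ r₁₂) m (116 * U)
            (At (3 + pc) (TransferSpec (src i j) A ∷ Γ)))
        (sym o≡)
        (exec-relabelled src i j 1≤D D≤K (fetched config seg₁ fits) (fetched config seg₂ fits) config)))

    exec-union-symbol : ∀ {pc A B Γ vs m} → Seg base pc (1 ∷ []) → 1 + pc ≤ N → At pc (B ∷ A ∷ Γ) vs m →
      Exec symbol vs m nodeCost (At (1 + pc) (UnionSpec A B ∷ Γ))
    exec-union-symbol {pc} {A} {B} {Γ} {m = m} seg fits (at {S} {H} config) = within
      (≤-trans (+-cost U 29 148 (c≤c*X 29 1≤U) (+-cost U 7 141 (c≤c*X 7 1≤U) (+-cost U 7 134 (c≤c*X 7 1≤U)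
        (+-cost U 109 25 (*-monoʳ-≤ 109 small) (c≤c*X 25 1≤U))))) (*-monoˡ-≤ U {177} {250} (≤ᵇ⇒≤ _ _ tt)))
      (exec-fetch (suc zero) (fetched config seg fits)
        (exec-⨾ (exec-≔ (exec-⨾ (exec-≔ (exec-⨾
          (exec-map (λ { (refl , P , filled) →
              exec-map (λ { (refl , config′) → at config′ })
                (exec-finish 1 P filled (proj₂ (proj₂ (Config.stack config)))) })
            (exec-union config (proj₁ (proj₂ (Config.stack config))) (proj₁ (Config.stack config))
                initially))))))))
      where
      open Build (UnionSpec A B) m S H config
      rearrange : ∀ m x → m * (m * (x * 1)) ≡ x * 1 * (m * m)
      rearrange = solve-∀
      small : M * (M * (K * 1)) ≤ U
      small = ≤-trans (≤-reflexive (rearrange M K)) (≤U {K} {1} {M} {M} ≤-refl 1≤K ≤-refl ≤-refl)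

    module _ (weights : ∀ c v → base (pos (toℕ c) (toℕ v)) ≡ weight c v * K)
             (pos<lo : ∀ (c : Fin k) (v : Fin n) → pos (toℕ c) (toℕ v) < lo) (slot<lo : ∀ c v → slot c v < lo)
             (weight<M : ∀ c v → weight c v < M) where

      exec-vertex-symbol : ∀ {pc Γ vs m} i v → Seg base pc (0 ∷ toℕ i ∷ toℕ v ∷ []) → 3 + pc ≤ N →
          At pc Γ vs m →
        Exec symbol vs m nodeCost (At (3 + pc) (LeafSpec i v ∷ Γ))
      exec-vertex-symbol {pc} {Γ} {m = m} i v seg@(_ , seg₁@(_ , seg₂)) fits (at {S} {H} config) = within
        (≤-trans (+-cost U 29 129 (c≤c*X 29 1≤U) (+-cost U 2 127 (c≤c*X 2 1≤U) (+-cost U 102 25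
          (switch-cost 98 (*-monoʳ-≤ 98 small)) (c≤c*X 25 1≤U)))) (*-monoˡ-≤ U {158} {250} (≤ᵇ⇒≤ _ _ tt)))
        (exec-fetch zero (fetched config seg fits)
          (exec-⨾ (exec-≔ (exec-⨾ (exec-switch 0 ℓ i (fetched config seg₁ fits)
            (exec-map (λ { (refl , P , filled) →
                exec-map (λ { (refl , config′) → at config′ }) (exec-finish 3 P filled (Config.stack config)) })
              (exec-leafTable weights pos<lo slot<lo weight<M config i v (fetched config seg₂ fits)
                  initially)))))))
        where
        open Build (LeafSpec i v) m S H config
        small : k * (K * 1) ≤ U
        small = ≤-trans (≤-reflexive (sym (*-assoc k K 1))) (≤U {k} {K} {1} {1} (k≤K 1≤ℓ) ≤-refl 1≤M 1≤M)

      exec-step : ∀ {pc pc′ Γ Γ′ vs m C Q} → pc < N → At pc Γ vs m → Exec symbol vs m nodeCost (At pc′ Γ′) →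
        (∀ {vs′ m′} → At pc′ Γ′ vs′ m′ → Exec evaluate vs′ m′ C Q) → Exec evaluate vs m (4 + nodeCost + C) Q
      exec-step pc<N (at _) x continue = exec-loop (∸-suc≢0 pc<N) (exec-map continue x)

      -- A single loop runs through all symbols, so a subexpression is no subprogram with a run of
      -- its own. The remaining run is passed as a continuation, and the induction follows the
      -- postfix order.
      exec-evaluate : ∀ σ {pc Γ vs m C Q} → Seg base pc (encode σ) → ∣ σ ∣ᵉ + pc ≤ N → At pc Γ vs m →
        (∀ {vs′ m′} → At (∣ σ ∣ᵉ + pc) (Solutions σ ∷ Γ) vs′ m′ → Exec evaluate vs′ m′ C Q) →
        Exec evaluate vs m (∣ σ ∣ᵉ * (4 + nodeCost) + C) Q
      exec-unary : ∀ σ w (i j : Fin ℓ) {A pc Γ vs m C Q} →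
        (∀ {pc vs m} → Seg base pc (w ∷ toℕ i ∷ toℕ j ∷ []) → 3 + pc ≤ N → At pc (Solutions σ ∷ Γ) vs m →
          Exec symbol vs m nodeCost (At (3 + pc) (A ∷ Γ))) →
        let ws = encode σ ++ w ∷ toℕ i ∷ toℕ j ∷ [] in
        Seg base pc ws → length ws + pc ≤ N → At pc Γ vs m →
        (∀ {vs′ m′} → At (length ws + pc) (A ∷ Γ) vs′ m′ → Exec evaluate vs′ m′ C Q) →
        Exec evaluate vs m (length ws * (4 + nodeCost) + C) Q
      exec-evaluate (vertex i v) {C = C} seg fits here continue = within
        (+-monoˡ-≤ C (m≤m+n (4 + nodeCost) (2 * (4 + nodeCost))))
        (exec-step (≤-trans (s≤s (m≤n+m _ 2)) fits) here (exec-vertex-symbol i v seg fits here) continue)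
      exec-evaluate (σ ⊕ τ) {pc} {Γ} {C = C} seg fits here continue = within (≤-reflexive cost≡)
        (exec-evaluate σ (proj₁ seg-σ) (≤-trans (m≤n+m _ (suc ∣ τ ∣ᵉ)) fits′) here λ here₁ →
          exec-evaluate τ (proj₁ seg-τ) (≤-trans (n≤1+n _) fits′) here₁ λ here₂ →
            exec-step fits′ here₂ (exec-union-symbol (proj₂ seg-τ) fits′ here₂)
              λ {vs′} {m′} here₃ → continue
                (subst (λ pc → At pc (Solutions (σ ⊕ τ) ∷ Γ) vs′ m′) (sym pc≡) here₃))
        where
        seg-σ = seg-++ (encode σ) seg
        seg-τ = seg-++ (encode τ) (proj₂ seg-σ)
        length≡ : ∣ σ ⊕ τ ∣ᵉ ≡ ∣ σ ∣ᵉ + (∣ τ ∣ᵉ + 1)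
        length≡ = trans (length-++ (encode σ)) (cong (∣ σ ∣ᵉ +_) (length-++ (encode τ)))
        shuffle : ∀ s t pc → s + (t + 1) + pc ≡ 1 + (t + (s + pc))
        shuffle = solve-∀
        pc≡ : ∣ σ ⊕ τ ∣ᵉ + pc ≡ 1 + (∣ τ ∣ᵉ + (∣ σ ∣ᵉ + pc))
        pc≡ = trans (cong (_+ pc) length≡) (shuffle ∣ σ ∣ᵉ ∣ τ ∣ᵉ pc)
        fits′ : 1 + (∣ τ ∣ᵉ + (∣ σ ∣ᵉ + pc)) ≤ N
        fits′ = subst (_≤ N) pc≡ fits
        distribute : ∀ s t d c → s * d + (t * d + (d + c)) ≡ (s + (t + 1)) * d + c
        distribute = solve-∀
        cost≡ : ∣ σ ∣ᵉ * (4 + nodeCost) + (∣ τ ∣ᵉ * (4 + nodeCost) + (4 + nodeCost + C)) ≡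
            ∣ σ ⊕ τ ∣ᵉ * (4 + nodeCost) + C
        cost≡ = trans (distribute ∣ σ ∣ᵉ ∣ τ ∣ᵉ (4 + nodeCost) C)
            (cong (λ x → x * (4 + nodeCost) + C) (sym length≡))
      exec-evaluate (η i j _ σ) = exec-unary σ 2 i j
        (exec-relabelled-symbol (suc (suc zero)) cut i j refl (1≤2^ k) (2^k≤K 1≤ℓ))
      exec-evaluate (ρ i j _ σ) = exec-unary σ 3 i j
        (exec-relabelled-symbol (suc (suc (suc zero))) (λ i j L _ → preimage i j L) i j refl ≤-refl 1≤K)
      exec-unary σ w i j {A} {pc} {Γ} {C = C} symbol-σ seg fits here continue = within cost≤
        (exec-evaluate σ (proj₁ seg-σ) (≤-trans (m≤n+m _ 3) fits′) here λ here₁ →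
          exec-step (≤-trans (s≤s (m≤n+m _ 2)) fits′) here₁ (symbol-σ (proj₂ seg-σ) fits′ here₁)
            λ {vs′} {m′} here₂ → continue (subst (λ pc → At pc (A ∷ Γ) vs′ m′) (sym pc≡) here₂))
        where
        ws = encode σ ++ w ∷ toℕ i ∷ toℕ j ∷ []
        seg-σ = seg-++ (encode σ) seg
        length≡ : length ws ≡ 3 + ∣ σ ∣ᵉ
        length≡ = trans (length-++ (encode σ)) (+-comm ∣ σ ∣ᵉ 3)
        pc≡ : length ws + pc ≡ 3 + (∣ σ ∣ᵉ + pc)
        pc≡ = cong (_+ pc) length≡
        fits′ : 3 + (∣ σ ∣ᵉ + pc) ≤ N
        fits′ = subst (_≤ N) pc≡ fits
        -- The charge is per word, although the three words of a unary symbol take only one round.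
        cost≤ : ∣ σ ∣ᵉ * (4 + nodeCost) + (4 + nodeCost + C) ≤ length ws * (4 + nodeCost) + C
        cost≤ = begin
          ∣ σ ∣ᵉ * (4 + nodeCost) + (4 + nodeCost + C)  ≡⟨ +-assoc (∣ σ ∣ᵉ * (4 + nodeCost)) _ C ⟨
          ∣ σ ∣ᵉ * (4 + nodeCost) + (4 + nodeCost) + C  ≡⟨ cong (_+ C) (+-comm _ (4 + nodeCost)) ⟩
          suc ∣ σ ∣ᵉ * (4 + nodeCost) + C               ≤⟨ +-monoˡ-≤ C
              (*-monoˡ-≤ (4 + nodeCost) (≤-trans (m≤n+m (suc ∣ σ ∣ᵉ) 2) (≤-reflexive (sym length≡)))) ⟩
          length ws * (4 + nodeCost) + C              ∎
          where open ≤-Reasoning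

-- Choosing and reading off an optimal coloring

contains : ℕ → Tree → Bool
contains b (leaf a)   = does (b ≟ a)
contains b (node l r) = contains b l ∨ contains b r

size : Tree → ℕ
size (leaf _)   = 1
size (node l r) = suc (size l + size r)

if-∨ : ∀ a b {x y : ℕ} → (if a then x else if b then x else y) ≡ (if a ∨ b then x else y)
if-∨ true  b = refl
if-∨ false b = refl

-- This is how a machine with only addition and truncated subtraction takes a minimum.
∸∸≡⊓ : ∀ x y → x ∸ (x ∸ y) ≡ x ⊓ y
∸∸≡⊓ x y with ≤-total y x
... | inj₁ y≤x = trans (m∸[m∸n]≡n y≤x) (sym (m≥n⇒m⊓n≡n y≤x))
... | inj₂ x≤y = trans (cong (x ∸_) (m≤n⇒m∸n≡0 x≤y)) (sym (m≤n⇒m⊓n≡m x≤y))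

-- The minimum in the order in which digits are decoded, last one first, with `s` as the initial
-- register value.
least : ∀ {j} → (Fin j → ℕ) → ℕ → ℕ
least {zero}  d s = s
least {suc j} d s = least (d ∘ suc) s ⊓ d zero

least-cong : ∀ {j} {d e : Fin j → ℕ} s → d ≗ e → least d s ≡ least e s
least-cong {zero}  s d≗e = refl
least-cong {suc j} s d≗e = cong₂ _⊓_ (least-cong s (d≗e ∘ suc)) (d≗e zero)

fold-least : ∀ {j} (d : Fin (suc j) → ℕ) s → least d s ≡ min d ⊓ s
fold-least {zero}  d s = ⊓-comm s (d zero)
fold-least {suc j} d s = begin
  least (d ∘ suc) s ⊓ d zero      ≡⟨ cong (_⊓ d zero) (fold-least (d ∘ suc) s) ⟩
  min (d ∘ suc) ⊓ s ⊓ d zero      ≡⟨ ⊓-comm _ (d zero) ⟩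
  d zero ⊓ (min (d ∘ suc) ⊓ s)    ≡⟨ ⊓-assoc (d zero) _ s ⟨
  min d ⊓ s                       ∎
  where open ≡-Reasoning

min≤head : ∀ {j} (d : Fin (suc j) → ℕ) → min d ≤ d zero
min≤head {zero}  d = ≤-refl
min≤head {suc j} d = m⊓n≤m (d zero) _

-- Digit zero has weight 1, so the code bounds it and with it the minimum; a start value of at least
-- the code drops out.
least-min : ∀ {j} .{{_ : NonZero j}} (P d : Fin j → ℕ) {s} → code 1 P d ≤ s → least d s ≡ min d
least-min {suc j} P d {s} ≤s = trans (fold-least d s) (m≤n⇒m⊓n≡m
  (≤-trans (min≤head d) (≤-trans
      (≤-trans (≤-reflexive (sym (*-identityʳ (d zero)))) (m≤m+n (d zero * 1) _)) ≤s)))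

min-cong : ∀ {j} .{{_ : NonZero j}} {d e : Fin j → ℕ} → d ≗ e → min d ≡ min e
min-cong {suc zero}    d≗e = d≗e zero
min-cong {suc (suc j)} d≗e = cong₂ _⊓_ (d≗e zero) (min-cong (d≗e ∘ suc))

≤max : ∀ {j} .{{_ : NonZero j}} (d : Fin j → ℕ) c → d c ≤ max d
≤max {suc zero}    d zero    = ≤-refl
≤max {suc (suc j)} d zero    = m≤m⊔n (d zero) _
≤max {suc (suc j)} d (suc c) = ≤-trans (≤max (d ∘ suc) c) (m≤n⊔m (d zero) _)

-- Table entries as codes of colorings

module Bridge (k ℓ n M N kn lo : ℕ) (p : Fin k → Fin n → ℕ) (base : Memory)
  (1≤k : 1 ≤ k) (1≤ℓ : 1 ≤ ℓ) (2≤lo : 2 ≤ lo) (1≤M : 1 ≤ M) where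

  open Families k ℓ
  open Profits p hiding (M)

  weight : Fin k → Fin n → ℕ
  weight c v = p c v * scale 1 worth c

  open Evaluation k ℓ n M N kn lo weight base 1≤k 1≤ℓ 2≤lo 1≤M using (Solutions; slot)

  -- An uncolored vertex gets address 0. No output bit lies there, so the 1 written by the traversal
  -- is harmless.
  target : Maybe (Fin k) → Fin n → ℕ
  target nothing  v = 0
  target (just c) v = slot c v

  -- Joins and relabellings add no node. The tree is thus no larger than the encoding, and its
  -- traversal takes linear time.
  witness : (σ : Expression ℓ n) → (Vertex σ → Maybe (Fin k)) → Tree
  witness (vertex i v) f = leaf (target (f tt) v)
  witness (σ ⊕ τ)      f = node (witness σ (f ∘ inj₁)) (witness τ (f ∘ inj₂))
  witness (η _ _ _ σ)  f = witness σ f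
  witness (ρ _ _ _ σ)  f = witness σ f

  solution : ∀ σ {L f} → Fits σ L f → Solutions σ L (codeOf σ f) (witness σ f)
  solution (vertex i v) {L} {f} F with f tt in e
  ... | nothing = inj₁ (code-zero {P = worth} , refl)
  ... | just c  = inj₂ (c , F .contained e , code-single {P = worth} c (p c v) , refl)
  solution (σ ⊕ τ) {f = f} F = _ , _ , _ , _ , codeOf-⊕ σ τ f , refl , solution σ (fits-⊕ˡ F) ,
      solution τ (fits-⊕ʳ F)
  solution (η i j _ σ) F = let d , F′ = fits-η⁻ F in d , solution σ F′
  solution (ρ i j _ σ) F = zero , solution σ (fits-ρ⁻ F)

  realise : ∀ σ {L q t} → Solutions σ L q t → ∃[ f ] (Fits σ L f × codeOf σ f ≡ q × witness σ f ≡ t)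
  realise (vertex i v) (inj₁ (refl , refl)) =
    (λ _ → nothing) , record { independent = λ () ; contained = λ () } , code-zero {P = worth} , refl
  realise (vertex i v) (inj₂ (c , h , refl , refl)) =
    (λ _ → just c) , record { independent = λ _ _ () ; contained = λ { refl → h } } ,
        code-single {P = worth} c (p c v) , refl
  realise (σ ⊕ τ) (a , b , s , u , refl , refl , x , y) =
    let f , F , a≡ , s≡ = realise σ x
        g , G , b≡ , u≡ = realise τ y
    in [ f , g ] , fits-⊕ F G , trans (codeOf-⊕ σ τ [ f , g ]) (cong₂ _+_ a≡ b≡) , cong₂ node s≡ u≡
  realise (η i j _ σ) (d , x) = let f , F , q≡ , t≡ = realise σ x in f , fits-η d F , q≡ , t≡
  realise (ρ i j _ σ) (d , x) = let f , F , q≡ , t≡ = realise σ x in f , fits-ρ F , q≡ , t≡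

  size-witness : ∀ σ f → size (witness σ f) ≤ ∣ σ ∣ᵉ
  size-witness (vertex i v) f = s≤s z≤n
  size-witness (σ ⊕ τ) f = begin
    suc (size (witness σ _) + size (witness τ _))  ≤⟨ s≤s (+-mono-≤ (size-witness σ _) (size-witness τ _)) ⟩
    suc (∣ σ ∣ᵉ + ∣ τ ∣ᵉ)                            ≡⟨ trans (cong (∣ σ ∣ᵉ +_) (+-comm ∣ τ ∣ᵉ 1))
        (+-suc ∣ σ ∣ᵉ ∣ τ ∣ᵉ) ⟨
    ∣ σ ∣ᵉ + (∣ τ ∣ᵉ + 1)                            ≡⟨ trans (length-++ (encode σ))
        (cong (∣ σ ∣ᵉ +_) (length-++ (encode τ))) ⟨
    ∣ σ ⊕ τ ∣ᵉ                                      ∎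
    where open ≤-Reasoning
  size-witness (η i j _ σ) f = ≤-trans (size-witness σ f)
      (≤-trans (m≤m+n _ 3) (≤-reflexive (sym (length-++ (encode σ)))))
  size-witness (ρ i j _ σ) f = ≤-trans (size-witness σ f)
      (≤-trans (m≤m+n _ 3) (≤-reflexive (sym (length-++ (encode σ)))))

  contains-witness : ∀ σ f u {b} → target (f u) (name σ u) ≡ b → contains b (witness σ f) ≡ true
  contains-witness (vertex i v) f tt {b} e = dec-true (b ≟ _) (sym e)
  contains-witness (σ ⊕ τ) f (inj₁ u) e rewrite contains-witness σ (f ∘ inj₁) u e = refl
  contains-witness (σ ⊕ τ) f (inj₂ u) {b} e
    rewrite contains-witness τ (f ∘ inj₂) u e with contains b (witness σ (f ∘ inj₁))
  ... | true  = refl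
  ... | false = refl
  contains-witness (η _ _ _ σ) f u e = contains-witness σ f u e
  contains-witness (ρ _ _ _ σ) f u e = contains-witness σ f u e

  contains-witness⁻ : ∀ σ f {b} → (∀ u → target (f u) (name σ u) ≢ b) → contains b (witness σ f) ≡ false
  contains-witness⁻ (vertex i v) f {b} off = dec-false (b ≟ _) (off tt ∘ sym)
  contains-witness⁻ (σ ⊕ τ) f off
    rewrite contains-witness⁻ σ (f ∘ inj₁) (off ∘ inj₁) | contains-witness⁻ τ (f ∘ inj₂) (off ∘ inj₂) = refl
  contains-witness⁻ (η _ _ _ σ) f off = contains-witness⁻ σ f off
  contains-witness⁻ (ρ _ _ _ σ) f off = contains-witness⁻ σ f off

module Outcome (k ℓ : ℕ) where

  open Families k ℓ
  open Programs k ℓ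

  -- The memory from register 5 on is a stack of pending addresses with register 3 as its upper end.
  -- A first word of 1 marks a leaf, any larger one is a child address.
  walk : Program
  walk = whilenz (var 3 ⊟ var 5) loop
    (3 ≔ var 3 ⊟ lit 1 ⨾ 7 ≔ load (var 3) ⨾
     ifnz load (var 7) ⊟ lit 1
       then ([ var 3 ]≔ load (var 7) ⨾ [ lit 1 ⊞ var 3 ]≔ load (var 7 ⊞ var 2) ⨾ 3 ≔ lit 2 ⊞ var 3)
       else ([ load (var 7 ⊞ var 2) ]≔ lit 1))

  divide : ℕ → Program
  divide o = whilenz (lit 1 ⊞ var 9) ⊟ load (var 0 ⊞ lit o) loop
    (9 ≔ var 9 ⊟ load (var 0 ⊞ lit o) ⨾ 12 ≔ lit 1 ⊞ var 12)

  digitAt : ℕ → Program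
  digitAt o = 12 ≔ lit 0 ⨾ divide o ⨾ 11 ≔ var 11 ⊟ (var 11 ⊟ var 12)

  -- The highest digit goes first: subtracting its weight as long as possible leaves a number below
  -- that weight, the code of the lower digits.
  decode : ℕ → ℕ → Program
  decode o zero    = skip
  decode o (suc j) = decode (suc o) j ⨾ digitAt o

  -- Register 7 holds the best level plus one. Its value 0 thus means that nothing has been found,
  -- and a coloring of level 0 still counts.
  update : Program
  update = ifnz (lit 1 ⊞ var 11) ⊟ var 7
    then (7 ≔ lit 1 ⊞ var 11 ⨾ 8 ≔ cellAt 4 (var 10) everything) else skip

  next : Program
  next = 10 ≔ lit K ⊞ var 10

  consider : Program
  consider =
    ifnz load (cellAt 4 (var 10) everything)
      then (9 ≔ var 10 ⨾ 11 ≔ var 2 ⨾ decode 0 k ⨾ update)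
      else skip

  select : Program
  select = 7 ≔ lit 0 ⨾ 8 ≔ lit 0 ⨾ 10 ≔ lit 0 ⨾
    whilenz (var 2 ⊟ var 10) loop (consider ⨾ next)

  module _ (n M N kn lo : ℕ) (weight : Fin k → Fin n → ℕ) (base : Memory)
    (1≤k : 1 ≤ k) (1≤ℓ : 1 ≤ ℓ) (2≤lo : 2 ≤ lo) (1≤M : 1 ≤ M) where

    open Evaluation k ℓ n M N kn lo weight base 1≤k 1≤ℓ 2≤lo 1≤M

    private variable
      m : Memory
      H a b : ℕ

    contains-outside : ∀ t → Points m H a t → lo ≤ b → contains b t ≡ false
    contains-outside {b = b} (leaf c) (_ , _ , _ , _ , c<lo) lo≤b = dec-false (b ≟ c) λ { refl → <⇒≱ c<lo lo≤b }
    contains-outside (node l r) (_ , _ , pl , pr) lo≤b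
      rewrite contains-outside l pl lo≤b = contains-outside r pr lo≤b

    -- Leaves write below `lo`, while tables and stack lie above, so treating the right child leaves
    -- the pending left child intact. The continuation stands for the trees still on the stack.
    exec-walk : ∀ t {sp r₄ r₇ r₈ r₉ r₁₀ r₁₁ r₁₂ C Q} → lo ≤ H → H ≤ sp → Points m H (m sp) t →
      (∀ {m′ r₇} → (∀ b → b < sp → m′ b ≡ (if contains b t then 1 else m b)) →
        Exec walk (regs sp r₄ H r₇ r₈ r₉ r₁₀ r₁₁ r₁₂) m′ C Q) →
      Exec walk (regs (1 + sp) r₄ H r₇ r₈ r₉ r₁₀ r₁₁ r₁₂) m (size t * 32 + C) Q
    exec-walk {H = H} {m = m} (leaf b) {sp} {C = C} lo≤H H≤sp (_ , _ , m≡1 , refl , _) continue =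
      within (+-monoˡ-≤ C (≤ᵇ⇒≤ 22 32 tt))
        (exec-loop (∸-suc≢0 (s≤s H≤sp)) (exec-⨾ (exec-≔ (exec-⨾ (exec-≔
          (exec-else (cong (_∸ 1) m≡1) (exec-[]≔ (continue λ b b<sp → refl))))))))
    exec-walk {H = H} {m = m} (node l r) {sp} {r₄} {r₇} {r₈} {r₉} {r₁₀} {r₁₁} {r₁₂} {C} {Q} lo≤H H≤sp
        (lo≤a , a< , pl , pr) continue =
      within (≤-reflexive (cost≡ (size l) (size r) C))
        (exec-loop (∸-suc≢0 (s≤s H≤sp)) (exec-⨾ (exec-≔ (exec-⨾ (exec-≔
          (exec-then (∸-suc≢0 (≤-trans 2≤lo (proj₁ pl))) (exec-⨾ (exec-[]≔ (exec-⨾ (exec-[]≔ (exec-≔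
            (exec-walk r lo≤H (≤-trans H≤sp (n≤1+n sp)) right λ {m₂} after-r →
              exec-walk l lo≤H H≤sp (left after-r) λ {m₃} after-l →
                continue λ b b<sp → trans (after-l b b<sp)
                  (trans (cong (if contains b l then 1 else_) (trans (after-r b (<-trans b<sp (n<1+n sp)))
                    (cong (if contains b r then 1 else_) (untouched b b<sp))))
                    (if-∨ (contains b l) (contains b r)))))))))))))))
      where
      x = m sp
      m₀ = m [ sp ↦ m x ]
      m₁ = m₀ [ 1 + sp ↦ m₀ (x + Z) ]
      x+Z<sp : x + Z < sp
      x+Z<sp = <-≤-trans a< H≤sp
      untouched : ∀ b → b < sp → m₁ b ≡ m b
      untouched b b<sp = trans (update-other m₀ {1 + sp} (m₀ (x + Z)) (<⇒≢ (<-trans b<sp (n<1+n sp))))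
          (update-other m {sp} (m x) (<⇒≢ b<sp))
      top≡ : m₁ (1 + sp) ≡ m (x + Z)
      top≡ = trans (update-same m₀ {1 + sp} (m₀ (x + Z)) refl) (update-other m {sp} (m x) (<⇒≢ x+Z<sp))
      sp≡ : m₁ sp ≡ m x
      sp≡ = trans (update-other m₀ {1 + sp} (m₀ (x + Z)) (<⇒≢ (n<1+n sp))) (update-same m {sp} (m x) refl)
      right : Points m₁ H (m₁ (1 + sp)) r
      right = subst (λ a → Points m₁ H a r) (sym top≡)
        (points-frame r (λ b _ b<H → untouched b (<-≤-trans b<H H≤sp)) ≤-refl pr)
      left : ∀ {m₂} → (∀ b → b < 1 + sp → m₂ b ≡ (if contains b r then 1 else m₁ b)) → Points m₂ H (m₂ sp) l
      left {m₂} after = subst (λ a → Points m₂ H a l) (sym (trans (same sp (≤-trans lo≤H H≤sp) (n<1+n sp)) sp≡))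
        (points-frame l (λ b lo≤b b<H →
            trans (same b lo≤b (<-≤-trans b<H (≤-trans H≤sp (n≤1+n sp))))
              (untouched b (<-≤-trans b<H H≤sp))) ≤-refl pl)
        where
        same : ∀ b → lo ≤ b → b < 1 + sp → m₂ b ≡ m₁ b
        same b lo≤b b< = trans (after b b<) (cong (if_then 1 else m₁ b) (contains-outside r pr lo≤b))
      cost≡ : ∀ s t C → 32 + (t * 32 + (s * 32 + C)) ≡ suc (s + t) * 32 + C
      cost≡ = solve-∀

    exec-digitAt : ∀ o {W r d s pc S H r₇ r₈ r₁₀ r₁₂ m} → m (N + o) ≡ W → r < W →
      Exec (digitAt o) (regs pc S H r₇ r₈ (r + d * W) r₁₀ s r₁₂) m (17 + 20 * d) λ vs′ m′ →
        m′ ≡ m × vs′ ≡ regs pc S H r₇ r₈ r r₁₀ (s ⊓ d) d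
    exec-digitAt o {W} {r} {d} {s} {pc} {S} {H} {r₇} {r₈} {r₁₀} {m = m} W≡ r<W =
      within (≤-reflexive (cost≡ d)) (exec-⨾ (exec-≔ (exec-⨾ (exec-map
        (λ { (refl , refl) → exec-≔ (refl ,
            cong₂ (λ x y → regs pc S H r₇ r₈ r r₁₀ x y)
              (trans (cong (λ x → s ∸ (s ∸ x)) (+-identityʳ d)) (∸∸≡⊓ s d)) (+-identityʳ d)) })
        (subtract d)))))
      where
      cost≡ : ∀ d → 2 + (d * 20 + 9 + 6) ≡ 17 + 20 * d
      cost≡ = solve-∀
      move : ∀ r W x → r + (W + x) ≡ W + (r + x)
      move = solve-∀
      subtract : ∀ d {e} → Exec (divide o) (regs pc S H r₇ r₈ (r + d * W) r₁₀ s e) m (d * 20 + 9) λ vs′ m′ →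
        m′ ≡ m × vs′ ≡ regs pc S H r₇ r₈ r r₁₀ s (d + e)
      subtract zero {e} = exec-exit
        (trans (cong₂ (λ x y → suc x ∸ y) (+-identityʳ r) W≡) (m≤n⇒m∸n≡0 r<W))
        (refl , cong (λ x → regs pc S H r₇ r₈ x r₁₀ s e) (+-identityʳ r))
      subtract (suc d) {e} = within (≤-reflexive (+-assoc 20 (d * 20) 9))
        (exec-loop (∸-suc≢0 (subst (_< suc (r + suc d * W)) (sym W≡)
            (s≤s (≤-trans (m≤m+n W (r + d * W)) (≤-reflexive (sym (move r W (d * W))))))))
          (exec-⨾ (exec-≔ (exec-≔ (subst
            (λ y → Exec (divide o) (regs pc S H r₇ r₈ y r₁₀ s (suc e)) m (d * 20 + 9) λ vs′ m′ →
              m′ ≡ m × vs′ ≡ regs pc S H r₇ r₈ r r₁₀ s (suc d + e))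
            (sym (trans (cong₂ _∸_ (move r W (d * W)) W≡) (m+n∸m≡n W (r + d * W))))
            (exec-map (λ (eq , eq′) → eq ,
                trans eq′ (cong (regs pc S H r₇ r₈ r r₁₀ s) (+-suc d e))) (subtract d)))))))

    exec-decode : ∀ j o (P d : Fin j → ℕ) {B a r s pc S H r₇ r₈ r₁₀ r₁₂ m} → r < a →
      (∀ c → d c ≤ P c) → (∀ c → d c < B) → (∀ c → m (N + (toℕ c + o)) ≡ scale a P c) →
      Exec (decode o j) (regs pc S H r₇ r₈ (r + code a P d) r₁₀ s r₁₂) m (j * (20 * B) + 1) λ vs′ m′ →
        m′ ≡ m × ∃[ r₁₂′ ] vs′ ≡ regs pc S H r₇ r₈ r r₁₀ (least d s) r₁₂′
    exec-decode zero o P d {r = r} {s} {pc} {S} {H} {r₇} {r₈} {r₁₀} {r₁₂} _ _ _ _ =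
      exec-skip (refl , r₁₂ , cong (λ x → regs pc S H r₇ r₈ x r₁₀ s r₁₂) (+-identityʳ r))
    exec-decode (suc j) o P d {B} {a} {r} {s} {pc} {S} {H} {r₇} {r₈} {r₁₀} {r₁₂} {m} r<a d≤P d<B scales =
        within cost≤
      (exec-⨾ (subst (λ x → Exec (decode (suc o) j) (regs pc S H r₇ r₈ x r₁₀ s r₁₂) m (j * (20 * B) + 1)
          LastDigit)
        (+-assoc r (d zero * a) _)
        (exec-map (λ { (refl , _ , refl) →
            exec-map (λ (eq , eq′) → eq , d zero , eq′)
              (exec-digitAt o {d = d zero} {m = m} (scales zero) r<a) })
          (exec-decode j (suc o) (P ∘ suc) (d ∘ suc) (next-digit {x = d zero} r<a (d≤P zero)) (d≤P ∘ suc)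
              (d<B ∘ suc)
            λ c → trans (cong (λ x → m (N + x)) (+-suc (toℕ c) o)) (scales (suc c))))))
      where
      LastDigit : List ℕ → Memory → Set
      LastDigit vs m₁ = Exec (digitAt o) vs m₁ (17 + 20 * d zero) λ vs′ m′ →
        m′ ≡ m × ∃[ r₁₂′ ] vs′ ≡ regs pc S H r₇ r₈ r r₁₀ (least d s) r₁₂′
      cost≤ : j * (20 * B) + 1 + (17 + 20 * d zero) ≤ 20 * B + j * (20 * B) + 1
      cost≤ = begin
        j * (20 * B) + 1 + (17 + 20 * d zero)  ≤⟨ +-monoʳ-≤ (j * (20 * B) + 1)
            (+-monoˡ-≤ (20 * d zero) {17} {20} (≤ᵇ⇒≤ _ _ tt)) ⟩
        j * (20 * B) + 1 + (20 + 20 * d zero)  ≡⟨ cong (j * (20 * B) + 1 +_) (*-suc 20 (d zero)) ⟨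
        j * (20 * B) + 1 + 20 * suc (d zero)   ≤⟨ +-monoʳ-≤ (j * (20 * B) + 1) (*-monoʳ-≤ 20 (d<B zero)) ⟩
        j * (20 * B) + 1 + 20 * B              ≡⟨ rearrange (j * (20 * B)) (20 * B) ⟩
        20 * B + j * (20 * B) + 1              ∎
        where
        open ≤-Reasoning
        rearrange : ∀ x y → x + 1 + y ≡ y + x + 1
        rearrange = solve-∀

    module Selection (A : Spec) (P : Fin k → ℕ) (B : ℕ) (P<B : ∀ c → P c < B)
      (decompose : ∀ {q t} → A everything q t → ∃[ d ] ((∀ c → d c ≤ P c) × code 1 P d ≡ q))
      {m : Memory} {S H : ℕ} (table : Table A m H S) (scales : ∀ c → m (N + (toℕ c + 0)) ≡ scale K P c) where

      open Table table

      Present : ℕ → Set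
      Present q = m (cell S everything q) ≢ 0

      record Candidate (t : Tree) (d : Fin k → ℕ) : Set where
        field
          solves  : A everything (code 1 P d) t
          bounded : ∀ c → d c ≤ P c

      -- Maximality ranges over all bounded digit vectors with an occupied code rather than over
      -- stored trees; this is sound because the code determines the vector.
      data Best (pc q : ℕ) : List ℕ → Memory → Set where
        best : ∀ {b ptr r₉ r₁₁ r₁₂} →
          (b ≡ 0 ⊎ ∃[ t ] ∃[ d ] (Candidate t d × Points m H ptr t × b ≡ suc (least d Z))) →
          (∀ q′ → q′ < q → Present q′ → ∀ d → (∀ c → d c ≤ P c) → code 1 P d ≡ q′ → suc (least d Z) ≤ b) →
          Best pc q (regs pc S H b ptr r₉ (q * K) r₁₁ r₁₂) m

      exec-consider : ∀ {pc q vs m′} → q < M → Best pc q vs m′ →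
        Exec (consider ⨾ next) vs m′ (52 * (k * B)) (Best pc (suc q))
      exec-consider {pc} {q} q<M (best {b} {ptr} {r₉} {r₁₁} {r₁₂} current maximal) = within cost≤
        (byCase (m (cell S everything q) ≟ 0))
        where
        1≤B : 1 ≤ B
        1≤B = m<n⇒0<n (P<B (Fin.fromℕ< 1≤k))
        cost≤ : 28 + k * (20 * B) + 4 ≤ 52 * (k * B)
        cost≤ = +-cost (k * B) 48 4 (+-cost (k * B) 28 20 (c≤c*X 28 (*-mono-≤ 1≤k 1≤B))
            (≤-reflexive (swap k B)))
          (c≤c*X 4 (*-mono-≤ 1≤k 1≤B))
          where
          swap : ∀ x y → x * (20 * y) ≡ 20 * (x * y)
          swap = solve-∀
        upto : ∀ {b′} → b ≤ b′ → (Present q → ∀ d → (∀ c → d c ≤ P c) → code 1 P d ≡ q → suc (least d Z) ≤ b′) →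
          ∀ q′ → q′ < suc q → Present q′ → ∀ d → (∀ c → d c ≤ P c) → code 1 P d ≡ q′ → suc (least d Z) ≤ b′
        upto b≤ new q′ q′< present d d≤ e with m<1+n⇒m<n∨m≡n q′<
        ... | inj₁ q′<q = ≤-trans (maximal q′ q′<q present d d≤ e) b≤
        ... | inj₂ refl = new present d d≤ e
        byCase : Dec (m (cell S everything q) ≡ 0) →
            Exec (consider ⨾ next) (regs pc S H b ptr r₉ (q * K) r₁₁ r₁₂) m (28 + k * (20 * B) + 4)
              (Best pc (suc q))
        byCase (yes absent) = within (+-monoˡ-≤ 4 (≤-trans (≤ᵇ⇒≤ 8 28 tt) (m≤m+n 28 _))) $
          exec-⨾ (exec-else absent (exec-skip
              (exec-≔ (best current (upto ≤-refl λ present → contradiction absent present)))))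
        byCase (no present) with sound everything q q<M present
        ... | t , a , h with decompose a
        ... | d , d≤P , refl = within (+-monoˡ-≤ 4 (≤-reflexive (rearrange (k * (20 * B))))) $
          exec-⨾ (exec-then present (exec-⨾ (exec-≔ (exec-⨾ (exec-≔ (exec-⨾ (subst
            (λ x → Exec (decode 0 k) (regs pc S H b ptr x (q * K) Z r₁₂) m (k * (20 * B) + 1) Updates) scaled
            (exec-map (λ { (refl , _ , refl) → improve (suc (least d Z) ∸ b ≟ 0) })
              (exec-decode k 0 P d 1≤K d≤P (λ c → ≤-<-trans (d≤P c) (P<B c)) scales)))))))))
          where
          rearrange : ∀ x → 7 + (2 + (2 + (x + 1 + 16))) ≡ 28 + x
          rearrange = solve-∀
          -- The loop offset in register 10 is already the code for weights starting at `K`, and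
          -- these are the weights kept in memory.
          scaled : 0 + code K P d ≡ code 1 P d * K
          scaled = trans (cong (λ a → code a P d) (sym (*-identityˡ K))) (code-* {P = P} {d} 1 K)
          same-level : ∀ d′ → (∀ c → d′ c ≤ P c) → code 1 P d′ ≡ code 1 P d → suc (least d′ Z) ≤ suc (least d Z)
          same-level d′ d′≤ e = ≤-reflexive (cong suc (least-cong Z
            (proj₂ (code-unique {P = P} {a = 1} {0} {0} (s≤s z≤n) (s≤s z≤n) d′≤ d≤P e))))
          points : Points m H (cell S everything (code 1 P d)) t
          points = ≤-trans lo≤T (m≤m+n S _) , <-trans (+-monoˡ-< Z (cell< S everything q<M)) end< , h
          Updates : List ℕ → Memory → Set
          Updates vs m = Exec update vs m 16 λ vs′ m′ → Exec next vs′ m′ 4 (Best pc (suc (code 1 P d)))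
          improve : ∀ {r₁₂′} → Dec (suc (least d Z) ∸ b ≡ 0) →
              Updates (regs pc S H b ptr 0 (code 1 P d * K) (least d Z) r₁₂′) m
          improve (yes worse) = within (≤ᵇ⇒≤ 7 16 tt) (exec-else worse (exec-skip (exec-≔
            (best current (upto ≤-refl λ _ d′ d′≤ e → ≤-trans (same-level d′ d′≤ e) (m∸n≡0⇒m≤n worse))))))
          improve (no better) = exec-then better (exec-⨾ (exec-≔ (exec-≔ (exec-≔
            (best (inj₂ (t , d , record { solves = a ; bounded = d≤P } , points , refl))
              (upto (<⇒≤ (m∸n≢0⇒n<m better)) λ _ → same-level))))))

      exec-select : ∀ {pc r₇ r₈ r₉ r₁₀ r₁₁ r₁₂} →
        Exec select (regs pc S H r₇ r₈ r₉ r₁₀ r₁₁ r₁₂) m (66 * (M * (k * B))) (Best pc M)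
      exec-select {pc} = within
        (+-cost (M * (k * B)) 2 64 (c≤c*X 2 1≤X)
            (+-cost (M * (k * B)) 2 62 (c≤c*X 2 1≤X) (+-cost (M * (k * B)) 2 60 (c≤c*X 2 1≤X)
          (while-cost 4 52 1≤M 1≤kB ≤-refl))))
        (exec-⨾ (exec-≔ (exec-⨾ (exec-≔ (exec-⨾ (exec-≔ (exec-times M (Best pc)
          (λ { q<M (best _ _) → ∸-suc≢0 (*-monoˡ-< K {{>-nonZero 1≤K}} q<M) })
          (λ { (best _ _) → n∸n≡0 (M * K) })
          exec-consider
          (best (inj₁ refl) λ _ ()))))))))
        where
        1≤kB : 1 ≤ k * B
        1≤kB = *-mono-≤ 1≤k (m<n⇒0<n (P<B (Fin.fromℕ< 1≤k)))
        1≤X : 1 ≤ M * (k * B)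
        1≤X = *-mono-≤ 1≤M 1≤kB

-- Scaling the profits

seg-from : ∀ ws {m a} → (∀ i → m (i + a) ≡ word ws i) → Seg m a ws
seg-from []       eq = tt
seg-from (w ∷ ws) {m} {a} eq = eq 0 , seg-from ws λ i → trans (cong m (+-suc i a)) (eq (suc i))

seg-cong : ∀ ws {m m′ a} → (∀ b → a ≤ b → b < length ws + a → m′ b ≡ m b) → Seg m a ws → Seg m′ a ws
seg-cong []       same s       = tt
seg-cong (w ∷ ws) {a = a} same (e , s) = trans (same a ≤-refl (s≤s (m≤n+m a (length ws)))) e ,
  seg-cong ws (λ b a<b b< → same b (<⇒≤ a<b) (subst (b <_) (+-suc (length ws) a) b<)) s

seg-lookup : ∀ ws {m a} → Seg m a ws → ∀ i → m (a + toℕ i) ≡ List.lookup ws i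
seg-lookup (w ∷ ws) {m} {a} (e , s) zero    = trans (cong m (+-identityʳ a)) e
seg-lookup (w ∷ ws) {m} {a} (e , s) (suc i) = trans (cong m (+-suc a (toℕ i))) (seg-lookup ws s i)

seg-++⁺ : ∀ xs {ys m a} → Seg m a xs → Seg m (length xs + a) ys → Seg m a (xs ++ ys)
seg-++⁺ []       _       t = t
seg-++⁺ (x ∷ xs) {ys} {m} {a} (e , s) t = e ,
    seg-++⁺ xs s (subst (λ b → Seg m b ys) (sym (+-suc (length xs) a)) t)

seg-tabulate : ∀ {j} (g : Fin j → ℕ) {m a} → Seg m a (List.tabulate g) → ∀ v → m (toℕ v + a) ≡ g v
seg-tabulate g (e , s) zero = e
seg-tabulate g {m} {a} (e , s) (suc v) = trans (cong m (sym (+-suc (toℕ v) a))) (seg-tabulate (g ∘ suc) s v)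

word-beyond : ∀ ws {b} → length ws ≤ b → word ws b ≡ 0
word-beyond []       _        = refl
word-beyond (w ∷ ws) (s≤s ≤b) = word-beyond ws ≤b

-- Layout of the profits and of the characteristic vectors

module Places (n : ℕ) where

  -- One layout serves twice: profits start at address 1, output bits at N + k + 1.
  place : ∀ {j} → ℕ → Fin j → Fin n → ℕ
  place a zero    v = toℕ v + a
  place a (suc c) v = place (n + a) c v

  place≡ : ∀ {j} a (c : Fin j) v → place a c v ≡ toℕ v + (toℕ c * n + a)
  place≡ a zero    v = refl
  place≡ a (suc c) v = trans (place≡ (n + a) c v) (cong (toℕ v +_) (shift (toℕ c * n) n a))
    where
    shift : ∀ x n a → x + (n + a) ≡ n + x + a
    shift = solve-∀

  ≤place : ∀ {j} a (c : Fin j) v → a ≤ place a c v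
  ≤place a zero    v = m≤n+m a (toℕ v)
  ≤place a (suc c) v = ≤-trans (m≤n+m a n) (≤place (n + a) c v)

  reorder : ∀ j a → j * n + (n + a) ≡ n + j * n + a
  reorder j a = trans (sym (+-assoc (j * n) n a)) (cong (_+ a) (+-comm (j * n) n))

  place< : ∀ {j} a (c : Fin j) v → place a c v < j * n + a
  place< {suc j} a zero    v = ≤-trans (+-monoˡ-< a (toℕ<n v))
      (≤-trans (m≤n+m (n + a) (j * n)) (≤-reflexive (reorder j a)))
  place< {suc j} a (suc c) v = ≤-trans (place< (n + a) c v) (≤-reflexive (reorder j a))

  length-rows : ∀ {j} (row : Fin j → List ℕ) → (∀ c → length (row c) ≡ n) →
      length (concat (List.tabulate row)) ≡ j * n
  length-rows {zero}  row ≡n = refl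
  length-rows {suc j} row ≡n = trans (length-++ (row zero))
      (cong₂ _+_ (≡n zero) (length-rows (row ∘ suc) (≡n ∘ suc)))

  seg-rows : ∀ {j} (p : Fin j → Fin n → ℕ) {m a} → Seg m a (concat (List.tabulate λ c → List.tabulate (p c))) →
    ∀ c v → m (place a c v) ≡ p c v
  seg-rows p s zero    v = seg-tabulate (p zero) (proj₁ (seg-++ (List.tabulate (p zero)) s)) v
  seg-rows p {m} {a} s (suc c) v = seg-rows (p ∘ suc)
    (subst (λ l → Seg m (l + a) (concat (List.tabulate λ c → List.tabulate (p (suc c)))))
        (length-tabulate (p zero)) (proj₂ (seg-++ (List.tabulate (p zero)) s))) c v

  seg-rows⁺ : ∀ {j} (row : Fin j → List ℕ) {m a} → (∀ c → length (row c) ≡ n) →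
    (∀ c → Seg m (toℕ c * n + a) (row c)) → Seg m a (concat (List.tabulate row))
  seg-rows⁺ {zero}  row ≡n segs = tt
  seg-rows⁺ {suc j} row {m} {a} ≡n segs = seg-++⁺ (row zero) (segs zero)
    (seg-rows⁺ (row ∘ suc) (≡n ∘ suc) λ c → subst (λ b → Seg m b (row (suc c)))
      (trans (sym (reorder (toℕ c) a)) (cong (λ l → toℕ c * n + (l + a)) (sym (≡n zero)))) (segs (suc c)))

  seg-bits : ∀ {j m a} (xs : Vec.Vec Bool j) → (∀ v → m (toℕ v + a) ≡ bit (Vec.lookup xs v)) →
    Seg m a (List.map bit (Vec.toList xs))
  seg-bits Vec.[] eq = tt
  seg-bits {m = m} {a} (x Vec.∷ xs) eq = eq zero , seg-bits xs λ v →
      trans (cong m (+-suc (toℕ v) a)) (eq (suc v))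

  length-bits : ∀ {j} (xs : Vec.Vec Bool j) → length (List.map bit (Vec.toList xs)) ≡ j
  length-bits Vec.[]       = refl
  length-bits (x Vec.∷ xs) = cong suc (length-bits xs)

Σ<-* : ∀ {j} (g : Fin j → ℕ) w → Σ< (λ v → g v * w) ≡ Σ< g * w
Σ<-* {zero}  g w = refl
Σ<-* {suc j} g w = trans (cong (g zero * w +_) (Σ<-* (g ∘ suc) w)) (sym (*-distribʳ-+ w (g zero) _))

Σ<-affine : ∀ {j} a b (g : Fin j → ℕ) → Σ< (λ v → a + b * g v) ≡ j * a + b * Σ< g
Σ<-affine {zero}  a b g = sym (*-zeroʳ b)
Σ<-affine {suc j} a b g = trans (cong (a + b * g zero +_) (Σ<-affine a b (g ∘ suc)))
    (rearrange a b (g zero) j (Σ< (g ∘ suc)))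
  where
  rearrange : ∀ a b x j y → a + b * x + (j * a + b * y) ≡ a + j * a + b * (x + y)
  rearrange = solve-∀

module Preparation (k ℓ : ℕ) where

  open Families k ℓ using (K)

  multiply : Program
  multiply = whilenz var 9 loop (10 ≔ var 7 ⊞ var 10 ⨾ 9 ≔ var 9 ⊟ lit 1)

  -- Register 2 starts at the weight s of the class and collects all scaled profits, so after the
  -- row it holds (1 + P) * s, the next weight. Repeated addition takes time linear in the profit,
  -- hence O(Q) for all products of a row.
  scaleRow : Program
  scaleRow = whilenz var 8 ⊟ var 3 loop
    (9 ≔ load (var 3) ⨾ 10 ≔ lit 0 ⨾ multiply ⨾ [ var 3 ]≔ var 10 ⨾ 2 ≔ var 2 ⊞ var 10 ⨾ 3 ≔ lit 1 ⊞ var 3)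

  scaleRows : ℕ → ℕ → Program
  scaleRows o zero    = skip
  scaleRows o (suc j) =
    ([ var 0 ⊞ lit o ]≔ var 2 ⨾ 7 ≔ var 2 ⨾ 8 ≔ var 1 ⊞ var 3 ⨾ scaleRow) ⨾ scaleRows (suc o) j

  -- Clearing register 12 first extends the register list to its full length of 13, the shape that
  -- `registers` and `regs` expect.
  prepare : Program
  prepare = 12 ≔ lit 0 ⨾ 1 ≔ load (lit 0) ⨾ 2 ≔ lit K ⨾ 3 ≔ lit 1 ⨾ scaleRows 0 k ⨾
    6 ≔ var 3 ⊟ lit 1 ⨾ 5 ≔ var 0 ⊞ (lit (suc k) ⊞ var 6)

  module _ (n N : ℕ) where

    open Places n

    registers : (scale a r₇ r₈ r₉ r₁₀ : ℕ) → List ℕ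
    registers s a r₇ r₈ r₉ r₁₀ = N ∷ n ∷ s ∷ a ∷ 0 ∷ 0 ∷ 0 ∷ r₇ ∷ r₈ ∷ r₉ ∷ r₁₀ ∷ 0 ∷ 0 ∷ []

    exec-multiply : ∀ x {s a w e y m} → Exec multiply (registers s a w e x y) m (x * 10 + 2) λ vs′ m′ →
      m′ ≡ m × vs′ ≡ registers s a w e 0 (x * w + y)
    exec-multiply zero    = exec-exit refl (refl , refl)
    exec-multiply (suc x) {s} {a} {w} {e} {y} = within (≤-reflexive (+-assoc 10 (x * 10) 2))
      (exec-loop (λ ()) (exec-⨾ (exec-≔ (exec-≔ (exec-map
        (λ (eq , eq′) → eq , trans eq′ (cong (registers s a w e 0) (rearrange x w y))) (exec-multiply x))))))
      where
      rearrange : ∀ x w y → x * w + (w + y) ≡ w + x * w + y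
      rearrange = solve-∀

    exec-scaleRow : ∀ j (g : Fin j → ℕ) {s a w e r₉ r₁₀ m} → e ≡ j + a → (∀ v → m (toℕ v + a) ≡ g v) →
      Exec scaleRow (registers s a w e r₉ r₁₀) m (Σ< (λ v → 22 + 10 * g v) + 4) λ vs′ m′ →
        ∃[ r₉′ ] ∃[ r₁₀′ ] (vs′ ≡ registers (s + Σ< (λ v → g v * w)) e w e r₉′ r₁₀′ ×
          (∀ v → m′ (toℕ v + a) ≡ g v * w) × (∀ b → b < a ⊎ e ≤ b → m′ b ≡ m b))
    exec-scaleRow zero g {s} {a} {w} {r₉ = r₉} {r₁₀} refl row = exec-exit (n∸n≡0 a)
      (r₉ , r₁₀ , cong (λ s → registers s a w a r₉ r₁₀) (sym (+-identityʳ s)) , (λ ()) , λ _ _ → refl)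
    exec-scaleRow (suc j) g {s} {a} {w} {m = m} refl row = within (≤-reflexive (cost≡ (g zero) _))
      (exec-loop (∸-suc≢0 (s≤s (m≤n+m a j))) (exec-⨾ (exec-≔ (exec-⨾ (exec-≔ (exec-⨾ (subst
        (λ x → Exec multiply (registers s a w (suc j + a) x 0) m (g zero * 10 + 2) Continue) (sym (row zero))
        (exec-map (λ { (refl , refl) → exec-⨾ (exec-[]≔ (exec-⨾ (exec-≔ (exec-≔ (exec-map rest
            (exec-scaleRow j (g ∘ suc) (sym (+-suc j a)) λ v →
              trans (elsewhere (later v)) (trans (cong m (+-suc (toℕ v) a)) (row (suc v)))))))))})
          (exec-multiply (g zero))))))))))
      where
      w₀ = g zero * w + 0
      m₁ = m [ a ↦ w₀ ]
      cost≡ : ∀ x y → 4 + (3 + (2 + (x * 10 + 2 + (3 + (4 + 4))))) + (y + 4) ≡ 22 + 10 * x + y + 4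
      cost≡ = solve-∀
      elsewhere : ∀ {b} → b ≢ a → m₁ b ≡ m b
      elsewhere = update-other m w₀
      later : ∀ (v : Fin j) → toℕ v + suc a ≢ a
      later v e = <⇒≢ (m≤n+m (suc a) (toℕ v)) (sym e)
      Post : List ℕ → Memory → Set
      Post vs′ m′ = ∃[ r₉′ ] ∃[ r₁₀′ ]
          (vs′ ≡ registers (s + Σ< (λ v → g v * w)) (suc j + a) w (suc j + a) r₉′ r₁₀′ ×
          (∀ v → m′ (toℕ v + a) ≡ g v * w) × (∀ b → b < a ⊎ suc j + a ≤ b → m′ b ≡ m b))
      Continue : List ℕ → Memory → Set
      Continue vs m = Exec ([ var 3 ]≔ var 10 ⨾ 2 ≔ var 2 ⊞ var 10 ⨾ 3 ≔ lit 1 ⊞ var 3) vs m 11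
        λ vs′ m′ → Exec scaleRow vs′ m′ (Σ< (λ v → 22 + 10 * g (suc v)) + 4) Post
      rest : ∀ {vs′ m′} → ∃[ r₉′ ] ∃[ r₁₀′ ]
          (vs′ ≡ registers (s + w₀ + Σ< (λ v → g (suc v) * w)) (suc j + a) w (suc j + a) r₉′ r₁₀′ ×
          (∀ v → m′ (toℕ v + suc a) ≡ g (suc v) * w) × (∀ b → b < suc a ⊎ suc j + a ≤ b → m′ b ≡ m₁ b)) →
              Post vs′ m′
      rest {m′ = m′} (r₉ , r₁₀ , eq , scaled , same) = r₉ , r₁₀ ,
        trans eq (cong (λ s → registers s (suc j + a) w (suc j + a) r₉ r₁₀)
          (trans (+-assoc s w₀ _) (cong (λ x →
              s + (x + Σ< (λ v → g (suc v) * w))) (+-identityʳ (g zero * w))))) ,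
        (λ { zero → trans (same a (inj₁ (n<1+n a))) (trans (update-same m w₀ refl) (+-identityʳ _))
           ; (suc v) → trans (cong m′ (sym (+-suc (toℕ v) a))) (scaled v) }) ,
        λ where
          b (inj₁ b<a) → trans (same b (inj₁ (<-trans b<a (n<1+n a)))) (elsewhere (<⇒≢ b<a))
          b (inj₂ ≤b)  → trans (same b (inj₂ ≤b)) (elsewhere (≢-sym (<⇒≢ (≤-trans (s≤s (m≤n+m a j)) ≤b))))

    Scaled : ∀ {j} (p : Fin j → Fin n → ℕ) (o a s : ℕ) → Memory → List ℕ → Memory → Set
    Scaled {j} p o a s m vs′ m′ = ∃[ r₇ ] ∃[ r₈ ] ∃[ r₉ ] ∃[ r₁₀ ] (
      vs′ ≡ registers (top s (Σ< ∘ p)) (j * n + a) r₇ r₈ r₉ r₁₀ ×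
      (∀ c v → m′ (place a c v) ≡ p c v * scale s (Σ< ∘ p) c) ×
      (∀ (c : Fin j) → m′ (N + (toℕ c + o)) ≡ scale s (Σ< ∘ p) c) ×
      (∀ b → b < a ⊎ j * n + a ≤ b → b < N + o ⊎ N + (j + o) ≤ b → m′ b ≡ m b))

    module _ {E B : ℕ} (1≤E : 1 ≤ E) (n≤E : n ≤ E) where

      exec-scaleRows : ∀ j (p : Fin j → Fin n → ℕ) o {a s r₇ r₈ r₉ r₁₀ m} → (∀ c → Σ< (p c) < B) →
        (∀ c v → m (place a c v) ≡ p c v) → j * n + a ≤ N →
        Exec (scaleRows o j) (registers s a r₇ r₈ r₉ r₁₀) m (j * (47 * (E * B)) + 1) (Scaled p o a s m)
      exec-scaleRows zero p o {a} {s} {r₇} {r₈} {r₉} {r₁₀} _ _ _ =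
          exec-skip (r₇ , r₈ , r₉ , r₁₀ , refl , (λ ()) , (λ ()) , λ _ _ _ → refl)
      exec-scaleRows (suc j) p o {a} {s} {m = m} p<B given fits = within
        (≤-trans (+-monoˡ-≤ _ row-cost) (≤-reflexive (sym (+-assoc (47 * (E * B)) (j * (47 * (E * B))) 1))))
        (exec-⨾ (exec-⨾ (exec-[]≔ (exec-⨾ (exec-≔ (exec-⨾ (exec-≔ (exec-map others
          (exec-scaleRow n (p zero) refl λ v →
              trans (elsewhere (place {suc j} a zero v) (inside zero v)) (given zero v))))))))))
        where
        P₀ = Σ< (p zero)
        m₁ = m [ N + o ↦ s ]
        fits′ : j * n + (n + a) ≤ N
        fits′ = subst (_≤ N) (sym (reorder j a)) fits
        n+a≤N : n + a ≤ N
        n+a≤N = ≤-trans (m≤n+m (n + a) (j * n)) fits′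
        elsewhere : ∀ b → b < N → m₁ b ≡ m b
        elsewhere b b<N = update-other m s (<⇒≢ (<-≤-trans b<N (m≤m+n N o)))
        inside : ∀ c v → place a c v < N
        inside c v = <-≤-trans (place< a c v) fits
        row-cost : 5 + (2 + (4 + (Σ< (λ v → 22 + 10 * p zero v) + 4))) ≤ 47 * (E * B)
        row-cost = +-cost (E * B) 5 42 (c≤c*X 5 1≤EB)
            (+-cost (E * B) 2 40 (c≤c*X 2 1≤EB) (+-cost (E * B) 4 36 (c≤c*X 4 1≤EB)
          (+-cost (E * B) 32 4 (≤-trans (≤-reflexive (Σ<-affine 22 10 (p zero))) (+-cost (E * B) 22 10
            (≤-trans (≤-reflexive (*-comm n 22)) (*-monoʳ-≤ 22 (≤-trans n≤E (m≤m*n E B {{>-nonZero 1≤B}}))))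
            (*-monoʳ-≤ 10 (≤-trans (<⇒≤ (p<B zero)) (m≤n*m B E {{>-nonZero 1≤E}})))))
            (c≤c*X 4 1≤EB))))
          where
          1≤B : 1 ≤ B
          1≤B = m<n⇒0<n (p<B zero)
          1≤EB : 1 ≤ E * B
          1≤EB = *-mono-≤ 1≤E 1≤B
        others : ∀ {vs₂ m₂} → ∃[ r₉ ] ∃[ r₁₀ ]
            (vs₂ ≡ registers (s + Σ< (λ v → p zero v * s)) (n + a) s (n + a) r₉ r₁₀ ×
            (∀ v → m₂ (toℕ v + a) ≡ p zero v * s) × (∀ b → b < a ⊎ n + a ≤ b → m₂ b ≡ m₁ b)) →
          Exec (scaleRows (suc o) j) vs₂ m₂ (j * (47 * (E * B)) + 1) (Scaled p o a s m)
        others {m₂ = m₂} (r₉ , r₁₀ , refl , scaled , same) = subst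
          (λ x → Exec (scaleRows (suc o) j) (registers x (n + a) s (n + a) r₉ r₁₀) m₂
              (j * (47 * (E * B)) + 1) (Scaled p o a s m))
          (cong (s +_) (sym (Σ<-* (p zero) s)))
          (exec-map finished (exec-scaleRows j (p ∘ suc) (suc o) (p<B ∘ suc)
            (λ c v → trans (same _ (inj₂ (≤place (n + a) c v)))
                (trans (elsewhere _ (inside (suc c) v)) (given (suc c) v)))
            fits′))
          where
          finished : ∀ {vs′ m′} → Scaled (p ∘ suc) (suc o) (n + a) (suc P₀ * s) m₂ vs′ m′ →
              Scaled p o a s m vs′ m′
          finished {m′ = m′} (r₇ , r₈ , r₉ , r₁₀ , eq , values , scales , same′) = r₇ , r₈ , r₉ , r₁₀ ,
            trans eq (cong (λ a → registers (top s (Σ< ∘ p)) a r₇ r₈ r₉ r₁₀) (reorder j a)) ,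
            (λ { zero v → trans (same′ _ (inj₁ (+-monoˡ-< a (toℕ<n v)))
                (inj₁ (<-≤-trans (inside zero v) (m≤m+n N (suc o))))) (scaled v)
               ; (suc c) v → values c v }) ,
            (λ { zero → trans (same′ (N + o) (inj₂ (≤-trans fits′ (m≤m+n N o))) (inj₁ (+-monoʳ-< N (n<1+n o))))
                  (trans (same (N + o) (inj₂ (≤-trans n+a≤N (m≤m+n N o)))) (update-same m s refl))
               ; (suc c) → trans (cong (λ x → m′ (N + x)) (sym (+-suc (toℕ c) o))) (scales c) }) ,
            λ b outside outside′ → trans (same′ b (below outside) (beside outside′))
              (trans (same b (below₁ outside)) (update-other m s (apart outside′)))
            where
            below : ∀ {b} → b < a ⊎ suc j * n + a ≤ b → b < n + a ⊎ j * n + (n + a) ≤ b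
            below (inj₁ b<a) = inj₁ (<-≤-trans b<a (m≤n+m a n))
            below {b} (inj₂ ≤b) = inj₂ (subst (_≤ b) (sym (reorder j a)) ≤b)
            below₁ : ∀ {b} → b < a ⊎ suc j * n + a ≤ b → b < a ⊎ n + a ≤ b
            below₁ (inj₁ b<a) = inj₁ b<a
            below₁ (inj₂ ≤b) = inj₂ (≤-trans (m≤n+m (n + a) (j * n)) (≤-trans (≤-reflexive (reorder j a)) ≤b))
            beside : ∀ {b} → b < N + o ⊎ N + (suc j + o) ≤ b → b < N + suc o ⊎ N + (j + suc o) ≤ b
            beside (inj₁ b<) = inj₁ (<-trans b< (+-monoʳ-< N (n<1+n o)))
            beside {b} (inj₂ ≤b) = inj₂ (subst (λ x → N + x ≤ b) (sym (+-suc j o)) ≤b)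
            apart : ∀ {b} → b < N + o ⊎ N + (suc j + o) ≤ b → b ≢ N + o
            apart (inj₁ b<) = <⇒≢ b<
            apart (inj₂ ≤b) = ≢-sym (<⇒≢ (<-≤-trans (+-monoʳ-< N (s≤s (m≤n+m o j))) ≤b))

-- Correctness and running time

module Assembly (k ℓ : ℕ) where
  open Outcome k ℓ
  open Programs k ℓ
  open Preparation k ℓ

  reconstruct : Program
  reconstruct = 3 ≔ lit 1 ⊞ var 5 ⨾ [ var 5 ]≔ var 8 ⨾ walk ⨾ 0 ≔ var 0 ⊞ lit (suc k) ⨾ 1 ≔ var 6

  solver : Program
  solver = prepare ⨾ evaluate ⨾ select ⨾ reconstruct

module Correctness (k ℓ : ℕ) .{{k≢0 : NonZero k}} .{{ℓ≢0 : NonZero ℓ}} {n : ℕ}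
  (G : Graph (Fin n)) (σ : Expression ℓ n) (p : Fin k → Fin n → ℕ) (constructs : σ Constructs G) where

  open Families k ℓ
  open Profits p
  open Programs k ℓ
  open Outcome k ℓ
  open Preparation k ℓ
  open Assembly k ℓ
  open Places n

  kn N lo E Q B : ℕ
  kn = k * n
  N  = length (inputWords p σ)
  lo = N + (suc k + kn)
  E  = ∣ σ ∣ᵉ
  Q  = maxProfit p
  B  = Q + 1

  rows : List ℕ
  rows = concat (List.tabulate λ j → List.tabulate (p j))

  N≡ : N ≡ E + (kn + 1)
  N≡ = trans (cong suc (trans (length-++ rows)
      (cong (_+ E) (length-rows (λ j → List.tabulate (p j)) (λ j → length-tabulate (p j))))))
    (rearrange kn E)
    where
    rearrange : ∀ x y → 1 + (x + y) ≡ y + (x + 1)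
    rearrange = solve-∀

  1≤k : 1 ≤ k
  1≤k = >-nonZero⁻¹ k

  1≤ℓ : 1 ≤ ℓ
  1≤ℓ = >-nonZero⁻¹ ℓ

  2≤lo : 2 ≤ lo
  2≤lo = ≤-trans (s≤s 1≤k) (≤-trans (m≤m+n (suc k) kn) (m≤n+m (suc k + kn) N))

  1≤M : 1 ≤ M
  1≤M = ≤-trans (s≤s z≤n) (code-bound {d = λ _ → 0} {worth} 0 (s≤s z≤n) (λ _ → z≤n))

  worth≤Q : ∀ c → worth c ≤ Q
  worth≤Q c = ≤-trans (≤-reflexive (sym (total-full (p c)))) (≤max (λ j → total {k} (p j) full) c)

  worth<B : ∀ c → worth c < B
  worth<B c = ≤-trans (s≤s (worth≤Q c)) (≤-reflexive (+-comm 1 Q))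

  M≤ : M ≤ B ^ k
  M≤ = ≤-trans (top≤ 1 worth≤Q) (≤-reflexive (trans (*-identityˡ _) (cong (_^ k) (+-comm 1 Q))))

  1≤E : 1 ≤ E
  1≤E = positive σ
    where
    positive : ∀ (σ : Expression ℓ n) → 1 ≤ ∣ σ ∣ᵉ
    positive (vertex i v) = s≤s z≤n
    positive (σ ⊕ τ)      = ≤-trans (≤-trans (positive σ) (m≤m+n _ _))
        (≤-reflexive (sym (length-++ (encode σ))))
    positive (η i j _ σ)  = ≤-trans (≤-trans (positive σ) (m≤m+n _ _))
        (≤-reflexive (sym (length-++ (encode σ))))
    positive (ρ i j _ σ)  = ≤-trans (≤-trans (positive σ) (m≤m+n _ _))
        (≤-reflexive (sym (length-++ (encode σ))))

  input : Memory
  input = word (inputWords p σ)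

  input-seg : Seg input 1 (rows ++ encode σ)
  input-seg = seg-from (rows ++ encode σ) λ i → cong input (+-comm i 1)

  input-rows : Seg input 1 rows
  input-rows = proj₁ (seg-++ rows input-seg)

  pc₀ : ℕ
  pc₀ = kn + 1

  input-code : Seg input pc₀ (encode σ)
  input-code = subst (λ l → Seg input (l + 1) (encode σ))
    (length-rows (λ j → List.tabulate (p j)) (λ j → length-tabulate (p j))) (proj₂ (seg-++ rows input-seg))

  pc₀≤N : pc₀ ≤ N
  pc₀≤N = ≤-trans (m≤n+m pc₀ E) (≤-reflexive (sym N≡))

  N≤lo : N ≤ lo
  N≤lo = m≤m+n N _

  -- The weight of a vertex is the code of a vector with a single digit, and a single profit is at
  -- most the total one.
  weight<M : ∀ c v → p c v * scale 1 worth c < M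
  weight<M c v = subst (_< M) (code-single {P = worth} c (p c v))
    (code-bound {P = worth} 0 (s≤s z≤n) single≤)
    where
    single≤ : ∀ c′ → (if does (c′ Fin.≟ c) then p c v else 0) ≤ worth c′
    single≤ c′ with c′ Fin.≟ c
    ... | yes refl = term≤Σ< (p c) v
    ... | no _     = z≤n

  record Prepared (base : Memory) : Set where
    field
      values  : ∀ c v → base (place 1 c v) ≡ p c v * scale K worth c
      scales  : ∀ (c : Fin k) → base (N + (toℕ c + 0)) ≡ scale K worth c
      program : Seg base pc₀ (encode σ)
      zeros   : ∀ b → N + k ≤ b → base b ≡ 0

  exec-prepare : Exec prepare (N ∷ []) input (19 + (k * (47 * (E * B)) + 1)) λ vs base →
    Prepared base × ∃[ r₇ ] ∃[ r₈ ] ∃[ r₉ ] ∃[ r₁₀ ]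
      vs ≡ N ∷ n ∷ M * K ∷ pc₀ ∷ 0 ∷ lo ∷ kn ∷ r₇ ∷ r₈ ∷ r₉ ∷ r₁₀ ∷ 0 ∷ 0 ∷ []
  exec-prepare = within (≤-reflexive (cost≡ (k * (47 * (E * B)))))
    (exec-⨾ (exec-≔ (exec-⨾ (exec-≔ (exec-⨾ (exec-≔ (exec-⨾ (exec-≔ (exec-⨾ (exec-map finished
      (exec-scaleRows n N 1≤E (vertices≤ G σ constructs) k p 0 worth<B (seg-rows p input-rows) pc₀≤N)))))))))))
    where
    cost≡ : ∀ x → 2 + (3 + (2 + (2 + (x + 1 + (4 + 6))))) ≡ 19 + (x + 1)
    cost≡ = solve-∀
    top≡ : top K worth ≡ M * K
    top≡ = trans (cong (λ a → top a worth) (sym (*-identityˡ K))) (top-* {P = worth} 1 K)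
    finished : ∀ {vs base} → Scaled n N p 0 1 K input vs base →
      Exec (6 ≔ var 3 ⊟ lit 1 ⨾ 5 ≔ var 0 ⊞ (lit (suc k) ⊞ var 6)) vs base 10 λ vs′ base′ →
        Prepared base′ × ∃[ r₇ ] ∃[ r₈ ] ∃[ r₉ ] ∃[ r₁₀ ]
          vs′ ≡ N ∷ n ∷ M * K ∷ pc₀ ∷ 0 ∷ lo ∷ kn ∷ r₇ ∷ r₈ ∷ r₉ ∷ r₁₀ ∷ 0 ∷ 0 ∷ []
    finished {base = base} (r₇ , r₈ , r₉ , r₁₀ , refl , values , scales , same) = exec-⨾ (exec-≔ (exec-≔
      (record
        { values  = values
        ; scales  = scales
        ; program = seg-cong (encode σ) (λ b pc₀≤b b< → same b (inj₂ pc₀≤b)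
            (inj₁ (<-≤-trans b< (≤-reflexive (trans (sym N≡) (sym (+-identityʳ N))))))) input-code
        ; zeros   = λ b ≤b → trans (same b (inj₂ (≤-trans pc₀≤N (≤-trans (m≤m+n N k) ≤b)))
            (inj₂ (subst (λ x → N + x ≤ b) (sym (+-identityʳ k)) ≤b)))
            (word-beyond (inputWords p σ) (≤-trans (m≤m+n N k) ≤b))
        } , r₇ , r₈ , r₉ , r₁₀ , cong₂
          (λ z x → N ∷ n ∷ z ∷ pc₀ ∷ 0 ∷ N + (suc k + x) ∷ x ∷ r₇ ∷ r₈ ∷ r₉ ∷ r₁₀ ∷ 0 ∷ 0 ∷ [])
          top≡ (m+n∸n≡m kn 1))))

  Solved : List ℕ → Memory → Set
  Solved vs m = ∃[ X ] (IsOptimal G p X × word vs 1 ≡ length (outputWords X) ×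
      Seg m (word vs 0) (outputWords X))

  module AfterPreparation (base : Memory) (prepared : Prepared base) where
    open Prepared prepared
    open Bridge k ℓ n M N kn lo p base 1≤k 1≤ℓ 2≤lo 1≤M
    open Evaluation k ℓ n M N kn lo weight base 1≤k 1≤ℓ 2≤lo 1≤M

    pos≡ : ∀ c v → pos c v ≡ suc v + c * n
    pos≡ zero    v = cong suc (sym (+-identityʳ v))
    pos≡ (suc c) v = trans (cong (n +_) (pos≡ c v)) (rearrange n v (c * n))
      where
      rearrange : ∀ n v x → n + (1 + v + x) ≡ 1 + v + (n + x)
      rearrange = solve-∀

    place-pos : ∀ (c : Fin k) v → place 1 c v ≡ pos (toℕ c) (toℕ v)
    place-pos c v = trans (place≡ 1 c v) (trans (rearrange (toℕ v) (toℕ c * n)) (sym (pos≡ (toℕ c) (toℕ v))))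
      where
      rearrange : ∀ v x → v + (x + 1) ≡ 1 + v + x
      rearrange = solve-∀

    place-slot : ∀ (c : Fin k) v → place (N + suc k) c v ≡ slot c v
    place-slot c v = trans (place≡ (N + suc k) c v) (trans (rearrange (toℕ v) (toℕ c * n) N k)
      (cong (λ x → N + (k + x)) (sym (pos≡ (toℕ c) (toℕ v)))))
      where
      rearrange : ∀ v x N k → v + (x + (N + (1 + k))) ≡ N + (k + (1 + v + x))
      rearrange = solve-∀

    pos<pc₀ : ∀ c v → pos (toℕ c) (toℕ v) < pc₀
    pos<pc₀ c v = subst (_< pc₀) (place-pos c v) (place< 1 c v)

    pos<lo : ∀ c v → pos (toℕ c) (toℕ v) < lo
    pos<lo c v = <-≤-trans (pos<pc₀ c v) (≤-trans pc₀≤N N≤lo)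

    slot<lo : ∀ c v → slot c v < lo
    slot<lo c v = +-monoʳ-< N (<-≤-trans (+-monoʳ-< k (pos<pc₀ c v)) (≤-reflexive (rearrange k kn)))
      where
      rearrange : ∀ k x → k + (x + 1) ≡ 1 + k + x
      rearrange = solve-∀

    slot-injective : ∀ c c′ v v′ → slot c v ≡ slot c′ v′ → c ≡ c′ × v ≡ v′
    slot-injective c c′ v v′ e =
      let v≡ , c≡ = divmod-unique n (toℕ c) (toℕ c′) (toℕ<n v) (toℕ<n v′)
            (suc-injective (trans (sym (pos≡ (toℕ c) (toℕ v)))
              (trans (+-cancelˡ-≡ k _ _ (+-cancelˡ-≡ N _ _ e)) (pos≡ (toℕ c′) (toℕ v′)))))
      in toℕ-injective c≡ , toℕ-injective v≡

    weights : ∀ c v → base (pos (toℕ c) (toℕ v)) ≡ weight c v * K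
    weights c v = begin
      base (pos (toℕ c) (toℕ v))       ≡⟨ cong base (place-pos c v) ⟨
      base (place 1 c v)               ≡⟨ values c v ⟩
      p c v * scale K worth c          ≡⟨ cong (λ a → p c v * scale a worth c) (*-identityˡ K) ⟨
      p c v * scale (1 * K) worth c    ≡⟨ cong (p c v *_) (scale-* {P = worth} 1 K c) ⟩
      p c v * (scale 1 worth c * K)    ≡⟨ *-assoc (p c v) _ K ⟨
      weight c v * K                   ∎
      where open ≡-Reasoning

    -- Each vertex is named by exactly one leaf, so no profit is counted twice. This rules out
    -- carries in the codes for the whole expression.
    profit≤ : ∀ f c → profit σ f c ≤ worth c
    profit≤ f c = ≤-trans (≤-reflexive
        (profit-matches G σ constructs f (classes G σ constructs f) (classes-match G σ constructs f) c))
      (total≤ (p c) (classes G σ constructs f c))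

    codeOf<M : ∀ f → codeOf σ f < M
    codeOf<M f = code-bound {P = worth} 0 (s≤s z≤n) (profit≤ f)

    satisfaction≡ : ∀ {f X} → Matches σ f X → satisfaction p X ≡ least (profit σ f) Z
    satisfaction≡ {f} {X} matches = trans (sym (min-cong (profit-matches G σ constructs f X matches)))
      (sym (least-min worth (profit σ f) (≤-trans (<⇒≤ (codeOf<M f)) (m≤m*n M K {{>-nonZero 1≤K}}))))

    decompose : ∀ {q t} → Solutions σ everything q t → ∃[ d ] ((∀ c → d c ≤ worth c) × code 1 worth d ≡ q)
    decompose x = let f , _ , q≡ , _ = realise σ x in profit σ f , profit≤ f , q≡

    contains-slot : ∀ f c v → contains (slot c v) (witness σ f) ≡ does
        (≡-dec Fin._≟_ (f (vertexOf G σ constructs v)) (just c))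
    contains-slot f c v with ≡-dec Fin._≟_ (f (vertexOf G σ constructs v)) (just c)
    ... | yes fu = contains-witness σ f (vertexOf G σ constructs v)
        (cong₂ target fu (name-vertexOf G σ constructs v))
    ... | no f≢ = contains-witness⁻ σ f λ u e → avoid u (f u) refl e
      where
      avoid : ∀ u x → f u ≡ x → target x (name σ u) ≢ slot c v
      -- Slots are at least `k`, hence positive, whereas uncolored vertices have address 0.
      avoid u nothing  fu e = <⇒≢ (≤-trans 1≤k (≤-trans (m≤m+n k _) (m≤n+m _ N))) e
      avoid u (just c′) fu e = let c≡ , v≡ = slot-injective c′ c (name σ u) v e in
        f≢ (trans (cong f (trans (cong (vertexOf G σ constructs) (sym v≡))
            (vertexOf-name G σ constructs u))) (trans fu (cong just c≡)))

    module _ {m : Memory} {S H : ℕ} (config : Config m S H (Solutions σ ∷ [])) where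
      open Config config
      open Selection n M N kn lo weight base 1≤k 1≤ℓ 2≤lo 1≤M (Solutions σ) worth B worth<B decompose
        (proj₁ stack) (λ c → trans (agree _ (+-monoʳ-< N (<-≤-trans (+-monoˡ-< 0 (toℕ<n c))
          (≤-trans (≤-reflexive (+-identityʳ k)) (≤-trans (n≤1+n k) (m≤m+n (suc k) kn)))))) (scales c))

      present : ∀ {f} → Fits σ everything f → Present (codeOf σ f)
      present {f} F = Table.complete (proj₁ stack) everything _ _ (solution σ F) (codeOf<M f)

      exec-reconstruct : ∀ {vs m′ pc} → Best pc M vs m′ →
          Exec reconstruct vs m′ (4 + (3 + (E * 32 + 4 + 6))) Solved
      -- The coloring with all classes empty occupies a cell for `everything`, so the search cannot
      -- end with 0.
      exec-reconstruct (best (inj₁ refl) maximal) = contradiction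
        (maximal _ (codeOf<M nobody) (present {nobody} record { independent = λ () ; contained = λ () })
          (profit σ nobody) (profit≤ nobody) refl) λ ()
        where
        nobody : Vertex σ → Maybe (Fin k)
        nobody _ = nothing
      exec-reconstruct {pc = pc} (best {ptr = ptr} (inj₂ (t , d , candidate , points , refl)) maximal)
        with realise σ (Candidate.solves candidate)
      ... | f , F , q≡ , refl = within
        (+-monoʳ-≤ 7 (+-monoˡ-≤ 6 (+-monoˡ-≤ 4 (*-monoˡ-≤ 32 (size-witness σ f)))))
        (exec-⨾ (exec-≔ (exec-⨾ (exec-[]≔ (exec-⨾
          (exec-walk n M N kn lo weight base 1≤k 1≤ℓ 2≤lo 1≤M t lo≤H ≤-refl points′ λ {m′} written →
            exec-exit (n∸n≡0 H) (exec-⨾ (exec-≔ (exec-≔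
              (X , optimal , sym (length-rows _ (λ c → length-bits (X c))) , output written))))))))))
        where
        X : Fin k → Subset n
        X = classes G σ constructs f
        m₁ : Memory
        m₁ = m [ H ↦ ptr ]
        points′ : Points m₁ H (m₁ H) t
        points′ = subst (λ a → Points m₁ H a t) (sym (update-same m {H} ptr refl))
          (points-frame t (λ b _ b<H → update-other m ptr (<⇒≢ b<H)) ≤-refl points)
        d≡ : ∀ c → profit σ f c ≡ d c
        d≡ = proj₂ (code-unique {P = worth} {a =
            1} {0} {0} (s≤s z≤n) (s≤s z≤n) (profit≤ f) (Candidate.bounded candidate) q≡)
        optimal : IsOptimal G p X
        optimal = record
          { coloring = classes-color G σ constructs F
          ; maximal  = λ Y coloring → let g = color G σ constructs Y coloring in
              subst₂ _≤_ (sym (satisfaction≡ {g} {Y} (color-matches G σ constructs Y coloring)))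
                (trans (sym (least-cong Z d≡)) (sym (satisfaction≡ {f} {X} (classes-match G σ constructs f))))
                (s≤s⁻¹ (maximal _ (codeOf<M g) (present {g} (color-fits G σ constructs Y coloring))
                    (profit σ g) (profit≤ g) refl))
          }
        output : ∀ {m′} → (∀ b → b < H → m′ b ≡ (if contains b t then 1 else m₁ b)) →
            Seg m′ (N + suc k) (outputWords X)
        output {m′} written = seg-rows⁺ (λ c → List.map bit (Vec.toList (X c))) (λ c → length-bits (X c))
          λ c → seg-bits (X c) λ v → trans (cong m′ (trans (sym (place≡ (N + suc k) c v)) (place-slot c v)))
            (trans (written _ (<-≤-trans (slot<lo c v) lo≤H))
              (trans (cong₂ (λ b x → if b then 1 else x) (contains-slot f c v) (untouched c v))
                (cong bit (sym (lookup∘tabulate _ v)))))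
          where
          untouched : ∀ c v → m₁ (slot c v) ≡ 0
          untouched c v = trans (update-other m ptr (<⇒≢ (<-≤-trans (slot<lo c v) lo≤H)))
            (trans (agree _ (slot<lo c v)) (zeros _ (+-monoʳ-≤ N (m≤m+n k _))))

      exec-output : ∀ {pc r₇ r₈ r₉ r₁₀ r₁₁ r₁₂} →
          Exec (select ⨾ reconstruct) (regs pc S H r₇ r₈ r₉ r₁₀ r₁₁ r₁₂) m
        (66 * (M * (k * B)) + (4 + (3 + (E * 32 + 4 + 6)))) Solved
      exec-output = exec-⨾ (exec-map exec-reconstruct exec-select)

    initially : Config base 0 lo []
    initially = record
      { lo≤H  = ≤-refl
      ; agree = λ _ _ → refl
      ; fresh = λ b lo≤b → zeros b (≤-trans (+-monoʳ-≤ N (≤-trans (n≤1+n k) (m≤m+n (suc k) kn))) lo≤b)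
      ; stack = tt
      }

    exec-solve : ∀ {r₇ r₈ r₉ r₁₀ r₁₁ r₁₂} →
      Exec (evaluate ⨾ select ⨾ reconstruct) (regs pc₀ 0 lo r₇ r₈ r₉ r₁₀ r₁₁ r₁₂) base
        (E * (4 + nodeCost) + 4 + (66 * (M * (k * B)) + (4 + (3 + (E * 32 + 4 + 6))))) Solved
    exec-solve = exec-⨾ (exec-evaluate N≤lo weights pos<lo slot<lo weight<M σ program
      (≤-reflexive (sym N≡)) (at initially) λ { (at config) →
        exec-exit (m≤n⇒m∸n≡0 (≤-reflexive N≡)) (exec-output config) })

  W : ℕ
  W = 4 ^ (k * ℓ) * E * B ^ (2 * k)

  K*K≡ : K * K ≡ 4 ^ (k * ℓ)
  K*K≡ = begin
    K * K                    ≡⟨ cong (K *_) (*-identityʳ K) ⟨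
    K ^ 2                    ≡⟨ ^-*-assoc 2 (k * ℓ) 2 ⟩
    2 ^ (k * ℓ * 2)          ≡⟨ cong (2 ^_) (*-comm (k * ℓ) 2) ⟩
    2 ^ (2 * (k * ℓ))        ≡⟨ ^-*-assoc 2 2 (k * ℓ) ⟨
    4 ^ (k * ℓ)              ∎
    where open ≡-Reasoning

  W≡ : W ≡ K * K * E * (B ^ k * B ^ k)
  W≡ = cong₂ (λ x y → x * E * y) (sym K*K≡)
    (trans (cong (B ^_) (cong (k +_) (+-identityʳ k))) (^-distribˡ-+-* B k k))

  1≤B : 1 ≤ B
  1≤B = m≤n+m 1 Q

  1≤B^k : 1 ≤ B ^ k
  1≤B^k = m^n>0 B {{>-nonZero 1≤B}} k

  B≤B^k : B ≤ B ^ k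
  B≤B^k = ≤-trans (≤-reflexive (sym (^-identityʳ B))) (^-monoʳ-≤ B {{>-nonZero 1≤B}} 1≤k)

  ≤W : ∀ {a b c d e} → a ≤ K → b ≤ K → c ≤ E → d ≤ B ^ k → e ≤ B ^ k → a * b * c * (d * e) ≤ W
  ≤W a≤ b≤ c≤ d≤ e≤ = ≤-trans (*-mono-≤ (*-mono-≤ (*-mono-≤ a≤ b≤) c≤) (*-mono-≤ d≤ e≤)) (≤-reflexive (sym W≡))

  1≤W : 1 ≤ W
  1≤W = ≤W {1} {1} {1} {1} {1} 1≤K 1≤K 1≤E 1≤B^k 1≤B^k

  E≤W : E ≤ W
  E≤W = ≤-trans (≤-reflexive (rearrange E)) (≤W {1} {1} {E} {1} {1} 1≤K 1≤K ≤-refl 1≤B^k 1≤B^k)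
    where
    rearrange : ∀ x → x ≡ 1 * 1 * x * (1 * 1)
    rearrange = solve-∀

  prepare-cost : k * (47 * (E * B)) ≤ 47 * W
  prepare-cost = ≤-trans (≤-reflexive (rearrange k E B))
    (*-monoʳ-≤ 47 (≤W {k} {1} {E} {B} {1} (k≤K 1≤ℓ) 1≤K ≤-refl B≤B^k 1≤B^k))
    where
    rearrange : ∀ k e b → k * (47 * (e * b)) ≡ 47 * (k * 1 * e * (b * 1))
    rearrange = solve-∀

  evaluate-cost : E * (4 + 250 * (K * K * (M * M))) ≤ 254 * W
  evaluate-cost = ≤-trans (≤-reflexive (rearrange E (K * K) (M * M)))
    (+-cost W 4 250 (*-monoʳ-≤ 4 E≤W) (*-monoʳ-≤ 250 (≤W {K} {K} {E} {M} {M} ≤-refl ≤-refl ≤-refl M≤ M≤)))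
    where
    rearrange : ∀ e x y → e * (4 + 250 * (x * y)) ≡ 4 * e + 250 * (x * e * y)
    rearrange = solve-∀

  select-cost : 66 * (M * (k * B)) ≤ 66 * W
  select-cost = *-monoʳ-≤ 66 (≤-trans (≤-reflexive (rearrange M k B))
    (≤W {k} {1} {1} {M} {B} (k≤K 1≤ℓ) 1≤K 1≤E M≤ B≤B^k))
    where
    rearrange : ∀ m k b → m * (k * b) ≡ k * 1 * 1 * (m * b)
    rearrange = solve-∀

  -- The constant is 440 = 67 + 258 + 66 + 49, for preparation, evaluation, selection and
  -- reconstruction.
  exec-solver : Exec solver (N ∷ []) input (440 * W) Solved
  exec-solver = within
    (+-cost W 67 373 (+-cost W 19 48 (c≤c*X 19 1≤W) (+-cost W 47 1 prepare-cost (c≤c*X 1 1≤W)))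
      (+-cost W 258 115 (+-cost W 254 4 evaluate-cost (c≤c*X 4 1≤W))
        (+-cost W 66 49 select-cost (+-cost W 4 45 (c≤c*X 4 1≤W) (+-cost W 3 42 (c≤c*X 3 1≤W)
          (+-cost W 36 6 (+-cost W 32 4 (≤-trans (≤-reflexive (*-comm E 32)) (*-monoʳ-≤ 32 E≤W))
              (c≤c*X 4 1≤W)) (c≤c*X 6 1≤W)))))))
    (exec-⨾ (exec-map (λ { (prepared , _ , _ , _ , _ , refl) → AfterPreparation.exec-solve _ prepared })
        exec-prepare))

  solves-within : ∀ {P C} → Exec P (N ∷ []) input C Solved → SolvesWithin P G σ p C
  solves-within (exec x) with x {(λ _ → 0) [ 0 ↦ N ]} (λ { zero → refl ; (suc _) → refl })
  ... | f , vs , m , t , run , f≗ , t≤ , X , optimal , size≡ , seg = record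
    { final   = ⟨ f , m ⟩
    ; steps   = t
    ; run     = run
    ; inTime  = t≤
    ; X       = X
    ; output  = record
      { size  = trans (f≗ 1) size≡
      ; words = λ i → trans (cong (λ a → m (a + toℕ i)) (f≗ 0)) (seg-lookup (outputWords X) seg i)
      }
    ; optimal = optimal
    }

  solves : SolvesWithin solver G σ p (440 * W)
  solves = solves-within exec-solver

theorem4 : ∃[ c ] ((k ℓ : ℕ) → .{{_ : NonZero k}} → .{{_ : NonZero ℓ}} →
    ∃[ P ] (∀ {n : ℕ} (G : Graph (Fin n)) (σ : Expression ℓ n) (p : Fin k → Fin n → ℕ) →
    CliqueWidth≤ G ℓ → σ Constructs G →
    SolvesWithin P G σ p
    (c * (4 ^ (k * ℓ) * ∣ σ ∣ᵉ * (maxProfit p + 1) ^ (2 * k)))))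
theorem4 = 440 , λ k ℓ → Assembly.solver k ℓ , λ G σ p _ constructs → Correctness.solves k ℓ G σ p constructs
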